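{- Let $k,\ell\in\mathbb{N}$, let $h\in (S V_k\otimes \bigwedge V_{2\ell})^*$ be a $(k,2\ell)$-color edge coloring model, and let $f=p_h$ be its (mixed) partition function, a graph parameter $f:\mathcal{G}\to\mathbb{C}$. For $t\in\mathbb{N}$ let $M_{f,t}$ be the $t$-th edge-connection matrix of $f$. Then $$\mathrm{rk}(M_{f,t})\le (k+2\ell)^t\quad\text{for each } t\in\mathbb{N}.$$
   Context: Conventions. $\mathbb{N}=\mathbb{Z}_{\ge 0}$ and $[n]=\{1,\dots,n\}$. All graphs are finite and may have loops and multiple edges. The circle $\bigcirc$, a single edge with empty vertex set, is regarded as a connected graph, so graphs may have components that are circles. $\mathcal{G}$ denotes the set of all graphs (up to isomorphism). A loop at $v$ is incident with $v$ twice: it counts twice in the degree of $v$ and occurs twice among the edges incident with $v$. Fragments and edge-connection matrices. A $t$-fragment is a graph having $t$ vertices of degree one labeled $1,\dots,t$ (its other vertices are unlabeled); $\mathcal{F}_t$ is the collection of all $t$-fragments. For $F_1,F_2\in\mathcal{F}_t$, the graph $F_1*F_2\in\mathcal{G}$ is obtained from the disjoint union $F_1\cup F_2$ as follows: for each $i\in[t]$, remove the two vertices labeled $i$ and glue together the edge of $F_1$ and the edge of $F_2$ that were incident with them, into a single edge. (Gluing edges both of whose endpoints are labeled may create circles.) For $f:\mathcal{G}\to\mathbb{C}$, the matrix $M_{f,t}$ is the infinite $\mathcal{F}_t\times\mathcal{F}_t$ matrix with $M_{f,t}(F_1,F_2)=f(F_1*F_2)$; $\mathrm{rk}$ denotes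 its rank over $\mathbb{C}$. Algebra. $V_k$ is a complex vector space with basis $e_1,\dots,e_k$, and $V_{2\ell}$ is a complex vector space with basis $f_1,\dots,f_{2\ell}$. $SV_k$ is the symmetric algebra of $V_k$ (product written $\odot$) and $\bigwedge V_{2\ell}$ is the exterior algebra of $V_{2\ell}$ (product $\wedge$); empty products equal $1$. $(\cdot)^*$ is the full linear dual. Define $g_i:=-f_{i+\ell}$ for $i\le \ell$ and $g_i:=f_{i-\ell}$ for $i>\ell$. Eulerian subsets, orientations and pairings. Let $G=(V,E)$ be a graph. A subset $F\subseteq E$ is Eulerian if every vertex has even degree in $G(F):=(V,F)$. An Eulerian orientation $\omega$ of $F$ is an orientation of the edges in $F$ such that at each vertex the number of incoming arcs equals the number of outgoing arcs (a loop is both incoming and outgoing at its vertex). A local pairing $\kappa$ of $G(F)$ is, for each $v\in V$, a decomposition $\kappa_v$ of the edges of $F$ incident with $v$ into ordered pairs; it is compatible with $\omega$ if for each $v\in V$ and each $(a_1,a_2)\in\kappa_v$, $a_1$ is incoming at $v$ and $a_2$ is outgoing at $v$ under $\omega$ (so $\kappa_v$ is a bijection from the arcs of $F$ incoming at $v$ to those outgoing at $v$). Following each arc $a_1$ by the arc $a_2$ with which it is paired at the head of $a_1$ decomposes $F$ into circuits; $c(\kappa)$ is the number of these circuits, where each circle contained in $F$ counts as one circuit. Mixed partition functions. An element $h\in (SV_k\otimes\bigwedge V_{2\ell})^*$ is called a $(k,2\ell)$-color edge coloring model. For $F\subseteq E$ Eulerian, with Eulerian orientation $\omega$ and compatible local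 pairing $\kappa$, set $$s_h(G,F,\omega,\kappa):=(-1)^{c(\kappa)}\sum_{\substack{\phi:F\to[2\ell]\\ \psi:E\setminus F\to[k]}}\ \prod_{v\in V}h\Big(\bigodot_{a\in\delta_{E\setminus F}(v)}e_{\psi(a)}\otimes\bigwedge_{(a_1,a_2)\in\kappa_v} f_{\phi(a_1)}\wedge g_{\phi(a_2)}\Big),$$ where $\delta_{E\setminus F}(v)$ is the collection of edges incident with $v$ not in $F$ (loops occurring twice). This value is known to be independent of the choice of $\omega$ and $\kappa$ and is denoted $s_h(G,F)$. The partition function of $h$ is $$p_h(G):=\sum_{F\subseteq E,\ F\text{ Eulerian}}s_h(G,F).$$ In particular $p_h(\bigcirc)=k-2\ell$. -}

module Defs where

open import Algebra.Bundles using (CommutativeRing; RawMonoid; RawRing)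
open import Algebra.Module.Bundles using (RawLeftModule)
open import Algebra.Module.Construct.TensorUnit using (rawLeftModule)
open import Algebra.Module.Morphism.Structures using (IsLeftModuleHomomorphism)
open import Data.Bool using (Bool; true; false; if_then_else_; not)
open import Data.Fin as Fin using (Fin; zero; suc; toℕ; _↑ˡ_; _↑ʳ_; splitAt)
open import Data.Fin.Permutation using (Permutation′; _⟨$⟩ʳ_)
import Data.Fin.Properties as Fin
open import Data.Fin.Subset using (Subset; inside; outside; _∈_; _∉_; ∁; ⊤)
open import Data.List using (List; []; _∷_; _++_; length; lookup; map; mapMaybe)
open import Data.Maybe using (Maybe; just; nothing)
open import Data.Maybe.Properties using (≡-dec)
open import Data.Nat as ℕ using (ℕ; zero; suc; _+_; _≤_; +-0-rawMonoid)
open import Data.Nat.Divisibility using (_∣_; _∣?_)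
open import Data.Nat.GeneralisedArithmetic using (fold)
import Data.Nat.Properties as ℕₚ
open import Data.Product using (Σ; ∃-syntax; _×_; _,_; proj₁; proj₂)
open import Data.Rational as ℚ using (ℚ; 0ℚ; 1ℚ; ½; ∣_∣)
import Data.Rational.Properties as ℚₚ
open import Data.Rational.Solver using (module +-*-Solver)
open import Data.Sum as Sum using (_⊎_; inj₁; inj₂; [_,_]′)
open import Data.Sum.Properties using () renaming (≡-dec to ⊎-≡-dec)
open import Data.Vec using ([]; _∷_; here; there)
open import Data.Vec.Functional using (Vector)
open import Level using (0ℓ)
open import Relation.Binary.Bundles using (Setoid)
open import Relation.Binary.Core using (Rel)
open import Relation.Binary.Definitions using (DecidableEquality)
open import Relation.Nullary using (Dec; yes; no; does)
open import Relation.Binary.PropositionalEquality using (_≡_; refl; sym; trans; cong; subst)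

-- Cauchy sequences; two of them represent the same real number if _≃_ holds.
record ℝ : Set where
  no-eta-equality
  field
    seq    : ℕ → ℚ
    cauchy : ∀ ε → 0ℚ ℚ.< ε → ∃[ N ] ∀ m n → N ℕ.≤ m → N ℕ.≤ n → ∣ seq m ℚ.- seq n ∣ ℚ.< ε

open ℝ

infix 4 _≃_

record _≃_ (x y : ℝ) : Set where
  constructor close
  field
    closeness : ∀ ε → 0ℚ ℚ.< ε → ∃[ N ] ∀ n → N ℕ.≤ n → ∣ seq x n ℚ.- seq y n ∣ ℚ.< ε

private
  open +-*-Solver using (solve; con; _:=_; _:+_; _:*_; :-_; _:-_)

  -- i is far out when rank i is large; this covers single indices as well as
  -- pairs of indices.
  module Small {I : Set} (rank : I → ℕ) where

    record Small (s : I → ℚ) : Set where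
      constructor small
      field
        smallness : ∀ ε → 0ℚ ℚ.< ε → ∃[ N ] ∀ i → N ℕ.≤ rank i → ∣ s i ∣ ℚ.< ε

    open Small public

    Bounded : (I → ℚ) → Set
    Bounded b = ∃[ B ] ℚ.Positive B × ∃[ N ] ∀ i → N ℕ.≤ rank i → ∣ b i ∣ ℚ.≤ B

    resp : ∀ {s t} → (∀ i → s i ≡ t i) → Small s → Small t
    resp {s} {t} eq (small s-small) = small λ ε ε>0 → let (N , bound) = s-small ε ε>0 in
      N , λ i N≤i → subst (λ q → ∣ q ∣ ℚ.< ε) (eq i) (bound i N≤i)

    zeroₛ : Small (λ _ → 0ℚ)
    zeroₛ = small λ ε ε>0 → 0 , λ _ _ → ε>0

    negₛ : ∀ {s} → Small s → Small (λ i → ℚ.- s i)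
    negₛ {s} (small s-small) = small λ ε ε>0 → let (N , bound) = s-small ε ε>0 in
      N , λ i N≤i → subst (ℚ._< ε) (sym (ℚₚ.∣-p∣≡∣p∣ (s i))) (bound i N≤i)

    addₛ : ∀ {s t} → Small s → Small t → Small (λ i → s i ℚ.+ t i)
    addₛ {s} {t} (small s-small) (small t-small) = small λ ε ε>0 →
      let ε/2>0          = subst (ℚ._< ½ ℚ.* ε) (ℚₚ.*-zeroʳ ½) (ℚₚ.*-monoʳ-<-pos ½ ε>0)
          (M , s-bound) = s-small (½ ℚ.* ε) ε/2>0
          (N , t-bound) = t-small (½ ℚ.* ε) ε/2>0
      in M ℕ.⊔ N , λ i far → begin-strict
        ∣ s i ℚ.+ t i ∣       ≤⟨ ℚₚ.∣p+q∣≤∣p∣+∣q∣ (s i) (t i) ⟩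
        ∣ s i ∣ ℚ.+ ∣ t i ∣   <⟨ ℚₚ.+-mono-< (s-bound i (ℕₚ.m⊔n≤o⇒m≤o M N far))
                                            (t-bound i (ℕₚ.m⊔n≤o⇒n≤o M N far)) ⟩
        ½ ℚ.* ε ℚ.+ ½ ℚ.* ε   ≡⟨ ℚₚ.*-distribʳ-+ ε ½ ½ ⟨
        1ℚ ℚ.* ε              ≡⟨ ℚₚ.*-identityˡ ε ⟩
        ε                     ∎
      where open ℚₚ.≤-Reasoning

    mulₛ : ∀ {b s} → Bounded b → Small s → Small (λ i → b i ℚ.* s i)
    mulₛ {b} {s} (B , B>0 , M , bound) (small s-small) = small λ ε ε>0 →
      let δ             = ℚ.1/ B ℚ.* ε
          δ>0           = subst (ℚ._< δ) (ℚₚ.*-zeroʳ (ℚ.1/ B)) (ℚₚ.*-monoʳ-<-pos (ℚ.1/ B) ε>0)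
          (N , s-bound) = s-small δ δ>0
      in M ℕ.⊔ N , λ i far → begin-strict
        ∣ b i ℚ.* s i ∣       ≡⟨ ℚₚ.∣p*q∣≡∣p∣*∣q∣ (b i) (s i) ⟩
        ∣ b i ∣ ℚ.* ∣ s i ∣   ≤⟨ ℚₚ.*-monoʳ-≤-nonNeg ∣ s i ∣ {{ℚ.nonNegative (ℚₚ.0≤∣p∣ (s i))}}
                                   (bound i (ℕₚ.m⊔n≤o⇒m≤o M N far)) ⟩
        B ℚ.* ∣ s i ∣         <⟨ ℚₚ.*-monoʳ-<-pos B (s-bound i (ℕₚ.m⊔n≤o⇒n≤o M N far)) ⟩
        B ℚ.* (ℚ.1/ B ℚ.* ε)  ≡⟨ ℚₚ.*-assoc B (ℚ.1/ B) ε ⟨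
        B ℚ.* ℚ.1/ B ℚ.* ε    ≡⟨ cong (ℚ._* ε) (ℚₚ.*-inverseʳ B) ⟩
        1ℚ ℚ.* ε              ≡⟨ ℚₚ.*-identityˡ ε ⟩
        ε                     ∎
      where
      open ℚₚ.≤-Reasoning
      instance
        _ = B>0
        _ = ℚₚ.pos⇒nonZero B
        _ = ℚₚ.1/pos⇒pos B

  module S₁ = Small {ℕ} (λ n → n)
  module S₂ = Small {ℕ × ℕ} (λ (m , n) → m ℕ.⊓ n)

  difference : ℝ → ℕ × ℕ → ℚ
  difference x (m , n) = seq x m ℚ.- seq x n

  to₂ : ∀ x → S₂.Small (difference x)
  to₂ x = S₂.small λ ε ε>0 → let (N , bound) = cauchy x ε ε>0 in
    N , λ (m , n) far → bound m n (ℕₚ.m≤n⊓o⇒m≤n m n far) (ℕₚ.m≤n⊓o⇒m≤o m n far)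

  from₂ : ∀ (s : ℕ → ℚ) → S₂.Small (λ (m , n) → s m ℚ.- s n) →
          ∀ ε → 0ℚ ℚ.< ε → ∃[ N ] ∀ m n → N ℕ.≤ m → N ℕ.≤ n → ∣ s m ℚ.- s n ∣ ℚ.< ε
  from₂ s (S₂.small s-small) ε ε>0 = let (N , bound) = s-small ε ε>0 in
    N , λ m n N≤m N≤n → bound (m , n) (ℕₚ.⊓-glb N≤m N≤n)

  to₁ : ∀ {x y} → x ≃ y → S₁.Small (λ n → seq x n ℚ.- seq y n)
  to₁ (close x≃y) = S₁.small x≃y

  from₁ : ∀ {x y} → S₁.Small (λ n → seq x n ℚ.- seq y n) → x ≃ y
  from₁ (S₁.small s-small) = close s-small

  1+∣_∣-positive : ∀ q → ℚ.Positive (1ℚ ℚ.+ ∣ q ∣)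
  1+∣ q ∣-positive = ℚₚ.pos+nonNeg⇒pos 1ℚ ∣ q ∣ {{ℚ.nonNegative (ℚₚ.0≤∣p∣ q)}}

  ∣p-q∣<1⇒∣p∣≤1+∣q∣ : ∀ p q → ∣ p ℚ.- q ∣ ℚ.< 1ℚ → ∣ p ∣ ℚ.≤ 1ℚ ℚ.+ ∣ q ∣
  ∣p-q∣<1⇒∣p∣≤1+∣q∣ p q near = begin
    ∣ p ∣                       ≡⟨ cong ∣_∣ (solve 2 (λ p q → p := (p :- q) :+ q) refl p q) ⟩
    ∣ (p ℚ.- q) ℚ.+ q ∣         ≤⟨ ℚₚ.∣p+q∣≤∣p∣+∣q∣ (p ℚ.- q) q ⟩
    ∣ p ℚ.- q ∣ ℚ.+ ∣ q ∣       ≤⟨ ℚₚ.+-monoˡ-≤ ∣ q ∣ (ℚₚ.<⇒≤ near) ⟩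
    1ℚ ℚ.+ ∣ q ∣                ∎
    where open ℚₚ.≤-Reasoning

  bounded : ∀ x → ∃[ B ] ℚ.Positive B × ∃[ N ] ∀ n → N ℕ.≤ n → ∣ seq x n ∣ ℚ.≤ B
  bounded x with cauchy x 1ℚ (ℚₚ.positive⁻¹ 1ℚ)
  ... | N , bound = 1ℚ ℚ.+ ∣ seq x N ∣ , 1+∣ seq x N ∣-positive , N , λ n N≤n →
    ∣p-q∣<1⇒∣p∣≤1+∣q∣ (seq x n) (seq x N) (bound n N N≤n ℕₚ.≤-refl)

  boundedˡ : ∀ x → S₂.Bounded (λ (m , n) → seq x m)
  boundedˡ x = let (B , B>0 , N , bound) = bounded x in B , B>0 , N , λ (m , n) far → bound m (ℕₚ.m≤n⊓o⇒m≤n m n far)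

  boundedʳ : ∀ x → S₂.Bounded (λ (m , n) → seq x n)
  boundedʳ x = let (B , B>0 , N , bound) = bounded x in B , B>0 , N , λ (m , n) far → bound n (ℕₚ.m≤n⊓o⇒m≤o m n far)

  +-difference : ∀ a b c d → (a ℚ.- b) ℚ.+ (c ℚ.- d) ≡ (a ℚ.+ c) ℚ.- (b ℚ.+ d)
  +-difference = solve 4 (λ a b c d → (a :- b) :+ (c :- d) := (a :+ c) :- (b :+ d)) refl

  *-difference : ∀ a b c d → a ℚ.* (c ℚ.- d) ℚ.+ d ℚ.* (a ℚ.- b) ≡ a ℚ.* c ℚ.- b ℚ.* d
  *-difference = solve 4 (λ a b c d → a :* (c :- d) :+ d :* (a :- b) := a :* c :- b :* d) refl

  neg-difference : ∀ a b → ℚ.- (a ℚ.- b) ≡ (ℚ.- a) ℚ.- (ℚ.- b)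
  neg-difference = solve 2 (λ a b → :- (a :- b) := (:- a) :- (:- b)) refl

infixl 6 _+ᴿ_
infixl 7 _*ᴿ_
infix  8 -ᴿ_

fromℚ : ℚ → ℝ
fromℚ q .seq _ = q
fromℚ q .cauchy = from₂ (λ _ → q) (S₂.resp (λ _ → sym (ℚₚ.+-inverseʳ q)) S₂.zeroₛ)

_+ᴿ_ _*ᴿ_ : ℝ → ℝ → ℝ
(x +ᴿ y) .seq n = seq x n ℚ.+ seq y n
(x +ᴿ y) .cauchy = from₂ (λ n → seq x n ℚ.+ seq y n) (S₂.resp
  (λ (m , n) → +-difference (seq x m) (seq x n) (seq y m) (seq y n))
  (S₂.addₛ (to₂ x) (to₂ y)))
(x *ᴿ y) .seq n = seq x n ℚ.* seq y n
(x *ᴿ y) .cauchy = from₂ (λ n → seq x n ℚ.* seq y n) (S₂.resp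
  (λ (m , n) → *-difference (seq x m) (seq x n) (seq y m) (seq y n))
  (S₂.addₛ (S₂.mulₛ (boundedˡ x) (to₂ y)) (S₂.mulₛ (boundedʳ y) (to₂ x))))

-ᴿ_ : ℝ → ℝ
(-ᴿ x) .seq n = ℚ.- seq x n
(-ᴿ x) .cauchy = from₂ (λ n → ℚ.- seq x n) (S₂.resp
  (λ (m , n) → neg-difference (seq x m) (seq x n))
  (S₂.negₛ (to₂ x)))

private
  pointwise : ∀ {x y} → (∀ n → seq x n ≡ seq y n) → x ≃ y
  pointwise {x} {y} eq = from₁ (S₁.resp
    (λ n → trans (sym (ℚₚ.+-inverseʳ (seq x n))) (cong (λ q → seq x n ℚ.- q) (eq n))) S₁.zeroₛ)

  ≃-sym : ∀ {x y} → x ≃ y → y ≃ x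
  ≃-sym {x} {y} x≃y = from₁ (S₁.resp
    (λ n → solve 2 (λ a b → :- (a :- b) := b :- a) refl (seq x n) (seq y n)) (S₁.negₛ (to₁ x≃y)))

  ≃-trans : ∀ {x y z} → x ≃ y → y ≃ z → x ≃ z
  ≃-trans {x} {y} {z} x≃y y≃z = from₁ (S₁.resp
    (λ n → solve 3 (λ a b c → (a :- b) :+ (b :- c) := a :- c) refl (seq x n) (seq y n) (seq z n))
    (S₁.addₛ (to₁ x≃y) (to₁ y≃z)))

  +ᴿ-cong : ∀ {x y u v} → x ≃ y → u ≃ v → x +ᴿ u ≃ y +ᴿ v
  +ᴿ-cong {x} {y} {u} {v} x≃y u≃v = from₁ (S₁.resp
    (λ n → +-difference (seq x n) (seq y n) (seq u n) (seq v n))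
    (S₁.addₛ (to₁ x≃y) (to₁ u≃v)))

  -ᴿ-cong : ∀ {x y} → x ≃ y → -ᴿ x ≃ -ᴿ y
  -ᴿ-cong {x} {y} x≃y = from₁ (S₁.resp
    (λ n → neg-difference (seq x n) (seq y n)) (S₁.negₛ (to₁ x≃y)))

  *ᴿ-cong : ∀ {x y u v} → x ≃ y → u ≃ v → x *ᴿ u ≃ y *ᴿ v
  *ᴿ-cong {x} {y} {u} {v} x≃y u≃v = from₁ (S₁.resp
    (λ n → *-difference (seq x n) (seq y n) (seq u n) (seq v n))
    (S₁.addₛ (S₁.mulₛ (bounded x) (to₁ u≃v)) (S₁.mulₛ (bounded v) (to₁ x≃y))))

record ℂ : Set where
  constructor _+i_
  field
    re : ℝ
    im : ℝ

open ℂ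

infix 4 _≈ᶜ_

record _≈ᶜ_ (z w : ℂ) : Set where
  constructor _,_
  field
    re≃ : re z ≃ re w
    im≃ : im z ≃ im w

private
  pointwiseᶜ : ∀ {z w} → (∀ n → seq (re z) n ≡ seq (re w) n) → (∀ n → seq (im z) n ≡ seq (im w) n) → z ≈ᶜ w
  pointwiseᶜ {z} {w} p q = pointwise {re z} {re w} p , pointwise {im z} {im w} q

infixl 6 _+ᶜ_
infixl 7 _*ᶜ_

_+ᶜ_ _*ᶜ_ : ℂ → ℂ → ℂ
(a +i b) +ᶜ (c +i d) = (a +ᴿ c) +i (b +ᴿ d)
(a +i b) *ᶜ (c +i d) = (a *ᴿ c +ᴿ -ᴿ (b *ᴿ d)) +i (a *ᴿ d +ᴿ b *ᴿ c)

-ᶜ_ : ℂ → ℂ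
-ᶜ (a +i b) = (-ᴿ a) +i (-ᴿ b)

0ᶜ 1ᶜ : ℂ
0ᶜ = fromℚ 0ℚ +i fromℚ 0ℚ
1ᶜ = fromℚ 1ℚ +i fromℚ 0ℚ

private
  ≈ᶜ-sym : ∀ {z w} → z ≈ᶜ w → w ≈ᶜ z
  ≈ᶜ-sym (p , q) = ≃-sym p , ≃-sym q

  ≈ᶜ-trans : ∀ {z w u} → z ≈ᶜ w → w ≈ᶜ u → z ≈ᶜ u
  ≈ᶜ-trans (p , q) (p′ , q′) = ≃-trans p p′ , ≃-trans q q′

  +ᶜ-cong : ∀ {z w u v} → z ≈ᶜ w → u ≈ᶜ v → z +ᶜ u ≈ᶜ w +ᶜ v
  +ᶜ-cong (p , q) (r , s) = +ᴿ-cong p r , +ᴿ-cong q s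

  *ᶜ-cong : ∀ {z w u v} → z ≈ᶜ w → u ≈ᶜ v → z *ᶜ u ≈ᶜ w *ᶜ v
  *ᶜ-cong (p , q) (r , s) =
    +ᴿ-cong (*ᴿ-cong p r) (-ᴿ-cong (*ᴿ-cong q s)) , +ᴿ-cong (*ᴿ-cong p s) (*ᴿ-cong q r)

  -ᶜ-cong : ∀ {z w} → z ≈ᶜ w → -ᶜ z ≈ᶜ -ᶜ w
  -ᶜ-cong (p , q) = -ᴿ-cong p , -ᴿ-cong q

  *ᶜ-comm : ∀ z w → z *ᶜ w ≈ᶜ w *ᶜ z
  *ᶜ-comm (a +i b) (c +i d) = pointwiseᶜ
    (λ n → solve 4 (λ a b c d → a :* c :- b :* d := c :* a :- d :* b) refl
      (seq a n) (seq b n) (seq c n) (seq d n))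
    (λ n → solve 4 (λ a b c d → a :* d :+ b :* c := c :* b :+ d :* a) refl
      (seq a n) (seq b n) (seq c n) (seq d n))

  *ᶜ-assoc : ∀ z w u → (z *ᶜ w) *ᶜ u ≈ᶜ z *ᶜ (w *ᶜ u)
  *ᶜ-assoc (a +i b) (c +i d) (e +i f) = pointwiseᶜ
    (λ n → solve 6 (λ a b c d e f →
        (a :* c :- b :* d) :* e :- (a :* d :+ b :* c) :* f
        := a :* (c :* e :- d :* f) :- b :* (c :* f :+ d :* e)) refl
      (seq a n) (seq b n) (seq c n) (seq d n) (seq e n) (seq f n))
    (λ n → solve 6 (λ a b c d e f →
        (a :* c :- b :* d) :* f :+ (a :* d :+ b :* c) :* e
        := a :* (c :* f :+ d :* e) :+ b :* (c :* e :- d :* f)) refl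
      (seq a n) (seq b n) (seq c n) (seq d n) (seq e n) (seq f n))

  *ᶜ-identityˡ : ∀ z → 1ᶜ *ᶜ z ≈ᶜ z
  *ᶜ-identityˡ (a +i b) = pointwiseᶜ
    (λ n → solve 2 (λ a b → con 1ℚ :* a :- con 0ℚ :* b := a) refl (seq a n) (seq b n))
    (λ n → solve 2 (λ a b → con 1ℚ :* b :+ con 0ℚ :* a := b) refl (seq a n) (seq b n))

  *ᶜ-distribˡ-+ᶜ : ∀ z w u → z *ᶜ (w +ᶜ u) ≈ᶜ z *ᶜ w +ᶜ z *ᶜ u
  *ᶜ-distribˡ-+ᶜ (a +i b) (c +i d) (e +i f) = pointwiseᶜ
    (λ n → solve 6 (λ a b c d e f →
        a :* (c :+ e) :- b :* (d :+ f) := (a :* c :- b :* d) :+ (a :* e :- b :* f)) refl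
      (seq a n) (seq b n) (seq c n) (seq d n) (seq e n) (seq f n))
    (λ n → solve 6 (λ a b c d e f →
        a :* (d :+ f) :+ b :* (c :+ e) := (a :* d :+ b :* c) :+ (a :* f :+ b :* e)) refl
      (seq a n) (seq b n) (seq c n) (seq d n) (seq e n) (seq f n))

  +ᶜ-identityˡ : ∀ z → 0ᶜ +ᶜ z ≈ᶜ z
  +ᶜ-identityˡ (a +i b) = pointwiseᶜ (λ n → ℚₚ.+-identityˡ (seq a n)) (λ n → ℚₚ.+-identityˡ (seq b n))

  -ᶜ-inverseˡ : ∀ z → -ᶜ z +ᶜ z ≈ᶜ 0ᶜ
  -ᶜ-inverseˡ (a +i b) = pointwiseᶜ (λ n → ℚₚ.+-inverseˡ (seq a n)) (λ n → ℚₚ.+-inverseˡ (seq b n))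

  +ᶜ-assoc : ∀ z w u → (z +ᶜ w) +ᶜ u ≈ᶜ z +ᶜ (w +ᶜ u)
  +ᶜ-assoc (a +i b) (c +i d) (e +i f) = pointwiseᶜ
    (λ n → ℚₚ.+-assoc (seq a n) (seq c n) (seq e n))
    (λ n → ℚₚ.+-assoc (seq b n) (seq d n) (seq f n))

  +ᶜ-comm : ∀ z w → z +ᶜ w ≈ᶜ w +ᶜ z
  +ᶜ-comm (a +i b) (c +i d) = pointwiseᶜ
    (λ n → ℚₚ.+-comm (seq a n) (seq c n)) (λ n → ℚₚ.+-comm (seq b n) (seq d n))

  ≈ᶜ-setoid : Setoid 0ℓ 0ℓ
  ≈ᶜ-setoid = record
    { Carrier       = ℂ
    ; _≈_           = _≈ᶜ_
    ; isEquivalence = record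
      { refl  = pointwiseᶜ (λ _ → refl) (λ _ → refl)
      ; sym   = ≈ᶜ-sym
      ; trans = ≈ᶜ-trans
      }
    }

  open import Algebra.Consequences.Setoid ≈ᶜ-setoid
    using (comm∧idˡ⇒id; comm∧invˡ⇒inv; comm∧distrˡ⇒distr)

ℂ-commutativeRing : CommutativeRing 0ℓ 0ℓ
ℂ-commutativeRing = record
  { Carrier = ℂ
  ; _≈_     = _≈ᶜ_
  ; _+_     = _+ᶜ_
  ; _*_     = _*ᶜ_
  ; -_      = -ᶜ_
  ; 0#      = 0ᶜ
  ; 1#      = 1ᶜ
  ; isCommutativeRing = record
    { isRing = record
      { +-isAbelianGroup = record
        { isGroup = record
          { isMonoid = record
            { isSemigroup = record
              { isMagma = record
                { isEquivalence = Setoid.isEquivalence ≈ᶜ-setoid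
                ; ∙-cong        = +ᶜ-cong
                }
              ; assoc = +ᶜ-assoc
              }
            ; identity = comm∧idˡ⇒id +ᶜ-comm +ᶜ-identityˡ
            }
          ; inverse = comm∧invˡ⇒inv +ᶜ-comm -ᶜ-inverseˡ
          ; ⁻¹-cong = -ᶜ-cong
          }
        ; comm = +ᶜ-comm
        }
      ; *-cong     = *ᶜ-cong
      ; *-assoc    = *ᶜ-assoc
      ; *-identity = comm∧idˡ⇒id *ᶜ-comm *ᶜ-identityˡ
      ; distrib    = comm∧distrˡ⇒distr +ᶜ-cong *ᶜ-comm *ᶜ-distribˡ-+ᶜ
      }
    ; *-comm = *ᶜ-comm
    }
  }

-- Edges are undirected: the order in which link lists the two ends of an edge
-- carries no meaning.  A circle is an edge without ends.
data Edge (V : Set) : Set where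
  circle : Edge V
  link   : V → V → Edge V

mapEdge : ∀ {V W : Set} → (V → W) → Edge V → Edge W
mapEdge f circle     = circle
mapEdge f (link x y) = link (f x) (f y)

record Graph : Set where
  field
    order : ℕ
    edges : List (Edge (Fin order))

  size : ℕ
  size = length edges

  edge : Fin size → Edge (Fin order)
  edge = lookup edges

module _ {c ℓ} (M : RawMonoid c ℓ) where
  open RawMonoid M

  combine : ∀ {m} (F : Subset m) → (∀ a → a ∈ F → Carrier) → Carrier
  combine []            g = ε
  combine (outside ∷ F) g = combine F (λ a a∈F → g (suc a) (there a∈F))
  combine (inside  ∷ F) g = g zero here ∙ combine F (λ a a∈F → g (suc a) (there a∈F))

module Incidence {V : Set} (_≟_ : DecidableEquality V) where

  indicator : V → V → ℕ
  indicator v x = if does (v ≟ x) then 1 else 0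

  -- The number of times e occurs among the edges incident with v.
  multiplicity : V → Edge V → ℕ
  multiplicity v circle     = 0
  multiplicity v (link x y) = indicator v x + indicator v y

  -- The degree of v in the graph with edge set F ⊆ es.
  degree : (es : List (Edge V)) → Subset (length es) → V → ℕ
  degree es F v = combine +-0-rawMonoid F (λ a _ → multiplicity v (lookup es a))

open module FinIncidence {n} = Incidence (Fin._≟_ {n}) using (multiplicity; degree)

Eulerian : (G : Graph) → Subset (Graph.size G) → Set
Eulerian G F = ∀ v → 2 ∣ degree (Graph.edges G) F v

eulerian? : ∀ G F → Dec (Eulerian G F)
eulerian? G F = Fin.all? (λ v → 2 ∣? degree (Graph.edges G) F v)

-- An orientation picks for every edge one of its two traversals.
source target : ∀ {V : Set} → Bool → Edge V → Maybe V
source _     circle     = nothing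
source true  (link x y) = just x
source false (link x y) = just y
target forwards e = source (not forwards) e

module _ (G : Graph) where
  open Graph G

  tail head : (Fin size → Bool) → Fin size → Maybe (Fin order)
  tail forwards a = source (forwards a) (edge a)
  head forwards a = target (forwards a) (edge a)

  leaves enters : (Fin size → Bool) → Fin order → Fin size → Bool
  leaves forwards v a = does (≡-dec Fin._≟_ (tail forwards a) (just v))
  enters forwards v a = does (≡-dec Fin._≟_ (head forwards a) (just v))

module _ (G : Graph) (F : Subset (Graph.size G)) where
  open Graph G

  -- Only the values of forwards on the edges of F that are not circles matter.
  record EulerianOrientation : Set where
    field
      forwards : Fin size → Bool
      balanced : ∀ v → combine +-0-rawMonoid F (λ a _ → if enters G forwards v a then 1 else 0)
                     ≡ combine +-0-rawMonoid F (λ a _ → if leaves G forwards v a then 1 else 0)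

  -- A local pairing compatible with ω.  The bijections κ_v from the arcs of F
  -- entering v to the arcs of F leaving v, v ranging over all vertices, are
  -- assembled into one permutation κ: the arc a is paired with κ a at the head
  -- of a.  Edges outside F and circles take no part in any κ_v, and κ fixes
  -- them.
  record LocalPairing (ω : EulerianOrientation) : Set where
    open EulerianOrientation ω using (forwards)
    field
      κ         : Permutation′ size
      κ-inside  : ∀ {a} → a ∈ F → κ ⟨$⟩ʳ a ∈ F
      κ-outside : ∀ {a} → a ∉ F → κ ⟨$⟩ʳ a ≡ a
      κ-circle  : ∀ {a} → edge a ≡ circle → κ ⟨$⟩ʳ a ≡ a
      κ-meets   : ∀ {a} → a ∈ F → head G forwards a ≡ tail G forwards (κ ⟨$⟩ʳ a)

    next : Fin size → Fin size
    next = κ ⟨$⟩ʳ_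

    -- The circuits are the cycles of κ on F, each of which is counted at its
    -- least element; size many iterates run through a whole cycle.
    IsLeast : Fin size → Set
    IsLeast a = ∀ (i : Fin size) → a Fin.≤ fold a next (toℕ i)

    isLeast? : ∀ a → Dec (IsLeast a)
    isLeast? a = Fin.all? (λ i → a Fin.≤? fold a next (toℕ i))

    circuits : ℕ
    circuits = combine +-0-rawMonoid F (λ a _ → if does (isLeast? a) then 1 else 0)

-- s_h(G,F) is defined through an Eulerian orientation of F and a compatible local
-- pairing, and does not depend on them; partition functions below take the
-- ones to use as an argument.
Choice : Set
Choice = ∀ G F → Eulerian G F → Σ (EulerianOrientation G F) (LocalPairing G F)

_≟ᶠ_ : ∀ {t n} → DecidableEquality (Fin t ⊎ Fin n)
_≟ᶠ_ = ⊎-≡-dec Fin._≟_ Fin._≟_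

open module FragmentIncidence {t n} = Incidence (_≟ᶠ_ {t} {n}) using ()
  renaming (degree to degreeᶠ)

-- The vertices inj₁ i are the labelled ones, the vertices inj₂ x the others.
record Fragment (t : ℕ) : Set where
  field
    order    : ℕ
    edges    : List (Edge (Fin t ⊎ Fin order))
    labelled : ∀ i → degreeᶠ edges ⊤ (inj₁ i) ≡ 1

-- Suppression of the vertex nothing, assumed to have degree two: the vertex is
-- removed and the two edge ends at it are joined.  If both ends belong to the
-- same edge, a loop at nothing, this leaves a circle.
module _ {V : Set} where

  stub : Edge (Maybe V) → Maybe V
  stub (link nothing (just x)) = just x
  stub (link (just x) nothing) = just x
  stub _                       = nothing

  rest : Edge (Maybe V) → Maybe (Edge V)
  rest circle                   = just circle
  rest (link (just x) (just y)) = just (link x y)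
  rest (link nothing nothing)   = just circle
  rest _                        = nothing

  join : List V → List (Edge V)
  join (x ∷ y ∷ _) = link x y ∷ []
  join _           = []

  suppress : List (Edge (Maybe V)) → List (Edge V)
  suppress es = join (mapMaybe stub es) ++ mapMaybe rest es

-- In F₁ ⋆ F₂ the two vertices labelled i, each of degree one, are first merged
-- into one vertex inj₁ i of degree two.  Suppressing it removes the two
-- labelled vertices and glues their edges together.
suppressAll : ∀ t {V : Set} → List (Edge (Fin t ⊎ V)) → List (Edge V)
suppressAll zero    es = map (mapEdge [ (λ ()) , (λ x → x) ]′) es
suppressAll (suc t) es = suppressAll t (suppress (map (mapEdge split) es))
  where
  split : ∀ {t} {V : Set} → Fin (suc t) ⊎ V → Maybe (Fin t ⊎ V)
  split (inj₁ zero)    = nothing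
  split (inj₁ (suc i)) = just (inj₁ i)
  split (inj₂ x)       = just (inj₂ x)

infixl 7 _⋆_

_⋆_ : ∀ {t} → Fragment t → Fragment t → Graph
F₁ ⋆ F₂ = record
  { order = order F₁ + order F₂
  ; edges = suppressAll _ (map (mapEdge (Sum.map₂ (_↑ˡ order F₂))) (edges F₁)
                        ++ map (mapEdge (Sum.map₂ (order F₁ ↑ʳ_))) (edges F₂))
  }
  where open Fragment

module Over (K : CommutativeRing 0ℓ 0ℓ) where
  open CommutativeRing K using (0#; 1#; _≈_; rawRing; +-rawMonoid; *-rawMonoid)
    renaming (Carrier to 𝕂; _+_ to _+ᴷ_; _*_ to _*ᴷ_; -_ to -ᴷ_)
  open import Algebra.Definitions.RawSemiring (RawRing.rawSemiring rawRing) using (_^_)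
  open import Algebra.Definitions.RawMonoid +-rawMonoid using () renaming (sum to ∑)
  open import Algebra.Definitions.RawMonoid *-rawMonoid using () renaming (sum to ∏)

  basis : ∀ {n} → Fin n → Vector 𝕂 n
  basis i j = if does (i Fin.≟ j) then 1# else 0#

  infixl 6 _⊞_
  infixl 7 _⊠_
  infixr 7 _·_

  -- Formal expressions for elements of the tensor algebra of K^n.
  data Expr (n : ℕ) : Set where
    ι       : Vector 𝕂 n → Expr n
    0ᵉ 1ᵉ   : Expr n
    _⊞_ _⊠_ : Expr n → Expr n → Expr n
    _·_     : 𝕂 → Expr n → Expr n

  -- Equality in the quotient of the tensor algebra of K^n by the two-sided
  -- ideal that R generates.
  data Quotient {n} (R : Rel (Expr n) 0ℓ) : Rel (Expr n) 0ℓ where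
    relation : ∀ {x y} → R x y → Quotient R x y

    ≈-refl  : ∀ {x} → Quotient R x x
    ≈-sym   : ∀ {x y} → Quotient R x y → Quotient R y x
    ≈-trans : ∀ {x y z} → Quotient R x y → Quotient R y z → Quotient R x z

    ⊞-cong : ∀ {x x′ y y′} → Quotient R x x′ → Quotient R y y′ → Quotient R (x ⊞ y) (x′ ⊞ y′)
    ⊠-cong : ∀ {x x′ y y′} → Quotient R x x′ → Quotient R y y′ → Quotient R (x ⊠ y) (x′ ⊠ y′)
    ·-cong : ∀ {c c′ x x′} → c ≈ c′ → Quotient R x x′ → Quotient R (c · x) (c′ · x′)
    ι-cong : ∀ {u v} → (∀ i → u i ≈ v i) → Quotient R (ι u) (ι v)

    ⊞-assoc     : ∀ x y z → Quotient R ((x ⊞ y) ⊞ z) (x ⊞ (y ⊞ z))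
    ⊞-comm      : ∀ x y → Quotient R (x ⊞ y) (y ⊞ x)
    ⊞-identityˡ : ∀ x → Quotient R (0ᵉ ⊞ x) x

    ·-assoc    : ∀ c d x → Quotient R ((c *ᴷ d) · x) (c · d · x)
    ·-identity : ∀ x → Quotient R (1# · x) x
    ·-zero     : ∀ x → Quotient R (0# · x) 0ᵉ
    ·-distribˡ : ∀ c x y → Quotient R (c · (x ⊞ y)) (c · x ⊞ c · y)
    ·-distribʳ : ∀ c d x → Quotient R ((c +ᴷ d) · x) (c · x ⊞ d · x)

    ⊠-assoc     : ∀ x y z → Quotient R ((x ⊠ y) ⊠ z) (x ⊠ (y ⊠ z))
    ⊠-identityˡ : ∀ x → Quotient R (1ᵉ ⊠ x) x
    ⊠-identityʳ : ∀ x → Quotient R (x ⊠ 1ᵉ) x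
    ⊠-distribˡ  : ∀ x y z → Quotient R (x ⊠ (y ⊞ z)) (x ⊠ y ⊞ x ⊠ z)
    ⊠-distribʳ  : ∀ x y z → Quotient R ((y ⊞ z) ⊠ x) (y ⊠ x ⊞ z ⊠ x)
    ·-⊠ˡ        : ∀ c x y → Quotient R ((c · x) ⊠ y) (c · (x ⊠ y))
    ·-⊠ʳ        : ∀ c x y → Quotient R (x ⊠ (c · y)) (c · (x ⊠ y))

    ι-⊞ : ∀ u v → Quotient R (ι (λ i → u i +ᴷ v i)) (ι u ⊞ ι v)
    ι-· : ∀ c v → Quotient R (ι (λ i → c *ᴷ v i)) (c · ι v)

  module _ {n} (R : Rel (Expr n) 0ℓ) where

    module-of : RawLeftModule 𝕂 0ℓ 0ℓ
    module-of = record
      { Carrierᴹ = Expr n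
      ; _≈ᴹ_     = Quotient R
      ; _+ᴹ_     = _⊞_
      ; _*ₗ_     = _·_
      ; 0ᴹ       = 0ᵉ
      ; -ᴹ_      = λ x → (-ᴷ 1#) · x
      }

    multiplication-of : RawMonoid 0ℓ 0ℓ
    multiplication-of = record
      { Carrier = Expr n
      ; _≈_     = Quotient R
      ; _∙_     = _⊠_
      ; ε       = 1ᵉ
      }

  data Commutators (n : ℕ) : Rel (Expr n) 0ℓ where
    commute : ∀ u v → Commutators n (ι u ⊠ ι v) (ι v ⊠ ι u)

  data Squares (n : ℕ) : Rel (Expr n) 0ℓ where
    square : ∀ v → Squares n (ι v ⊠ ι v) 0ᵉ

  S ⋀ : ℕ → RawLeftModule 𝕂 0ℓ 0ℓ
  S k = module-of (Commutators k)
  ⋀ n = module-of (Squares n)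

  module _ (M N : RawLeftModule 𝕂 0ℓ 0ℓ) where
    private
      module M = RawLeftModule M
      module N = RawLeftModule N

    data Tensor : Set where
      _⊗_ : M.Carrierᴹ → N.Carrierᴹ → Tensor
      0ᵗ  : Tensor
      _⊞_ : Tensor → Tensor → Tensor
      _·_ : 𝕂 → Tensor → Tensor

    infix 4 _≈ᵗ_

    data _≈ᵗ_ : Rel Tensor 0ℓ where
      ≈-refl  : ∀ {x} → x ≈ᵗ x
      ≈-sym   : ∀ {x y} → x ≈ᵗ y → y ≈ᵗ x
      ≈-trans : ∀ {x y z} → x ≈ᵗ y → y ≈ᵗ z → x ≈ᵗ z

      ⊗-cong : ∀ {x x′ y y′} → x M.≈ᴹ x′ → y N.≈ᴹ y′ → (x ⊗ y) ≈ᵗ (x′ ⊗ y′)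
      ⊞-cong : ∀ {x x′ y y′} → x ≈ᵗ x′ → y ≈ᵗ y′ → (x ⊞ y) ≈ᵗ (x′ ⊞ y′)
      ·-cong : ∀ {c c′ x x′} → c ≈ c′ → x ≈ᵗ x′ → (c · x) ≈ᵗ (c′ · x′)

      ⊞-assoc     : ∀ x y z → ((x ⊞ y) ⊞ z) ≈ᵗ (x ⊞ (y ⊞ z))
      ⊞-comm      : ∀ x y → (x ⊞ y) ≈ᵗ (y ⊞ x)
      ⊞-identityˡ : ∀ x → (0ᵗ ⊞ x) ≈ᵗ x

      ·-assoc    : ∀ c d x → ((c *ᴷ d) · x) ≈ᵗ (c · (d · x))
      ·-identity : ∀ x → (1# · x) ≈ᵗ x
      ·-zero     : ∀ x → (0# · x) ≈ᵗ 0ᵗ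
      ·-distribˡ : ∀ c x y → (c · (x ⊞ y)) ≈ᵗ ((c · x) ⊞ (c · y))
      ·-distribʳ : ∀ c d x → ((c +ᴷ d) · x) ≈ᵗ ((c · x) ⊞ (d · x))

      ⊗-⊞ˡ : ∀ x x′ y → ((x M.+ᴹ x′) ⊗ y) ≈ᵗ ((x ⊗ y) ⊞ (x′ ⊗ y))
      ⊗-⊞ʳ : ∀ x y y′ → (x ⊗ (y N.+ᴹ y′)) ≈ᵗ ((x ⊗ y) ⊞ (x ⊗ y′))
      ⊗-·ˡ : ∀ c x y → ((c M.*ₗ x) ⊗ y) ≈ᵗ (c · (x ⊗ y))
      ⊗-·ʳ : ∀ c x y → (x ⊗ (c N.*ₗ y)) ≈ᵗ (c · (x ⊗ y))

    tensorProduct : RawLeftModule 𝕂 0ℓ 0ℓ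
    tensorProduct = record
      { Carrierᴹ = Tensor
      ; _≈ᴹ_     = _≈ᵗ_
      ; _+ᴹ_     = _⊞_
      ; _*ₗ_     = _·_
      ; 0ᴹ       = 0ᵗ
      ; -ᴹ_      = λ x → (-ᴷ 1#) · x
      }

  record Dual (M : RawLeftModule 𝕂 0ℓ 0ℓ) : Set where
    field
      ⟦_⟧      : RawLeftModule.Carrierᴹ M → 𝕂
      isLinear : IsLeftModuleHomomorphism M (rawLeftModule {R = rawRing}) ⟦_⟧

  ColouringModel : ℕ → ℕ → Set
  ColouringModel k ℓ = Dual (tensorProduct (S k) (⋀ (ℓ + ℓ)))

  -- g i is - f (i + ℓ) for the first ℓ indices i and f (i - ℓ) for the last ℓ.
  f g : ∀ {ℓ} → Fin (ℓ + ℓ) → Expr (ℓ + ℓ)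
  f i = ι (basis i)
  g {ℓ} i = [ (λ j → ι (λ x → -ᴷ basis (ℓ ↑ʳ j) x)) , (λ j → ι (basis (j ↑ˡ ℓ))) ]′ (splitAt ℓ i)

  ∑⊆ : ∀ {m} → (Subset m → 𝕂) → 𝕂
  ∑⊆ {zero}  s = s []
  ∑⊆ {suc m} s = ∑⊆ (λ F → s (outside ∷ F)) +ᴷ ∑⊆ (λ F → s (inside ∷ F))

  Colouring : ∀ {m} → Subset m → ℕ → Set
  Colouring F n = ∀ a → a ∈ F → Fin n

  ∑colourings : ∀ {m} (F : Subset m) n → (Colouring F n → 𝕂) → 𝕂
  ∑colourings []            n s = s (λ _ ())
  ∑colourings (outside ∷ F) n s = ∑colourings F n (λ φ → s (λ { (suc a) (there a∈F) → φ a a∈F }))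
  ∑colourings (inside  ∷ F) n s = ∑ {n} (λ c → ∑colourings F n (λ φ →
    s (λ { zero here → c ; (suc a) (there a∈F) → φ a a∈F })))

  module _ (k ℓ : ℕ) (h : ColouringModel k ℓ) where
    open Dual h

    module _ (G : Graph) (F : Subset (Graph.size G))
             (ω : EulerianOrientation G F) (pairing : LocalPairing G F ω) where
      open Graph G
      open EulerianOrientation ω using (forwards)
      open LocalPairing pairing using (next; κ-inside; circuits)

      symmetricPart : Colouring (∁ F) k → Fin order → Expr k
      symmetricPart ψ v = combine (multiplication-of (Commutators k)) (∁ F)
        (λ a a∉F → power (multiplicity v (edge a)) (ι (basis (ψ a a∉F))))
        where
        open import Algebra.Definitions.RawMonoid (multiplication-of (Commutators k))
          using () renaming (_×_ to power)

      exteriorPart : Colouring F (ℓ + ℓ) → Fin order → Expr (ℓ + ℓ)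
      exteriorPart φ v = combine (multiplication-of (Squares (ℓ + ℓ))) F
        (λ a a∈F → if enters G forwards v a then f {ℓ} (φ a a∈F) ⊠ g {ℓ} (φ (next a) (κ-inside a∈F)) else 1ᵉ)

      s : 𝕂
      s = (-ᴷ 1#) ^ circuits *ᴷ
          ∑colourings F (ℓ + ℓ) (λ φ → ∑colourings (∁ F) k (λ ψ →
            ∏ (λ v → ⟦ symmetricPart ψ v ⊗ exteriorPart φ v ⟧)))

    module _ (choice : Choice) (G : Graph) where

      sOfEulerian : ∀ F → Dec (Eulerian G F) → 𝕂
      sOfEulerian F (yes eulerian) = let (ω , pairing) = choice G F eulerian in s G F ω pairing
      sOfEulerian F (no _)         = 0#

      partitionFunction : 𝕂
      partitionFunction = ∑⊆ (λ F → sOfEulerian F (eulerian? G F))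

  module _ {I J : Set} (M : I → J → 𝕂) where

    RowsIndependent : ∀ {n} → Vector I n → Set
    RowsIndependent {n} rows =
      ∀ (c : Vector 𝕂 n) → (∀ j → ∑ (λ i → c i *ᴷ M (rows i) j) ≈ 0#) → ∀ i → c i ≈ 0#

    -- The rank of M is the greatest number of linearly independent rows.
    Rank≤ : ℕ → Set
    Rank≤ r = ∀ {n} (rows : Vector I n) → RowsIndependent rows → n ≤ r

  connectionMatrix : (Graph → 𝕂) → ∀ t → Fragment t → Fragment t → 𝕂
  connectionMatrix p t F₁ F₂ = p (F₁ ⋆ F₂)

open Over ℂ-commutativeRing public
  using (ColouringModel; partitionFunction; connectionMatrix; Rank≤)

{-# OPTIONS --safe #-}

-- In the supersymmetric algebra with generators e i (even) and f j (odd) over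
-- every vertex, let an edge uv act as multiplication by the even element
-- Σ e i ⊗ e i - Σ f j ⊗ g j over u and v, and a circle as the scalar k - 2ℓ.
-- Then p_h(G) is the value of the tensor product of the h's on the product of
-- all edges.  Indeed, expand the product over the set F of the edges that
-- contribute an odd term.  Reordering ∏ f(φ a) g(φ a) into ∏ f(φ a) g(φ (κ a))
-- costs the sign of κ, which is (-1)^(|F| - c(κ)), and afterwards the letters at
-- each vertex are together.  If F is not Eulerian, some vertex carries an odd
-- number of odd letters.
--
-- Evaluating a vertex of degree two with the dual bilinear form joins its two
-- edges.  Hence f(F₁ * F₂) is computed from the disjoint union of F₁ and F₂ by
-- contracting the two letters at each label, and summing over the (k + 2ℓ)^t
-- colourings x of the labels gives f(F₁ * F₂) = Σ_x A(F₁, x) B(F₂, x).  Finally,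
-- over a nontrivial reduced ring more than r vectors of length r are dependent,
-- by elimination without division.

module Submission where

open import Defs

open import Algebra.Bundles using (CommutativeRing; Monoid; RawRing)
open import Algebra.Module.Morphism.Structures using (IsLeftModuleHomomorphism)
open import Data.Bool using (Bool; true; false; not; _∧_; _xor_; if_then_else_)
import Data.Bool.Properties as Bool
open import Data.Bool.Solver using (module xor-∧-Solver)
open import Data.Fin as Fin using (Fin; zero; suc; toℕ; fromℕ<; punchIn; splitAt; _↑ˡ_; _↑ʳ_)
open import Data.Fin.Permutation using (_⟨$⟩ˡ_; inverseˡ)
open import Data.Fin.Permutation.Components using (transpose; transpose-inverse)
import Data.Fin.Properties as Fin
open import Data.Fin.Subset using (Subset; inside; outside; _∈_; _∉_; ∁; ⊤)
open import Data.Fin.Subset.Properties using (x∈∁p⇒x∉p)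
open import Data.List using (List; []; _∷_; _++_; map; mapMaybe; length; lookup; concat; tabulate)
import Data.List.Properties as List
open import Data.Maybe as Maybe using (Maybe; just; nothing)
open import Data.Maybe.Properties using (≡-dec)
open import Data.Nat as ℕ using (ℕ; zero; suc; s<s; +-0-rawMonoid)
open import Data.Nat.Divisibility using (_∣_; _∣?_; divides)
open import Data.Nat.DivMod using (_%_; _/_; m≡m%n+[m/n]*n; m%n<n)
open import Data.Nat.GeneralisedArithmetic using (fold; fold-+)
import Data.Nat.Properties as ℕₚ
open import Data.Nat.Solver using (module +-*-Solver)
open import Data.Product as Product using (Σ; ∃-syntax; ∃₂; _×_; _,_; proj₁; proj₂)
open import Data.Rational as ℚ using (ℚ; 0ℚ; 1ℚ; ½)
import Data.Rational.Properties as ℚₚ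
open import Data.Rational.Solver using () renaming (module +-*-Solver to ℚ-Solver)
open import Data.Sum as Sum using (_⊎_; inj₁; inj₂; [_,_]′)
open import Data.Vec using ([]; _∷_) renaming (here to hereᵛ; there to thereᵛ)
open import Data.Vec.Functional as Vector using (Vector; insertAt)
open import Data.Vec.Functional.Properties using (insertAt-lookup; insertAt-punchIn; lookup-++ˡ; lookup-++ʳ)
open import Function using (_∘_; mk⇔)
open import Level using (0ℓ)
open import Relation.Binary.Core using (Rel)
open import Relation.Binary.Definitions using (tri<; tri≈; tri>)
import Relation.Binary.PropositionalEquality as ≡
open ≡ using (_≡_; _≢_)
import Relation.Binary.Reasoning.Setoid as SetoidReasoning
open import Relation.Nullary using (¬_; Dec; yes; no; does; contradiction)
open import Relation.Nullary.Decidable using (dec-true; dec-false; does-⇔)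
open FinIncidence using (multiplicity; degree)

-- The superalgebra is never built. An element of its dual is a function on words that obeys the
-- sign rule for neighbouring letters, and an edge acts on such functions by the transpose of
-- multiplication. Everything is thus stated on free words, without bases or normal forms.
--
-- Two obstacles shape the rest. The first is that gluing does not split at once into a product:
-- when the letters are sorted by vertex, the second fragment's letter at a label passes the
-- remaining letters of the first fragment, and the resulting sign depends on both. Since the form
-- at a label pairs only colours of equal parity, this sign can be charged to the first fragment
-- alone.
--
-- The second is that equality of complex numbers, given as Cauchy sequences, is undecidable, so a
-- nonzero pivot cannot be searched for. The elimination therefore treats every entry as a possible
-- pivot, carries a multiplier along and proves that the multiplier vanishes; reducedness serves to
-- remove the squares that arise.

-- Signs as elements of a commutative ring.

module Signs (K : CommutativeRing 0ℓ 0ℓ) where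

  open CommutativeRing K hiding (zero)
  open import Algebra.Properties.Ring ring using (-‿involutive; -1*x≈-x)

  sg : Bool → Carrier
  sg false = 1#
  sg true  = - 1#

  sg-xor : ∀ b c → sg (b xor c) ≈ sg b * sg c
  sg-xor false c     = sym (*-identityˡ (sg c))
  sg-xor true  false = sym (*-identityʳ (- 1#))
  sg-xor true  true  = sym (trans (-1*x≈-x (- 1#)) (-‿involutive 1#))

  sg-square : ∀ b → sg b * sg b ≈ 1#
  sg-square b = trans (sym (sg-xor b b)) (reflexive (≡.cong sg (Bool.xor-same b)))

  sg-cancel : ∀ b x → sg b * (sg b * x) ≈ x
  sg-cancel b x = trans (sym (*-assoc (sg b) (sg b) x)) (trans (*-congʳ (sg-square b)) (*-identityˡ x))

  x∙yz≈y∙xz : ∀ x y z → x * (y * z) ≈ y * (x * z)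
  x∙yz≈y∙xz x y z = trans (sym (*-assoc x y z)) (trans (*-congʳ (*-comm x y)) (*-assoc y x z))

-- Linear operators between spaces of functions.

module LinearOperators (K : CommutativeRing 0ℓ 0ℓ) where

  open CommutativeRing K hiding (zero)
  open Signs K
  open import Algebra.Properties.Semiring.Sum semiring
    using (sum; sum-cong-≋; sum-replicate-zero; *-distribˡ-sum; ∑-distrib-+)
  open import Algebra.Properties.CommutativeSemigroup +-commutativeSemigroup using (interchange)

  sum-zero : ∀ {n} {xs : Vector Carrier n} → (∀ i → xs i ≈ 0#) → sum xs ≈ 0#
  sum-zero {n} xs≈0 = trans (sum-cong-≋ xs≈0) (sum-replicate-zero n)

  sum-splitAt : ∀ m {n} (s : Fin (m ℕ.+ n) → Carrier) → sum s ≈ sum (λ i → s (i ↑ˡ n)) + sum (λ i → s (m ↑ʳ i))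
  sum-splitAt zero    s = sym (+-identityˡ _)
  sum-splitAt (suc m) s = trans (+-congˡ (sum-splitAt m (s ∘ suc))) (sym (+-assoc _ _ _))

  record Linear {X Y : Set} (T : (X → Carrier) → Y → Carrier) : Set where
    field
      cong   : ∀ {f g} → (∀ x → f x ≈ g x) → ∀ y → T f y ≈ T g y
      +-homo : ∀ f g y → T (λ x → f x + g x) y ≈ T f y + T g y
      *-homo : ∀ c f y → T (λ x → c * f x) y ≈ c * T f y

    0-homo : ∀ y → T (λ _ → 0#) y ≈ 0#
    0-homo y = trans (cong (λ _ → sym (zeroˡ 0#)) y) (trans (*-homo 0# (λ _ → 0#) y) (zeroˡ _))

    sum-homo : ∀ {n} (f : Fin n → X → Carrier) y → T (λ x → sum (λ i → f i x)) y ≈ sum (λ i → T (f i) y)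
    sum-homo {zero}  f y = 0-homo y
    sum-homo {suc n} f y = trans (+-homo (f zero) (λ x → sum (λ i → f (suc i) x)) y) (+-congˡ (sum-homo (f ∘ suc) y))

  open Linear

  linear-substitution : ∀ {X Y : Set} (h : Y → X) → Linear (λ f y → f (h y))
  linear-substitution h = record { cong = λ f≈g y → f≈g (h y) ; +-homo = λ _ _ _ → refl ; *-homo = λ _ _ _ → refl }

  linear-∘ : ∀ {X Y Z : Set} {S : (Y → Carrier) → Z → Carrier} {T : (X → Carrier) → Y → Carrier} →
             Linear S → Linear T → Linear (λ f → S (T f))
  linear-∘ {S = S} {T} s t = record
    { cong   = λ f≈g → cong s (cong t f≈g)
    ; +-homo = λ f g z → trans (cong s (+-homo t f g) z) (+-homo s (T f) (T g) z)
    ; *-homo = λ c f z → trans (cong s (*-homo t c f) z) (*-homo s c (T f) z)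
    }

  linear-+ : ∀ {X Y : Set} {S T : (X → Carrier) → Y → Carrier} →
             Linear S → Linear T → Linear (λ f y → S f y + T f y)
  linear-+ s t = record
    { cong   = λ f≈g y → +-cong (cong s f≈g y) (cong t f≈g y)
    ; +-homo = λ f g y → trans (+-cong (+-homo s f g y) (+-homo t f g y)) (interchange _ _ _ _)
    ; *-homo = λ c f y → trans (+-cong (*-homo s c f y) (*-homo t c f y)) (sym (distribˡ c _ _))
    }

  linear-scale : ∀ {X Y : Set} (a : Y → Carrier) {T : (X → Carrier) → Y → Carrier} → Linear T → Linear (λ f y → a y * T f y)
  linear-scale a t = record
    { cong   = λ f≈g y → *-congˡ (cong t f≈g y)
    ; +-homo = λ f g y → trans (*-congˡ (+-homo t f g y)) (distribˡ (a y) _ _)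
    ; *-homo = λ c f y → trans (*-congˡ (*-homo t c f y)) (x∙yz≈y∙xz (a y) c _)
    }

  linear-sum : ∀ {X Y : Set} {n} {T : Fin n → (X → Carrier) → Y → Carrier} →
               (∀ i → Linear (T i)) → Linear (λ f y → sum (λ i → T i f y))
  linear-sum {T = T} t = record
    { cong   = λ f≈g y → sum-cong-≋ (λ i → cong (t i) f≈g y)
    ; +-homo = λ f g y → trans (sum-cong-≋ (λ i → +-homo (t i) f g y)) (∑-distrib-+ (λ i → T i f y) (λ i → T i g y))
    ; *-homo = λ c f y → trans (sum-cong-≋ (λ i → *-homo (t i) c f y)) (sym (*-distribˡ-sum c (λ i → T i f y)))
    }

-- Functionals on words in even and odd letters.

module SuperWords (K : CommutativeRing 0ℓ 0ℓ) where

  open CommutativeRing K hiding (zero)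
  open Signs K
  open SetoidReasoning setoid

  parity : {A : Set} → (A → Bool) → List A → Bool
  parity odd []      = false
  parity odd (a ∷ w) = odd a xor parity odd w

  parity-++ : ∀ {A : Set} (odd : A → Bool) u w → parity odd (u ++ w) ≡ parity odd u xor parity odd w
  parity-++ odd []      w = ≡.refl
  parity-++ odd (a ∷ u) w = ≡.trans (≡.cong (odd a xor_) (parity-++ odd u w)) (≡.sym (Bool.xor-assoc (odd a) _ _))

  parity-swap : ∀ {A : Set} (odd : A → Bool) u a b w → parity odd (u ++ a ∷ b ∷ w) ≡ parity odd (u ++ b ∷ a ∷ w)
  parity-swap odd []      a b w = xor-∧-Solver.solve 3 (λ x y z → x :+ (y :+ z) := y :+ (x :+ z)) ≡.refl (odd a) (odd b) (parity odd w)
    where open xor-∧-Solver using (_:+_; _:=_)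
  parity-swap odd (c ∷ u) a b w = ≡.cong (odd c xor_) (parity-swap odd u a b w)

  -- A linear functional on the supercommutative algebra generated by the letters, recorded by its
  -- values on monomials.
  record Supersymmetric {A : Set} (odd : A → Bool) (E : List A → Carrier) : Set where
    constructor supersymmetric
    field
      swap : ∀ u a b w → E (u ++ a ∷ b ∷ w) ≈ sg (odd a ∧ odd b) * E (u ++ b ∷ a ∷ w)

  open Supersymmetric

  module _ {A : Set} {odd : A → Bool} where

    super-prefix : ∀ {E} → Supersymmetric odd E → ∀ v → Supersymmetric odd (λ w → E (v ++ w))
    super-prefix {E} super v .swap u a b w = begin
      E (v ++ u ++ a ∷ b ∷ w)                         ≡⟨ ≡.cong E (List.++-assoc v u _) ⟨
      E ((v ++ u) ++ a ∷ b ∷ w)                       ≈⟨ swap super (v ++ u) a b w ⟩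
      sg (odd a ∧ odd b) * E ((v ++ u) ++ b ∷ a ∷ w)  ≡⟨ ≡.cong (λ z → sg (odd a ∧ odd b) * E z) (List.++-assoc v u _) ⟩
      sg (odd a ∧ odd b) * E (v ++ u ++ b ∷ a ∷ w)    ∎

    super-map : ∀ {B : Set} (h : B → A) {E} → Supersymmetric odd E → Supersymmetric (odd ∘ h) (E ∘ map h)
    super-map h {E} super .swap u a b w = begin
      E (map h (u ++ a ∷ b ∷ w))
        ≡⟨ ≡.cong E (List.map-++ h u _) ⟩
      E (map h u ++ h a ∷ h b ∷ map h w)
        ≈⟨ swap super (map h u) (h a) (h b) (map h w) ⟩
      sg (odd (h a) ∧ odd (h b)) * E (map h u ++ h b ∷ h a ∷ map h w)
        ≡⟨ ≡.cong (λ z → sg (odd (h a) ∧ odd (h b)) * E z) (List.map-++ h u _) ⟨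
      sg (odd (h a) ∧ odd (h b)) * E (map h (u ++ b ∷ a ∷ w)) ∎

    -- The two letters of the pair meet `c` with the same sign, and the signs cancel. This is what
    -- makes the element of an edge central.
    even-pair-past-letter : ∀ {E} → Supersymmetric odd E → ∀ u {a b} → odd a ≡ odd b → ∀ c w →
                            E (u ++ a ∷ b ∷ c ∷ w) ≈ E (u ++ c ∷ a ∷ b ∷ w)
    even-pair-past-letter {E} super u {a} {b} a≡b c w = begin
      E (u ++ a ∷ b ∷ c ∷ w)
        ≈⟨ swap (super-prefix super u) (a ∷ []) b c w ⟩
      sg (odd b ∧ odd c) * E (u ++ a ∷ c ∷ b ∷ w)
        ≈⟨ *-congˡ (swap super u a c (b ∷ w)) ⟩
      sg (odd b ∧ odd c) * (sg (odd a ∧ odd c) * E (u ++ c ∷ a ∷ b ∷ w))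
        ≡⟨ ≡.cong (λ o → sg (odd b ∧ odd c) * (sg (o ∧ odd c) * E (u ++ c ∷ a ∷ b ∷ w))) a≡b ⟩
      sg (odd b ∧ odd c) * (sg (odd b ∧ odd c) * E (u ++ c ∷ a ∷ b ∷ w))
        ≈⟨ sg-cancel (odd b ∧ odd c) _ ⟩
      E (u ++ c ∷ a ∷ b ∷ w) ∎

    even-pairs-commute : ∀ {E} → Supersymmetric odd E → ∀ {a b c d} → odd a ≡ odd b → ∀ w →
                         E (a ∷ b ∷ c ∷ d ∷ w) ≈ E (c ∷ d ∷ a ∷ b ∷ w)
    even-pairs-commute super {a} {b} {c} {d} a≡b w =
      trans (even-pair-past-letter super [] a≡b c (d ∷ w)) (even-pair-past-letter super (c ∷ []) a≡b d w)

    -- Each letter in between is passed once by `x` and once by `y`, so its two signs cancel; only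
    -- the sign of exchanging `x` with `y` is left.
    transpose-odd : ∀ {E} → Supersymmetric odd E → ∀ {x y} → odd x ≡ true → odd y ≡ true →
                    ∀ u v w → E (u ++ x ∷ v ++ y ∷ w) ≈ sg true * E (u ++ y ∷ v ++ x ∷ w)
    transpose-odd {E} super {x} {y} ox oy u [] w = trans (swap super u x y w)
      (reflexive (≡.cong₂ (λ o o′ → sg (o ∧ o′) * E (u ++ y ∷ x ∷ w)) ox oy))
    transpose-odd {E} super {x} {y} ox oy u (z ∷ v) w = begin
      E (u ++ x ∷ z ∷ v ++ y ∷ w)
        ≈⟨ swap super u x z (v ++ y ∷ w) ⟩
      sg (odd x ∧ odd z) * E (u ++ z ∷ x ∷ v ++ y ∷ w)
        ≈⟨ *-congˡ (reassociate (transpose-odd super ox oy (u ++ z ∷ []) v w)) ⟩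
      sg (odd x ∧ odd z) * (sg true * E (u ++ z ∷ y ∷ v ++ x ∷ w))
        ≈⟨ *-congˡ (*-congˡ (swap super u z y (v ++ x ∷ w))) ⟩
      sg (odd x ∧ odd z) * (sg true * (sg (odd z ∧ odd y) * E (u ++ y ∷ z ∷ v ++ x ∷ w)))
        ≈⟨ *-congˡ (x∙yz≈y∙xz (sg true) (sg (odd z ∧ odd y)) _) ⟩
      sg (odd x ∧ odd z) * (sg (odd z ∧ odd y) * (sg true * E (u ++ y ∷ z ∷ v ++ x ∷ w)))
        ≡⟨ ≡.cong₂ (λ o o′ → sg o * (sg o′ * (sg true * E (u ++ y ∷ z ∷ v ++ x ∷ w))))
             (≡.cong (_∧ odd z) ox) (≡.trans (≡.cong (odd z ∧_) oy) (Bool.∧-identityʳ (odd z))) ⟩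
      sg (odd z) * (sg (odd z) * (sg true * E (u ++ y ∷ z ∷ v ++ x ∷ w)))
        ≈⟨ sg-cancel (odd z) _ ⟩
      sg true * E (u ++ y ∷ z ∷ v ++ x ∷ w) ∎
      where
      reassociate : ∀ {r s t} → E ((u ++ z ∷ []) ++ r) ≈ t * E ((u ++ z ∷ []) ++ s) → E (u ++ z ∷ r) ≈ t * E (u ++ z ∷ s)
      reassociate {r} {s} {t} eq = ≡.subst₂ (λ r s → E r ≈ t * E s) (List.++-assoc u (z ∷ []) r) (List.++-assoc u (z ∷ []) s) eq

  -- Peeling off one vertex: V ∪ {nothing}.  The value of φ ⊛ E on a word is the
  -- value of φ on the letters at nothing times the value of E on the other
  -- letters, the letters at nothing first being moved to the front.
  module Peeling {C : Set} (odd : C → Bool) where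

    here : {V : Set} → List (Maybe V × C) → List C
    here []                  = []
    here ((nothing , c) ∷ w) = c ∷ here w
    here ((just _  , c) ∷ w) = here w

    there : {V : Set} → List (Maybe V × C) → List (V × C)
    there []                  = []
    there ((nothing , c) ∷ w) = there w
    there ((just x  , c) ∷ w) = (x , c) ∷ there w

    oddₗ : {V : Set} → V × C → Bool
    oddₗ (_ , c) = odd c

    inversions : {V : Set} → List (Maybe V × C) → Bool
    inversions []                  = false
    inversions ((nothing , c) ∷ w) = inversions w
    inversions ((just x  , c) ∷ w) = (odd c ∧ parity odd (here w)) xor inversions w

    infixr 7 _⊛_

    _⊛_ : {V : Set} → (List C → Carrier) → (List (V × C) → Carrier) → List (Maybe V × C) → Carrier
    (φ ⊛ E) w = sg (inversions w) * (φ (here w) * E (there w))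

    here-++ : ∀ {V : Set} (u : List (Maybe V × C)) w → here (u ++ w) ≡ here u ++ here w
    here-++ []                  w = ≡.refl
    here-++ ((nothing , c) ∷ u) w = ≡.cong (c ∷_) (here-++ u w)
    here-++ ((just x  , c) ∷ u) w = here-++ u w

    there-++ : ∀ {V : Set} (u : List (Maybe V × C)) w → there (u ++ w) ≡ there u ++ there w
    there-++ []                  w = ≡.refl
    there-++ ((nothing , c) ∷ u) w = there-++ u w
    there-++ ((just x  , c) ∷ u) w = ≡.cong ((x , c) ∷_) (there-++ u w)

    inversions-++ : ∀ {V : Set} (u : List (Maybe V × C)) w →
      inversions (u ++ w) ≡ inversions u xor ((parity oddₗ (there u) ∧ parity odd (here w)) xor inversions w)
    inversions-++ []                  w = ≡.refl
    inversions-++ ((nothing , c) ∷ u) w = inversions-++ u w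
    inversions-++ ((just x  , c) ∷ u) w
      rewrite inversions-++ u w | here-++ u w | parity-++ odd (here u) (here w) =
      solve 6 (λ o hu hw iu pu iw → o :* (hu :+ hw) :+ (iu :+ (pu :* hw :+ iw)) := (o :* hu :+ iu) :+ ((o :+ pu) :* hw :+ iw))
        ≡.refl (odd c) (parity odd (here u)) (parity odd (here w)) (inversions u) (parity oddₗ (there u)) (inversions w)
      where open xor-∧-Solver

    -- The share of a swap's sign that `inversions` accounts for. A swap of two letters at `nothing`
    -- is left to `φ`, a swap of two other letters to `E`.
    mixed : {V : Set} → Maybe V × C → Maybe V × C → Bool
    mixed (nothing , c) (just _  , d) = odd c ∧ odd d
    mixed (just _  , c) (nothing , d) = odd c ∧ odd d
    mixed _             _             = false

    parity-here-swap : ∀ {V : Set} (u : List (Maybe V × C)) a b w →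
      parity odd (here (u ++ a ∷ b ∷ w)) ≡ parity odd (here (u ++ b ∷ a ∷ w))
    parity-here-swap u a b w rewrite here-++ u (a ∷ b ∷ w) | here-++ u (b ∷ a ∷ w) with a | b
    ... | nothing , c | nothing , d = parity-swap odd (here u) c d (here w)
    ... | nothing , c | just _  , d = ≡.refl
    ... | just _  , c | nothing , d = ≡.refl
    ... | just _  , c | just _  , d = ≡.refl

    inversions-swap : ∀ {V : Set} (u : List (Maybe V × C)) a b w →
      inversions (u ++ a ∷ b ∷ w) ≡ mixed a b xor inversions (u ++ b ∷ a ∷ w)
    inversions-swap [] (nothing , c) (nothing , d) w = ≡.refl
    inversions-swap [] (nothing , c) (just _  , d) w =
      solve 4 (λ c d p i → d :* p :+ i := c :* d :+ (d :* (c :+ p) :+ i)) ≡.refl (odd c) (odd d) (parity odd (here w)) (inversions w)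
      where open xor-∧-Solver
    inversions-swap [] (just _  , c) (nothing , d) w =
      solve 4 (λ c d p i → c :* (d :+ p) :+ i := c :* d :+ (c :* p :+ i)) ≡.refl (odd c) (odd d) (parity odd (here w)) (inversions w)
      where open xor-∧-Solver
    inversions-swap [] (just _  , c) (just _  , d) w =
      solve 4 (λ c d p i → c :* p :+ (d :* p :+ i) := d :* p :+ (c :* p :+ i)) ≡.refl (odd c) (odd d) (parity odd (here w)) (inversions w)
      where open xor-∧-Solver
    inversions-swap ((nothing , c) ∷ u) a b w = inversions-swap u a b w
    inversions-swap ((just x , c) ∷ u) a b w
      rewrite parity-here-swap u a b w | inversions-swap u a b w =
      solve 3 (λ p m i → p :+ (m :+ i) := m :+ (p :+ i)) ≡.refl
        (odd c ∧ parity odd (here (u ++ b ∷ a ∷ w))) (mixed a b) (inversions (u ++ b ∷ a ∷ w))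
      where open xor-∧-Solver

    ⊛-super : ∀ {V : Set} {φ} {E : List (V × C) → Carrier} →
              Supersymmetric odd φ → Supersymmetric oddₗ E → Supersymmetric oddₗ (φ ⊛ E)
    ⊛-super {φ = φ} {E} φ-super E-super .swap u a b w
      rewrite here-++ u (a ∷ b ∷ w) | here-++ u (b ∷ a ∷ w) | there-++ u (a ∷ b ∷ w) | there-++ u (b ∷ a ∷ w)
            | inversions-swap u a b w with a | b
    ... | nothing , c | nothing , d =
      trans (*-congˡ (trans (*-congʳ (swap φ-super (here u) c d (here w))) (*-assoc _ _ _))) (x∙yz≈y∙xz _ _ _)
    ... | nothing , c | just _  , d = trans (*-congʳ (sg-xor (odd c ∧ odd d) _)) (*-assoc _ _ _)
    ... | just _  , c | nothing , d = trans (*-congʳ (sg-xor (odd c ∧ odd d) _)) (*-assoc _ _ _)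
    ... | just x  , c | just y  , d =
      trans (*-congˡ (trans (*-congˡ (swap E-super (there u) (x , c) (y , d) (there w))) (x∙yz≈y∙xz _ _ _))) (x∙yz≈y∙xz _ _ _)

    relabel : ∀ {V W : Set} → (V → W) → List (V × C) → List (W × C)
    relabel f = map (Product.map₁ f)

    module _ {V W : Set} (g : V → W) where

      here-relabel : ∀ w → here (relabel (Maybe.map g) w) ≡ here w
      here-relabel []                  = ≡.refl
      here-relabel ((nothing , c) ∷ w) = ≡.cong (c ∷_) (here-relabel w)
      here-relabel ((just x  , c) ∷ w) = here-relabel w

      there-relabel : ∀ w → there (relabel (Maybe.map g) w) ≡ relabel g (there w)
      there-relabel []                  = ≡.refl
      there-relabel ((nothing , c) ∷ w) = there-relabel w
      there-relabel ((just x  , c) ∷ w) = ≡.cong ((g x , c) ∷_) (there-relabel w)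

      inversions-relabel : ∀ w → inversions (relabel (Maybe.map g) w) ≡ inversions w
      inversions-relabel []                  = ≡.refl
      inversions-relabel ((nothing , c) ∷ w) = inversions-relabel w
      inversions-relabel ((just x  , c) ∷ w) =
        ≡.cong₂ (λ u i → (odd c ∧ parity odd u) xor i) (here-relabel w) (inversions-relabel w)

      parity-relabel : ∀ w → parity oddₗ (relabel g w) ≡ parity oddₗ w
      parity-relabel []            = ≡.refl
      parity-relabel ((x , c) ∷ w) = ≡.cong (odd c xor_) (parity-relabel w)

    relabel-∘ : ∀ {V W X : Set} {f : W → X} {g : V → W} {h : V → X} → (∀ x → f (g x) ≡ h x) →
                ∀ w → relabel f (relabel g w) ≡ relabel h w
    relabel-∘ eq []            = ≡.refl
    relabel-∘ eq ((x , c) ∷ w) = ≡.cong₂ _∷_ (≡.cong (_, c) (eq x)) (relabel-∘ eq w)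

    inversions-replace : ∀ {V : Set} {a b} → odd a ≡ odd b → ∀ u (x : Maybe V) w →
      inversions (u ++ (x , a) ∷ w) ≡ inversions (u ++ (x , b) ∷ w)
    inversions-replace {a = a} {b} a≡b u x w
      rewrite inversions-++ u ((x , a) ∷ w) | inversions-++ u ((x , b) ∷ w) with x
    ... | nothing rewrite a≡b = ≡.refl
    ... | just _  rewrite a≡b = ≡.refl

    ⊛-replace : ∀ {V : Set} {φ} {E : List (V × C) → Carrier} {a b s} → odd a ≡ odd b →
      (∀ u w → φ (u ++ a ∷ w) ≈ s * φ (u ++ b ∷ w)) → (∀ u x w → E (u ++ (x , a) ∷ w) ≈ s * E (u ++ (x , b) ∷ w)) →
      ∀ u x w → (φ ⊛ E) (u ++ (x , a) ∷ w) ≈ s * (φ ⊛ E) (u ++ (x , b) ∷ w)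
    ⊛-replace {a = a} {b} a≡b φ-replace E-replace u x w
      rewrite inversions-replace {a = a} {b} a≡b u x w | here-++ u ((x , a) ∷ w) | here-++ u ((x , b) ∷ w)
            | there-++ u ((x , a) ∷ w) | there-++ u ((x , b) ∷ w) with x
    ... | nothing = trans (*-congˡ (trans (*-congʳ (φ-replace (here u) (here w))) (*-assoc _ _ _))) (x∙yz≈y∙xz _ _ _)
    ... | just x  = trans (*-congˡ (trans (*-congˡ (E-replace (there u) x (there w))) (x∙yz≈y∙xz _ _ _))) (x∙yz≈y∙xz _ _ _)

    isolateZero : ∀ {n} → Fin (suc n) → Maybe (Fin n)
    isolateZero zero    = nothing
    isolateZero (suc v) = just v

    module _ (φ : List C → Carrier) where

      ⨂ : ∀ n → List (Fin n × C) → Carrier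
      ⨂ zero    w = 1#
      ⨂ (suc n) w = (φ ⊛ ⨂ n) (relabel isolateZero w)

      ⨂-super : Supersymmetric odd φ → ∀ n → Supersymmetric oddₗ (⨂ n)
      ⨂-super φ-super zero    .swap u (() , _)
      ⨂-super φ-super (suc n) = super-map (Product.map₁ isolateZero) (⊛-super φ-super (⨂-super φ-super n))

      -- Letters of equal parity incur the same reordering signs, so proportionality at a single
      -- vertex passes to the whole product. It serves to trade a letter `𝐠` for the `𝐟` it is a
      -- multiple of.
      ⨂-replace : ∀ {a b s} → odd a ≡ odd b → (∀ u w → φ (u ++ a ∷ w) ≈ s * φ (u ++ b ∷ w)) →
        ∀ n u x w → ⨂ n (u ++ (x , a) ∷ w) ≈ s * ⨂ n (u ++ (x , b) ∷ w)
      ⨂-replace {a} {b} {s} a≡b φ-replace (suc n) u x w = begin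
        (φ ⊛ ⨂ n) (relabel isolateZero (u ++ (x , a) ∷ w))
          ≡⟨ ≡.cong (φ ⊛ ⨂ n) (List.map-++ _ u _) ⟩
        (φ ⊛ ⨂ n) (relabel isolateZero u ++ (isolateZero x , a) ∷ relabel isolateZero w)
          ≈⟨ ⊛-replace {φ = φ} {⨂ n} a≡b φ-replace (⨂-replace a≡b φ-replace n) (relabel isolateZero u) (isolateZero x) (relabel isolateZero w) ⟩
        s * (φ ⊛ ⨂ n) (relabel isolateZero u ++ (isolateZero x , b) ∷ relabel isolateZero w)
          ≡⟨ ≡.cong (λ w → s * (φ ⊛ ⨂ n) w) (List.map-++ _ u _) ⟨
        s * (φ ⊛ ⨂ n) (relabel isolateZero (u ++ (x , b) ∷ w)) ∎

      -- Vertices are peeled off in increasing order, and the letters over the first `m` vertices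
      -- already stand in front, so no letter of `w` crosses a letter of `u`.
      ⨂-multiplicative : ∀ m n u w → ⨂ (m ℕ.+ n) (relabel (_↑ˡ n) u ++ relabel (m ↑ʳ_) w) ≈ ⨂ m u * ⨂ n w
      ⨂-multiplicative zero    n [] w = trans (reflexive (≡.cong (⨂ n) (List.map-id w))) (sym (*-identityˡ _))
      ⨂-multiplicative (suc m) n u w = begin
        (φ ⊛ ⨂ (m ℕ.+ n)) (relabel isolateZero (relabel (_↑ˡ n) u ++ relabel (suc m ↑ʳ_) w))
          ≡⟨ ≡.cong (φ ⊛ ⨂ (m ℕ.+ n)) words ⟩
        (φ ⊛ ⨂ (m ℕ.+ n)) (u″ ++ w″)
          ≡⟨ ≡.cong₂ (λ i z → sg i * z) inversions-eq (≡.cong₂ (λ h z → φ h * ⨂ (m ℕ.+ n) z) here-eq there-eq) ⟩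
        sg (inversions u′) * (φ (here u′) * ⨂ (m ℕ.+ n) (relabel (_↑ˡ n) (there u′) ++ relabel (m ↑ʳ_) w))
          ≈⟨ *-congˡ (*-congˡ (⨂-multiplicative m n (there u′) w)) ⟩
        sg (inversions u′) * (φ (here u′) * (⨂ m (there u′) * ⨂ n w))
          ≈⟨ trans (*-congˡ (sym (*-assoc _ _ _))) (sym (*-assoc _ _ _)) ⟩
        (φ ⊛ ⨂ m) u′ * ⨂ n w ∎
        where
        u′ = relabel isolateZero u
        u″ = relabel (Maybe.map (_↑ˡ n)) u′
        w′ = relabel (m ↑ʳ_) w
        w″ = relabel just w′
        here-just : ∀ {V : Set} (w : List (V × C)) → here (relabel just w) ≡ []
        here-just []      = ≡.refl
        here-just (_ ∷ w) = here-just w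
        there-just : ∀ {V : Set} (w : List (V × C)) → there (relabel just w) ≡ w
        there-just []      = ≡.refl
        there-just (a ∷ w) = ≡.cong (a ∷_) (there-just w)
        inversions-just : ∀ {V : Set} (w : List (V × C)) → inversions (relabel just w) ≡ false
        inversions-just []            = ≡.refl
        inversions-just ((_ , c) ∷ w) rewrite here-just w | inversions-just w | Bool.∧-zeroʳ (odd c) = ≡.refl
        words : relabel isolateZero (relabel (_↑ˡ n) u ++ relabel (suc m ↑ʳ_) w) ≡ u″ ++ w″
        words = ≡.trans (List.map-++ _ (relabel (_↑ˡ n) u) _) (≡.cong₂ _++_
          (≡.trans (relabel-∘ {h = λ x → Maybe.map (_↑ˡ n) (isolateZero x)} (λ { zero → ≡.refl ; (suc v) → ≡.refl }) u) (≡.sym (relabel-∘ (λ _ → ≡.refl) u)))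
          (≡.trans (relabel-∘ {h = λ x → just (m ↑ʳ x)} (λ _ → ≡.refl) w) (≡.sym (relabel-∘ (λ _ → ≡.refl) w))))
        here-eq : here (u″ ++ w″) ≡ here u′
        here-eq = ≡.trans (here-++ u″ w″) (≡.trans (≡.cong₂ _++_ (here-relabel _ u′) (here-just w′)) (List.++-identityʳ _))
        there-eq : there (u″ ++ w″) ≡ relabel (_↑ˡ n) (there u′) ++ w′
        there-eq = ≡.trans (there-++ u″ w″) (≡.cong₂ _++_ (there-relabel _ u′) (there-just w′))
        inversions-eq : inversions (u″ ++ w″) ≡ inversions u′
        inversions-eq = ≡.trans (inversions-++ u″ w″) (≡.trans
          (≡.cong₂ (λ h i → inversions u″ xor ((parity oddₗ (there u″) ∧ parity odd h) xor i)) (here-just w′) (inversions-just w′))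
          (≡.trans (≡.cong (λ b → inversions u″ xor (b xor false)) (Bool.∧-zeroʳ (parity oddₗ (there u″))))
            (≡.trans (Bool.xor-identityʳ _) (inversions-relabel _ u′))))

-- Linear dependence and rank over reduced rings.

module LinearAlgebra (K : CommutativeRing 0ℓ 0ℓ) where

  open CommutativeRing K hiding (zero)
  open LinearOperators K using (sum-zero)
  open import Algebra.Properties.Semiring.Sum semiring using (sum; sum-cong-≋; sum-remove; *-distribˡ-sum; *-distribʳ-sum; ∑-distrib-+; ∑-comm)
  open import Algebra.Properties.Ring ring using (-‿distribˡ-*; -‿distribʳ-*)
  open import Algebra.Solver.Ring.NaturalCoefficients.Default commutativeSemiring using (solve; _:=_; _:+_; _:*_)
  open SetoidReasoning setoid

  -- Independence up to a multiplier: `m` equal to 1 is independence itself, and during elimination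
  -- `m` collects the pivots by which one would otherwise divide.
  Annihilates : ∀ {n r} → Carrier → (Fin n → Vector Carrier r) → Set
  Annihilates {n} m V = ∀ (c : Vector Carrier n) → (∀ j → sum (λ i → c i * V i j) ≈ 0#) → ∀ i → m * c i ≈ 0#

  module _ {n r} (V : Fin (suc n) → Vector Carrier (suc r)) (i : Fin (suc n)) where

    eliminate : Fin n → Vector Carrier (suc r)
    eliminate x j = V i zero * V (punchIn i x) j - V (punchIn i x) zero * V i j

    module _ (d : Vector Carrier n) where

      -- The coefficients on the original rows of the combination of eliminated rows given by `d`;
      -- row `i` receives all the subtracted multiples.
      lift : Vector Carrier (suc n)
      lift = insertAt (λ x → V i zero * d x) i (- sum (λ x → d x * V (punchIn i x) zero))

      lift-combination : ∀ j → sum (λ x → lift x * V x j) ≈ sum (λ x → d x * eliminate x j)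
      lift-combination j = begin
        sum (λ x → lift x * V x j)
          ≈⟨ sum-remove {i = i} (λ x → lift x * V x j) ⟩
        lift i * V i j + sum (λ x → lift (punchIn i x) * V (punchIn i x) j)
          ≈⟨ +-cong (*-congʳ (reflexive (insertAt-lookup _ i _)))
                    (sum-cong-≋ (λ x → *-congʳ (reflexive (insertAt-punchIn _ i _ x)))) ⟩
        - B * V i j + sum (λ x → V i zero * d x * V (punchIn i x) j)
          ≈⟨ +-congʳ (trans (sym (-‿distribˡ-* B (V i j))) (-‿distribʳ-* B (V i j))) ⟩
        B * - V i j + sum (λ x → V i zero * d x * V (punchIn i x) j)
          ≈⟨ +-congʳ (*-distribʳ-sum (- V i j) (λ x → d x * V (punchIn i x) zero)) ⟩
        sum (λ x → d x * V (punchIn i x) zero * - V i j) + sum (λ x → V i zero * d x * V (punchIn i x) j)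
          ≈⟨ ∑-distrib-+ (λ x → d x * V (punchIn i x) zero * - V i j) (λ x → V i zero * d x * V (punchIn i x) j) ⟨
        sum (λ x → d x * V (punchIn i x) zero * - V i j + V i zero * d x * V (punchIn i x) j)
          ≈⟨ sum-cong-≋ (λ x → solve 5 (λ d b y a v → (d :* b :* y :+ a :* d :* v) := (d :* (a :* v :+ b :* y))) refl
                                 (d x) (V (punchIn i x) zero) (- V i j) (V i zero) (V (punchIn i x) j)) ⟩
        sum (λ x → d x * (V i zero * V (punchIn i x) j + V (punchIn i x) zero * - V i j))
          ≈⟨ sum-cong-≋ (λ x → *-congˡ {x = d x} (+-congˡ (sym (-‿distribʳ-* _ _)))) ⟩
        sum (λ x → d x * eliminate x j) ∎
        where B = sum (λ x → d x * V (punchIn i x) zero)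

    eliminate-annihilates : ∀ m → Annihilates m V → Annihilates (m * V i zero) (λ x → eliminate x ∘ suc)
    eliminate-annihilates m ann d d-kernel x = begin
      m * V i zero * d x          ≈⟨ *-assoc m (V i zero) (d x) ⟩
      m * (V i zero * d x)        ≈⟨ *-congˡ (reflexive (insertAt-punchIn _ i _ x)) ⟨
      m * lift d (punchIn i x)    ≈⟨ ann (lift d) kernel (punchIn i x) ⟩
      0#                          ∎
      where
      kernel : ∀ j → sum (λ x → lift d x * V x j) ≈ 0#
      kernel (suc j) = trans (lift-combination d (suc j)) (d-kernel j)
      kernel zero    = trans (lift-combination d zero) (sum-zero λ x →
        trans (*-congˡ (trans (+-congʳ (*-comm (V i zero) (V (punchIn i x) zero))) (-‿inverseʳ _))) (zeroʳ (d x)))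

  module _ (reduced : ∀ x → x * x ≈ 0# → x ≈ 0#) where

    -- Induction on the number of columns, used twice. Eliminating with row `i` shows that
    -- `m * V i zero` vanishes, for every `i` and without asking whether the pivot is zero. Hence
    -- `m` kills the first column, and the induction hypothesis applies to the remaining columns
    -- with `m` itself.
    annihilator-trivial : ∀ r {n} → r ℕ.< n → (V : Fin n → Vector Carrier r) →
                          ∀ m → Annihilates m V → m ≈ 0#
    -- Without columns every vector of coefficients is a relation, in particular the all-ones
    -- vector.
    annihilator-trivial zero {suc n} _ V m ann = trans (sym (*-identityʳ m)) (ann (λ _ → 1#) (λ ()) zero)
    annihilator-trivial (suc r) {suc n} (s<s r<n) V m ann =
      annihilator-trivial r (ℕₚ.m<n⇒m<1+n r<n) (λ i → V i ∘ suc) m tails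
      where
      pivot : ∀ i → m * V i zero ≈ 0#
      pivot i = annihilator-trivial r r<n (λ x → eliminate V i x ∘ suc) (m * V i zero) (eliminate-annihilates V i m ann)

      tails : Annihilates m (λ i → V i ∘ suc)
      -- By `pivot`, the multiple of `c` by `m` is a relation in the first column as well, so `ann`
      -- kills it and yields m(mc) = 0, hence (mc)² = 0.
      tails c kernel i = reduced (m * c i) (begin
        m * c i * (m * c i)      ≈⟨ solve 2 (λ m c → (m :* c :* (m :* c)) := (c :* (m :* (m :* c)))) refl m (c i) ⟩
        c i * (m * (m * c i))    ≈⟨ *-congˡ (ann (λ x → m * c x) all i) ⟩
        c i * 0#                 ≈⟨ zeroʳ (c i) ⟩
        0#                       ∎)
        where
        all : ∀ j → sum (λ x → m * c x * V x j) ≈ 0#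
        all zero    = sum-zero λ x → trans
          (solve 3 (λ m c v → (m :* c :* v) := (c :* (m :* v))) refl m (c x) (V x zero))
          (trans (*-congˡ (pivot x)) (zeroʳ (c x)))
        all (suc j) = begin
          sum (λ x → m * c x * V x (suc j))    ≈⟨ sum-cong-≋ (λ x → *-assoc m (c x) (V x (suc j))) ⟩
          sum (λ x → m * (c x * V x (suc j)))  ≈⟨ *-distribˡ-sum m (λ x → c x * V x (suc j)) ⟨
          m * sum (λ x → c x * V x (suc j))    ≈⟨ *-congˡ (kernel j) ⟩
          m * 0#                               ≈⟨ zeroʳ m ⟩
          0#                                   ∎

    module _ (1≉0 : ¬ 1# ≈ 0#) {I J : Set} (M : I → J → Carrier) where

      -- A relation among the rows of `A` is one among the rows of `M`. If the latter are
      -- independent, 1 annihilates all relations of the former, which is impossible for more than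
      -- `r` vectors of length `r`.
      factorization⇒rank≤ : ∀ r (A : I → Vector Carrier r) (B : J → Vector Carrier r) →
        (∀ i j → M i j ≈ sum (λ x → A i x * B j x)) → Over.Rank≤ K M r
      factorization⇒rank≤ r A B M≈AB {n} rows independent with n ℕₚ.≤? r
      ... | yes n≤r = n≤r
      ... | no  n≰r = contradiction
        (annihilator-trivial r (ℕₚ.≰⇒> n≰r) (λ i → A (rows i)) 1#
          (λ c kernel i → trans (*-identityˡ (c i)) (independent c (λ j → in-kernel c kernel j) i)))
        1≉0
        where
        in-kernel : ∀ (c : Vector Carrier n) → (∀ x → sum (λ i → c i * A (rows i) x) ≈ 0#) → ∀ j → sum (λ i → c i * M (rows i) j) ≈ 0#
        in-kernel c kernel j = begin
          sum (λ i → c i * M (rows i) j)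
            ≈⟨ sum-cong-≋ (λ i → trans (*-congˡ (M≈AB (rows i) j)) (*-distribˡ-sum (c i) (λ x → A (rows i) x * B j x))) ⟩
          sum (λ i → sum (λ x → c i * (A (rows i) x * B j x)))
            ≈⟨ ∑-comm (λ i x → c i * (A (rows i) x * B j x)) ⟩
          sum (λ x → sum (λ i → c i * (A (rows i) x * B j x)))
            ≈⟨ sum-cong-≋ (λ x → sum-cong-≋ (λ i → sym (*-assoc (c i) (A (rows i) x) (B j x)))) ⟩
          sum (λ x → sum (λ i → c i * A (rows i) x * B j x))
            ≈⟨ sum-cong-≋ (λ x → sym (*-distribʳ-sum (B j x) (λ i → c i * A (rows i) x))) ⟩
          sum (λ x → sum (λ i → c i * A (rows i) x) * B j x)
            ≈⟨ sum-zero (λ x → trans (*-congʳ (kernel x)) (zeroˡ (B j x))) ⟩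
          0# ∎

-- The complex numbers form a nontrivial reduced ring.

module ComplexNumbers where

  open ℚ-Solver using (solve; _:=_; _:+_; _:*_; :-_; _:-_; con)

  square-mono-≤ : ∀ {p q} → 0ℚ ℚ.≤ p → p ℚ.≤ q → p ℚ.* p ℚ.≤ q ℚ.* q
  square-mono-≤ {p} {q} 0≤p p≤q = ℚₚ.≤-trans
    (ℚₚ.*-monoˡ-≤-nonNeg p {{ℚ.nonNegative 0≤p}} p≤q)
    (ℚₚ.*-monoʳ-≤-nonNeg q {{ℚ.nonNegative (ℚₚ.≤-trans 0≤p p≤q)}} p≤q)

  ∣p∣*∣p∣≡p*p : ∀ p → ℚ.∣ p ∣ ℚ.* ℚ.∣ p ∣ ≡ p ℚ.* p
  ∣p∣*∣p∣≡p*p p with ℚₚ.∣p∣≡p∨∣p∣≡-p p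
  ... | inj₁ eq rewrite eq = ≡.refl
  ... | inj₂ eq rewrite eq = solve 1 (λ p → (:- p) :* (:- p) := p :* p) ≡.refl p

  0≤p*p : ∀ p → 0ℚ ℚ.≤ p ℚ.* p
  0≤p*p p = ≡.subst (0ℚ ℚ.≤_) (∣p∣*∣p∣≡p*p p) (square-mono-≤ ℚₚ.≤-refl (ℚₚ.0≤∣p∣ p))

  -- (a² - b²)² + (2ab)² = (a² + b²)² bounds a by the real and imaginary parts of (a + ib)².
  square-small : ∀ {δ ε} a b → 0ℚ ℚ.< ε → δ ≡ ½ ℚ.* (ε ℚ.* ε) →
    ℚ.∣ a ℚ.* a ℚ.- b ℚ.* b ∣ ℚ.< δ → ℚ.∣ a ℚ.* b ℚ.+ b ℚ.* a ∣ ℚ.< δ → ℚ.∣ a ∣ ℚ.< ε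
  square-small {δ} {ε} a b 0<ε ≡.refl p<δ q<δ = ℚₚ.≰⇒> λ ε≤∣a∣ → ℚₚ.<-irrefl ≡.refl (begin-strict
    δ ℚ.* δ ℚ.+ δ ℚ.* δ
      ≡⟨ ℚₚ.+-identityʳ (δ ℚ.* δ ℚ.+ δ ℚ.* δ) ⟨
    δ ℚ.* δ ℚ.+ δ ℚ.* δ ℚ.+ 0ℚ
      <⟨ ℚₚ.+-monoʳ-< (δ ℚ.* δ ℚ.+ δ ℚ.* δ) 0<2δ² ⟩
    δ ℚ.* δ ℚ.+ δ ℚ.* δ ℚ.+ (δ ℚ.* δ ℚ.+ δ ℚ.* δ)
      ≡⟨ solve 1 (λ e → con ½ :* e :* (con ½ :* e) :+ con ½ :* e :* (con ½ :* e) :+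
                        (con ½ :* e :* (con ½ :* e) :+ con ½ :* e :* (con ½ :* e)) := e :* e) ≡.refl (ε ℚ.* ε) ⟩
    ε ℚ.* ε ℚ.* (ε ℚ.* ε)
      ≤⟨ square-mono-≤ (0≤p*p ε) (square-mono-≤ (ℚₚ.<⇒≤ 0<ε) ε≤∣a∣) ⟩
    ℚ.∣ a ∣ ℚ.* ℚ.∣ a ∣ ℚ.* (ℚ.∣ a ∣ ℚ.* ℚ.∣ a ∣)
      ≡⟨ ≡.cong (λ s → s ℚ.* s) (∣p∣*∣p∣≡p*p a) ⟩
    a ℚ.* a ℚ.* (a ℚ.* a)
      ≤⟨ square-mono-≤ (0≤p*p a) a²≤a²+b² ⟩
    (a ℚ.* a ℚ.+ b ℚ.* b) ℚ.* (a ℚ.* a ℚ.+ b ℚ.* b)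
      ≡⟨ solve 2 (λ a b → (a :* a :+ b :* b) :* (a :* a :+ b :* b) :=
           (a :* a :- b :* b) :* (a :* a :- b :* b) :+ (a :* b :+ b :* a) :* (a :* b :+ b :* a)) ≡.refl a b ⟩
    (a ℚ.* a ℚ.- b ℚ.* b) ℚ.* (a ℚ.* a ℚ.- b ℚ.* b) ℚ.+ (a ℚ.* b ℚ.+ b ℚ.* a) ℚ.* (a ℚ.* b ℚ.+ b ℚ.* a)
      ≤⟨ ℚₚ.+-mono-≤ (bound p<δ) (bound q<δ) ⟩
    δ ℚ.* δ ℚ.+ δ ℚ.* δ ∎)
    where
    open ℚₚ.≤-Reasoning
    instance
      _ = ℚ.positive 0<ε
    0<ε² : 0ℚ ℚ.< ε ℚ.* ε
    0<ε² = ≡.subst (ℚ._< ε ℚ.* ε) (ℚₚ.*-zeroʳ ε) (ℚₚ.*-monoʳ-<-pos ε 0<ε)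
    0<δ : 0ℚ ℚ.< δ
    0<δ = ≡.subst (ℚ._< δ) (ℚₚ.*-zeroʳ ½) (ℚₚ.*-monoʳ-<-pos ½ 0<ε²)
    0<2δ² : 0ℚ ℚ.< δ ℚ.* δ ℚ.+ δ ℚ.* δ
    0<2δ² = ℚₚ.+-mono-< 0<δ² 0<δ²
      where
      0<δ² = ≡.subst (ℚ._< δ ℚ.* δ) (ℚₚ.*-zeroʳ δ) (ℚₚ.*-monoʳ-<-pos δ {{ℚ.positive 0<δ}} 0<δ)
    a²≤a²+b² : a ℚ.* a ℚ.≤ a ℚ.* a ℚ.+ b ℚ.* b
    a²≤a²+b² = ≡.subst (ℚ._≤ a ℚ.* a ℚ.+ b ℚ.* b) (ℚₚ.+-identityʳ (a ℚ.* a)) (ℚₚ.+-monoʳ-≤ (a ℚ.* a) (0≤p*p b))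
    bound : ∀ {p} → ℚ.∣ p ∣ ℚ.< δ → p ℚ.* p ℚ.≤ δ ℚ.* δ
    bound {p} p<δ = ≡.subst (ℚ._≤ δ ℚ.* δ) (∣p∣*∣p∣≡p*p p) (square-mono-≤ (ℚₚ.0≤∣p∣ p) (ℚₚ.<⇒≤ p<δ))

  reduced : ∀ z → z *ᶜ z ≈ᶜ 0ᶜ → z ≈ᶜ 0ᶜ
  reduced (x +i y) (close re-small , close im-small) =
    -- The tolerance δ = ε²/2 satisfies 4δ² = ε⁴: from |x| ≥ ε would follow ε⁴ ≤ (x² + y²)² ≤ 2δ², a
    -- contradiction.
    close (λ ε 0<ε → let (M , p) = re-small (½ ℚ.* (ε ℚ.* ε)) (0<δ 0<ε)
                         (N , q) = im-small (½ ℚ.* (ε ℚ.* ε)) (0<δ 0<ε)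
      in M ℕ.⊔ N , λ n far → drop-0 (square-small (seq x n) (seq y n) 0<ε ≡.refl
           (take-0 (p n (ℕₚ.m⊔n≤o⇒m≤o M N far))) (take-0 (q n (ℕₚ.m⊔n≤o⇒n≤o M N far))))) ,
    close (λ ε 0<ε → let (M , p) = re-small (½ ℚ.* (ε ℚ.* ε)) (0<δ 0<ε)
                         (N , q) = im-small (½ ℚ.* (ε ℚ.* ε)) (0<δ 0<ε)
      in M ℕ.⊔ N , λ n far → drop-0 (square-small (seq y n) (seq x n) 0<ε ≡.refl
           -- The square of y + ix differs from that of x + iy only in the sign of its real part, so
           -- the same estimate bounds the imaginary part.
           (≡.subst (ℚ._< _) (flip-sign (seq x n) (seq y n)) (take-0 (p n (ℕₚ.m⊔n≤o⇒m≤o M N far))))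
           (≡.subst (ℚ._< _) (≡.cong ℚ.∣_∣ (ℚₚ.+-comm (seq x n ℚ.* seq y n) (seq y n ℚ.* seq x n)))
             (take-0 (q n (ℕₚ.m⊔n≤o⇒n≤o M N far))))))
    where
    open ℝ using (seq)
    p-0≡p : ∀ p → p ℚ.- 0ℚ ≡ p
    p-0≡p = ℚₚ.+-identityʳ
    drop-0 : ∀ {p ε} → ℚ.∣ p ∣ ℚ.< ε → ℚ.∣ p ℚ.- 0ℚ ∣ ℚ.< ε
    drop-0 {p} {ε} = ≡.subst (λ q → ℚ.∣ q ∣ ℚ.< ε) (≡.sym (p-0≡p p))
    take-0 : ∀ {p ε} → ℚ.∣ p ℚ.- 0ℚ ∣ ℚ.< ε → ℚ.∣ p ∣ ℚ.< ε
    take-0 {p} {ε} = ≡.subst (λ q → ℚ.∣ q ∣ ℚ.< ε) (p-0≡p p)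
    flip-sign : ∀ a b → ℚ.∣ a ℚ.* a ℚ.- b ℚ.* b ∣ ≡ ℚ.∣ b ℚ.* b ℚ.- a ℚ.* a ∣
    flip-sign a b = ≡.trans (≡.sym (ℚₚ.∣-p∣≡∣p∣ (a ℚ.* a ℚ.- b ℚ.* b)))
      (≡.cong ℚ.∣_∣ (solve 2 (λ a b → :- (a :* a :- b :* b) := b :* b :- a :* a) ≡.refl a b))
    0<δ : ∀ {ε} → 0ℚ ℚ.< ε → 0ℚ ℚ.< ½ ℚ.* (ε ℚ.* ε)
    0<δ {ε} 0<ε = ≡.subst (ℚ._< ½ ℚ.* (ε ℚ.* ε)) (ℚₚ.*-zeroʳ ½) (ℚₚ.*-monoʳ-<-pos ½
      (≡.subst (ℚ._< ε ℚ.* ε) (ℚₚ.*-zeroʳ ε) (ℚₚ.*-monoʳ-<-pos ε {{ℚ.positive 0<ε}} 0<ε)))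

  1≉0 : ¬ 1ᶜ ≈ᶜ 0ᶜ
  1≉0 (close re-small , _) = let (N , bound) = re-small 1ℚ (ℚₚ.positive⁻¹ 1ℚ) in
    ℚₚ.<-irrefl ≡.refl (bound N ℕₚ.≤-refl)

-- Edges as operators on functionals, and the dual form.

module EdgeOperators (K : CommutativeRing 0ℓ 0ℓ) (k ℓ : ℕ) where

  open CommutativeRing K hiding (zero)
  open Signs K
  open LinearOperators K
  open Linear
  open SuperWords K
  open Supersymmetric
  open Over K using (basis)
  open import Algebra.Properties.Semiring.Sum semiring
    using (sum; sum-cong-≋; *-distribˡ-sum; ∑-distrib-+)
  open SetoidReasoning setoid

  -- inj₁ i stands for e i, inj₂ (inj₁ i) for f i and inj₂ (inj₂ i) for f (i + ℓ).
  -- The element Σ e i ⊗ e i - Σ f j ⊗ g j is the sum of sg (negative c) c ⊗ dual c.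
  Colour : Set
  Colour = Fin k ⊎ Fin ℓ ⊎ Fin ℓ

  odd : Colour → Bool
  odd (inj₁ _) = false
  odd (inj₂ _) = true

  dual : Colour → Colour
  dual (inj₁ i)        = inj₁ i
  dual (inj₂ (inj₁ i)) = inj₂ (inj₂ i)
  dual (inj₂ (inj₂ i)) = inj₂ (inj₁ i)

  negative : Colour → Bool
  negative (inj₁ _)        = false
  negative (inj₂ (inj₁ _)) = false
  negative (inj₂ (inj₂ _)) = true

  open Peeling odd

  Word : Set → Set
  Word V = List (V × Colour)

  ∑ₑ ∑ₒ ∑ : (Colour → Carrier) → Carrier
  ∑ₑ s = sum (λ i → s (inj₁ i))
  ∑ₒ s = sum (λ i → s (inj₂ (inj₁ i))) + sum (λ i → s (inj₂ (inj₂ i)))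
  ∑ s  = ∑ₑ s + ∑ₒ s

  ∑ₒ-cong : ∀ {s t} → (∀ c → s c ≈ t c) → ∑ₒ s ≈ ∑ₒ t
  ∑ₒ-cong s≈t = +-cong (sum-cong-≋ (λ i → s≈t (inj₂ (inj₁ i)))) (sum-cong-≋ (λ i → s≈t (inj₂ (inj₂ i))))

  ∑-cong : ∀ {s t} → (∀ c → s c ≈ t c) → ∑ s ≈ ∑ t
  ∑-cong s≈t = +-cong (sum-cong-≋ (λ i → s≈t (inj₁ i))) (∑ₒ-cong s≈t)

  ∑-homo : ∀ {X Y : Set} {T : (X → Carrier) → Y → Carrier} → Linear T →
           ∀ (f : Colour → X → Carrier) y → T (λ x → ∑ (λ c → f c x)) y ≈ ∑ (λ c → T (f c) y)
  ∑-homo lin f y = trans (+-homo lin (λ x → ∑ₑ (λ c → f c x)) (λ x → ∑ₒ (λ c → f c x)) y)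
    (+-cong (sum-homo lin (λ i → f (inj₁ i)) y)
      (trans (+-homo lin (λ x → sum (λ i → f (inj₂ (inj₁ i)) x)) (λ x → sum (λ i → f (inj₂ (inj₂ i)) x)) y)
        (+-cong (sum-homo lin (λ i → f (inj₂ (inj₁ i))) y) (sum-homo lin (λ i → f (inj₂ (inj₂ i))) y))))

  linear-∑ : ∀ {X Y : Set} {T : Colour → (X → Carrier) → Y → Carrier} →
             (∀ c → Linear (T c)) → Linear (λ f y → ∑ (λ c → T c f y))
  linear-∑ lin = linear-+ (linear-sum (λ i → lin (inj₁ i))) (linear-+ (linear-sum (λ i → lin (inj₂ (inj₁ i)))) (linear-sum (λ i → lin (inj₂ (inj₂ i)))))

  ∑-comm-∑ : ∀ (s : Colour → Colour → Carrier) → ∑ (λ c → ∑ (λ d → s c d)) ≈ ∑ (λ d → ∑ (λ c → s c d))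
  ∑-comm-∑ s = ∑-homo {T = λ f (_ : Fin 1) → ∑ f} (linear-∑ (λ c → linear-substitution (λ _ → c))) (λ d c → s c d) zero

  -- A circle too gets one summand per colour, so that its value splits into k in `opₑ` and -2ℓ in
  -- `opₒ`, the contributions of a circle outside and inside F.
  term : ∀ {V : Set} → Edge V → (Word V → Carrier) → Word V → Colour → Carrier
  term circle     E w c = sg (odd c) * E w
  term (link x y) E w c = sg (negative c) * E ((x , c) ∷ (y , dual c) ∷ w)

  opₑ opₒ op : ∀ {V : Set} → Edge V → (Word V → Carrier) → Word V → Carrier
  opₑ e E w = ∑ₑ (term e E w)
  opₒ e E w = ∑ₒ (term e E w)
  op e E w  = opₑ e E w + opₒ e E w

  -- The value of E on the product of a word with the elements
  -- Σ e i ⊗ e i - Σ f j ⊗ g j of the edges; a circle counts k - 2ℓ.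
  Z : ∀ {V : Set} → List (Edge V) → (Word V → Carrier) → Word V → Carrier
  Z []       E = E
  Z (e ∷ es) E = Z es (op e E)

  term-linear : ∀ {V : Set} (e : Edge V) c → Linear (λ E w → term e E w c)
  term-linear circle     c = linear-scale (λ _ → sg (odd c)) (linear-substitution (λ w → w))
  term-linear (link x y) c = linear-scale (λ _ → sg (negative c)) (linear-substitution (λ w → (x , c) ∷ (y , dual c) ∷ w))

  opₑ-linear : ∀ {V : Set} (e : Edge V) → Linear (opₑ e)
  opₑ-linear e = linear-sum (λ i → term-linear e (inj₁ i))

  opₒ-linear : ∀ {V : Set} (e : Edge V) → Linear (opₒ e)
  opₒ-linear e = linear-+ (linear-sum (λ i → term-linear e (inj₂ (inj₁ i)))) (linear-sum (λ i → term-linear e (inj₂ (inj₂ i))))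

  op-linear : ∀ {V : Set} (e : Edge V) → Linear (op e)
  op-linear e = linear-+ (opₑ-linear e) (opₒ-linear e)

  Z-linear : ∀ {V : Set} (es : List (Edge V)) → Linear (Z es)
  Z-linear []       = linear-substitution (λ w → w)
  Z-linear (e ∷ es) = linear-∘ (Z-linear es) (op-linear e)

  Z-++ : ∀ {V : Set} (es es′ : List (Edge V)) E → Z (es ++ es′) E ≡ Z es′ (Z es E)
  Z-++ []       es′ E = ≡.refl
  Z-++ (e ∷ es) es′ E = Z-++ es es′ (op e E)

  Super : ∀ {V : Set} → (Word V → Carrier) → Set
  Super = Supersymmetric oddₗ

  super-+ : ∀ {V : Set} {E E′ : Word V → Carrier} → Super E → Super E′ → Super (λ w → E w + E′ w)
  super-+ S S′ .swap u a b w = trans (+-cong (swap S u a b w) (swap S′ u a b w)) (sym (distribˡ _ _ _))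

  super-* : ∀ {V : Set} {E : Word V → Carrier} c → Super E → Super (λ w → c * E w)
  super-* c S .swap u a b w = trans (*-congˡ (swap S u a b w)) (x∙yz≈y∙xz _ _ _)

  super-sum : ∀ {V : Set} {n} {E : Fin n → Word V → Carrier} → (∀ i → Super (E i)) → Super (λ w → sum (λ i → E i w))
  super-sum {E = E} S .swap u a b w =
    trans (sum-cong-≋ (λ i → swap (S i) u a b w)) (sym (*-distribˡ-sum _ (λ i → E i (u ++ b ∷ a ∷ w))))

  super-term : ∀ {V : Set} {E : Word V → Carrier} → Super E → ∀ e c → Super (λ w → term e E w c)
  super-term S circle     c = super-* (sg (odd c)) S
  super-term S (link x y) c = super-* (sg (negative c)) (super-prefix S ((x , c) ∷ (y , dual c) ∷ []))

  super-op : ∀ {V : Set} {E : Word V → Carrier} → Super E → ∀ e → Super (op e E)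
  super-op S e = super-+ (super-sum (λ i → super-term S e (inj₁ i)))
    (super-+ (super-sum (λ i → super-term S e (inj₂ (inj₁ i)))) (super-sum (λ i → super-term S e (inj₂ (inj₂ i)))))

  super-Z : ∀ {V : Set} {E : Word V → Carrier} → Super E → ∀ es → Super (Z es E)
  super-Z S []       = S
  super-Z S (e ∷ es) = super-Z (super-op S e) es

  odd-dual : ∀ c → odd (dual c) ≡ odd c
  odd-dual (inj₁ _)        = ≡.refl
  odd-dual (inj₂ (inj₁ _)) = ≡.refl
  odd-dual (inj₂ (inj₂ _)) = ≡.refl

  -- Exchanging the ends exchanges a colour with its dual. For odd colours `negative` then changes
  -- its value, and the sign of swapping the two letters makes up for it.
  term-flip : ∀ {V : Set} {E : Word V → Carrier} → Super E → ∀ x y w c →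
              term (link x y) E w c ≈ term (link y x) E w (dual c)
  term-flip S x y w c@(inj₁ i)        = *-congˡ (trans (swap S [] (x , c) (y , c) w) (*-identityˡ _))
  term-flip S x y w c@(inj₂ (inj₁ i)) = trans (*-identityˡ _) (swap S [] (x , c) (y , dual c) w)
  term-flip {E = E} S x y w c@(inj₂ (inj₂ i)) = trans (*-congˡ (swap S [] (x , c) (y , dual c) w))
    (trans (sg-cancel true (E ((y , dual c) ∷ (x , c) ∷ w))) (sym (*-identityˡ _)))

  opₑ-flip : ∀ {V : Set} {E : Word V → Carrier} → Super E → ∀ x y w → opₑ (link x y) E w ≈ opₑ (link y x) E w
  opₑ-flip S x y w = sum-cong-≋ (λ i → term-flip S x y w (inj₁ i))

  opₒ-flip : ∀ {V : Set} {E : Word V → Carrier} → Super E → ∀ x y w → opₒ (link x y) E w ≈ opₒ (link y x) E w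
  opₒ-flip S x y w = trans (∑ₒ-cong (term-flip S x y w)) (+-comm _ _)

  op-flip : ∀ {V : Set} {E : Word V → Carrier} → Super E → ∀ x y w → op (link x y) E w ≈ op (link y x) E w
  op-flip S x y w = +-cong (opₑ-flip S x y w) (opₒ-flip S x y w)

  term-comm : ∀ {V : Set} {E : Word V → Carrier} → Super E → ∀ e e′ w c c′ →
    term e (λ w → term e′ E w c′) w c ≈ term e′ (λ w → term e E w c) w c′
  term-comm S circle     circle       w c c′ = x∙yz≈y∙xz _ _ _
  term-comm S circle     (link x′ y′) w c c′ = x∙yz≈y∙xz _ _ _
  term-comm S (link x y) circle       w c c′ = x∙yz≈y∙xz _ _ _
  term-comm S (link x y) (link x′ y′) w c c′ = trans (x∙yz≈y∙xz _ _ _)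
    (*-congˡ (*-congˡ (even-pairs-commute S (≡.sym (odd-dual c′)) w)))

  op-comm : ∀ {V : Set} {E : Word V → Carrier} → Super E → ∀ e e′ w → op e (op e′ E) w ≈ op e′ (op e E) w
  op-comm {E = E} S e e′ w = begin
    ∑ (term e (op e′ E) w)
      ≈⟨ ∑-cong (λ c → ∑-homo (term-linear e c) (λ c′ w → term e′ E w c′) w) ⟩
    ∑ (λ c → ∑ (λ c′ → term e (λ w → term e′ E w c′) w c))
      ≈⟨ ∑-cong (λ c → ∑-cong (λ c′ → term-comm S e e′ w c c′)) ⟩
    ∑ (λ c → ∑ (λ c′ → term e′ (λ w → term e E w c) w c′))
      ≈⟨ ∑-comm-∑ (λ c c′ → term e′ (λ w → term e E w c) w c′) ⟩
    ∑ (λ c′ → ∑ (λ c → term e′ (λ w → term e E w c) w c′))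
      ≈⟨ ∑-cong (λ c′ → ∑-homo (term-linear e′ c′) (λ c w → term e E w c) w) ⟨
    ∑ (term e′ (op e E) w) ∎

  -- Edge operators commute, so any chosen edge may act last; the edges at a suppressed vertex are
  -- brought to the outside in this way.
  Z-op : ∀ {V : Set} {E : Word V → Carrier} → Super E → ∀ es e w → Z es (op e E) w ≈ op e (Z es E) w
  Z-op S []        e w = refl
  Z-op {E = E} S (e′ ∷ es) e w = trans (cong (Z-linear es) (λ w → op-comm S e′ e w) w) (Z-op (super-op S e′) es e w)

  term-relabel : ∀ {V W : Set} (f : V → W) (E : Word W → Carrier) e w c →
                 term e (E ∘ relabel f) w c ≡ term (mapEdge f e) E (relabel f w) c
  term-relabel f E circle     w c = ≡.refl
  term-relabel f E (link x y) w c = ≡.refl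

  Z-relabel : ∀ {V W : Set} (f : V → W) (E : Word W → Carrier) es w →
              Z es (E ∘ relabel f) w ≈ Z (map (mapEdge f) es) E (relabel f w)
  Z-relabel f E []       w = refl
  Z-relabel f E (e ∷ es) w = trans
    (cong (Z-linear es) (λ w → ∑-cong (λ c → reflexive (term-relabel f E e w c))) w)
    (Z-relabel f (op (mapEdge f e) E) es w)

  -- The form dual to the edge operators: contracting the ends at a vertex of
  -- degree two with it joins the two edges into one.
  form : Colour → Colour → Carrier
  form (inj₁ i)        (inj₁ j)        = basis i j
  form (inj₂ (inj₁ i)) (inj₂ (inj₂ j)) = sg true * basis i j
  form (inj₂ (inj₂ i)) (inj₂ (inj₁ j)) = basis i j
  form _               _               = 0#

  contraction : List Colour → Carrier
  contraction (c ∷ d ∷ []) = form c d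
  contraction _            = 0#

  basis-sym : ∀ {n} (i j : Fin n) → basis i j ≈ basis j i
  basis-sym zero    zero    = refl
  basis-sym zero    (suc j) = refl
  basis-sym (suc i) zero    = refl
  basis-sym (suc i) (suc j) = basis-sym i j

  basis-diagonal : ∀ {n} (i : Fin n) → basis i i ≈ 1#
  basis-diagonal zero    = refl
  basis-diagonal (suc i) = basis-diagonal i

  sum-basis : ∀ {n} (j : Fin n) (s : Fin n → Carrier) → sum (λ i → basis i j * s i) ≈ s j
  sum-basis zero       s = trans (+-cong (*-identityˡ _) (sum-zero (λ i → zeroˡ (s (suc i))))) (+-identityʳ _)
  sum-basis (suc j) s = trans (+-cong (zeroˡ (s zero)) (sum-basis j (s ∘ suc))) (+-identityˡ _)

  form-sym : ∀ c d → form c d ≈ sg (odd c ∧ odd d) * form d c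
  form-sym (inj₁ i)        (inj₁ j)        = trans (basis-sym i j) (sym (*-identityˡ _))
  form-sym (inj₁ i)        (inj₂ (inj₁ j)) = sym (zeroʳ _)
  form-sym (inj₁ i)        (inj₂ (inj₂ j)) = sym (zeroʳ _)
  form-sym (inj₂ (inj₁ i)) (inj₁ j)        = sym (zeroʳ _)
  form-sym (inj₂ (inj₂ i)) (inj₁ j)        = sym (zeroʳ _)
  form-sym (inj₂ (inj₁ i)) (inj₂ (inj₁ j)) = sym (zeroʳ _)
  form-sym (inj₂ (inj₁ i)) (inj₂ (inj₂ j)) = *-congˡ (basis-sym i j)
  form-sym (inj₂ (inj₂ i)) (inj₂ (inj₁ j)) = trans (basis-sym i j) (sym (sg-cancel true _))
  form-sym (inj₂ (inj₂ i)) (inj₂ (inj₂ j)) = sym (zeroʳ _)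

  contraction-super : Supersymmetric odd contraction
  contraction-super .swap []               a b []      = form-sym a b
  contraction-super .swap []               a b (_ ∷ w) = sym (zeroʳ _)
  contraction-super .swap (x ∷ [])         a b w       = sym (zeroʳ _)
  contraction-super .swap (x ∷ y ∷ [])     a b w       = sym (zeroʳ _)
  contraction-super .swap (x ∷ y ∷ z ∷ u)  a b w       = sym (zeroʳ _)

  private
    vanishes : ∀ {a} x → a * (0# * x) ≈ 0#
    vanishes {a} x = trans (*-congˡ (zeroˡ x)) (zeroʳ a)

  -- `form` is inverse to the tensor of an edge: `sg (negative c) * form (dual c) d` is the
  -- Kronecker delta of `c` and `d`. Contracting one end of an edge with a letter `d` thus moves `d`
  -- to the other end.
  form-reproduces : ∀ d (s : Colour → Carrier) → ∑ (λ c → sg (negative c) * (form (dual c) d * s c)) ≈ s d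
  form-reproduces d s with d
  ... | inj₁ j = trans (+-cong
      (trans (sum-cong-≋ (λ i → *-identityˡ (basis i j * s (inj₁ i)))) (sum-basis j (s ∘ inj₁)))
      (+-cong (sum-zero {ℓ} (λ i → vanishes (s (inj₂ (inj₁ i))))) (sum-zero {ℓ} (λ i → vanishes (s (inj₂ (inj₂ i)))))))
      (trans (+-congˡ (+-identityʳ 0#)) (+-identityʳ _))
  ... | inj₂ (inj₁ j) = trans (+-cong (sum-zero {k} (λ i → vanishes (s (inj₁ i))))
      (+-cong (trans (sum-cong-≋ (λ i → *-identityˡ (basis i j * s (inj₂ (inj₁ i))))) (sum-basis j (s ∘ inj₂ ∘ inj₁)))
              (sum-zero {ℓ} (λ i → vanishes (s (inj₂ (inj₂ i)))))))
      (trans (+-identityˡ _) (+-identityʳ _))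
  ... | inj₂ (inj₂ j) = trans (+-cong (sum-zero {k} (λ i → vanishes (s (inj₁ i))))
      (+-cong (sum-zero {ℓ} (λ i → vanishes (s (inj₂ (inj₁ i)))))
              (trans (sum-cong-≋ (λ i → trans (*-congˡ (*-assoc (sg true) (basis i j) (s (inj₂ (inj₂ i)))))
                                              (sg-cancel true (basis i j * s (inj₂ (inj₂ i))))))
                     (sum-basis j (s ∘ inj₂ ∘ inj₂)))))
      (trans (+-identityˡ _) (+-identityˡ _))

-- Vertex degrees under suppression.

module WeightedDegree where

  -- Degrees are weights for the indicator of a vertex. Arbitrary weights are easier to transport
  -- when suppression changes the type of the vertices.
  endWeight : {V : Set} → (V → ℕ) → Edge V → ℕ
  endWeight χ circle     = 0
  endWeight χ (link x y) = χ x ℕ.+ χ y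

  weight : {V : Set} → (V → ℕ) → List (Edge V) → ℕ
  weight χ []       = 0
  weight χ (e ∷ es) = endWeight χ e ℕ.+ weight χ es

  weight-++ : ∀ {V : Set} (χ : V → ℕ) es es′ → weight χ (es ++ es′) ≡ weight χ es ℕ.+ weight χ es′
  weight-++ χ []       es′ = ≡.refl
  weight-++ χ (e ∷ es) es′ = ≡.trans (≡.cong (endWeight χ e ℕ.+_) (weight-++ χ es es′)) (≡.sym (ℕₚ.+-assoc (endWeight χ e) _ _))

  weight-map : ∀ {V W : Set} {χ : V → ℕ} {ξ : W → ℕ} (f : V → W) → (∀ x → ξ (f x) ≡ χ x) →
               ∀ es → weight ξ (map (mapEdge f) es) ≡ weight χ es
  weight-map f eq []              = ≡.refl
  weight-map f eq (circle ∷ es)   = weight-map f eq es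
  weight-map f eq (link x y ∷ es) = ≡.cong₂ ℕ._+_ (≡.cong₂ ℕ._+_ (eq x) (eq y)) (weight-map f eq es)

  at-nothing : {V : Set} → Maybe V → ℕ
  at-nothing nothing  = 1
  at-nothing (just _) = 0

  off-nothing : {V : Set} → (V → ℕ) → Maybe V → ℕ
  off-nothing χ nothing  = 0
  off-nothing χ (just x) = χ x

  total : {V : Set} → (V → ℕ) → List V → ℕ
  total χ []       = 0
  total χ (x ∷ xs) = χ x ℕ.+ total χ xs

  weight-stub-rest : ∀ {V : Set} (χ : V → ℕ) es →
    weight (off-nothing χ) es ≡ total χ (mapMaybe stub es) ℕ.+ weight χ (mapMaybe rest es)
  weight-stub-rest χ []                              = ≡.refl
  weight-stub-rest χ (circle ∷ es)                   = weight-stub-rest χ es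
  weight-stub-rest χ (link nothing nothing ∷ es)     = weight-stub-rest χ es
  weight-stub-rest χ (link nothing (just y) ∷ es)    =
    ≡.trans (≡.cong (χ y ℕ.+_) (weight-stub-rest χ es)) (≡.sym (ℕₚ.+-assoc (χ y) _ _))
  weight-stub-rest χ (link (just x) nothing ∷ es)    =
    ≡.trans (≡.cong₂ ℕ._+_ (ℕₚ.+-identityʳ (χ x)) (weight-stub-rest χ es)) (≡.sym (ℕₚ.+-assoc (χ x) _ _))
  weight-stub-rest χ (link (just x) (just y) ∷ es)   =
    ≡.trans (≡.cong (χ x ℕ.+ χ y ℕ.+_) (weight-stub-rest χ es))
      (solve 3 (λ a t r → a :+ (t :+ r) := t :+ (a :+ r)) ≡.refl (χ x ℕ.+ χ y) (total χ (mapMaybe stub es)) (weight χ (mapMaybe rest es)))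
    where open +-*-Solver

  no-stubs : ∀ {V : Set} (es : List (Edge (Maybe V))) → weight at-nothing es ≡ 0 → mapMaybe stub es ≡ []
  no-stubs []                            eq = ≡.refl
  no-stubs (circle ∷ es)                 eq = no-stubs es eq
  no-stubs (link (just _) (just _) ∷ es) eq = no-stubs es eq

  one-stub : ∀ {V : Set} (es : List (Edge (Maybe V))) → weight at-nothing es ≡ 1 → ∃[ y ] mapMaybe stub es ≡ y ∷ []
  one-stub (circle ∷ es)                 eq = one-stub es eq
  one-stub (link nothing (just y) ∷ es)  eq = y , ≡.cong (y ∷_) (no-stubs es (ℕₚ.suc-injective eq))
  one-stub (link (just x) nothing ∷ es)  eq = x , ≡.cong (x ∷_) (no-stubs es (ℕₚ.suc-injective eq))
  one-stub (link (just _) (just _) ∷ es) eq = one-stub es eq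

  -- Two stubs become the ends of the joined edge, and a loop becomes a circle, which has no ends. A
  -- single stub, which `join` would drop, is excluded by the degree.
  weight-suppress : ∀ {V : Set} (χ : V → ℕ) es → weight at-nothing es ≡ 2 → weight χ (suppress es) ≡ weight (off-nothing χ) es
  weight-suppress {V} χ es eq = ≡.trans (≡.trans (weight-++ χ (join (mapMaybe stub es)) (mapMaybe rest es))
    (≡.cong (ℕ._+ weight χ (mapMaybe rest es)) (joined (two-stubs es eq)))) (≡.sym (weight-stub-rest χ es))
    where
    TwoOrNone : List V → Set
    TwoOrNone xs = xs ≡ [] ⊎ ∃₂ λ x y → xs ≡ x ∷ y ∷ []
    two-stubs : ∀ es → weight at-nothing es ≡ 2 → TwoOrNone (mapMaybe stub es)
    two-stubs (circle ∷ es)                 eq = two-stubs es eq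
    two-stubs (link (just _) (just _) ∷ es) eq = two-stubs es eq
    two-stubs (link nothing nothing ∷ es)   eq = inj₁ (no-stubs es (ℕₚ.suc-injective (ℕₚ.suc-injective eq)))
    two-stubs (link nothing (just x) ∷ es)  eq with one-stub es (ℕₚ.suc-injective eq)
    ... | y , stubs = inj₂ (x , y , ≡.cong (x ∷_) stubs)
    two-stubs (link (just x) nothing ∷ es)  eq with one-stub es (ℕₚ.suc-injective eq)
    ... | y , stubs = inj₂ (x , y , ≡.cong (x ∷_) stubs)
    joined : ∀ {xs} → TwoOrNone xs → weight χ (join xs) ≡ total χ xs
    joined (inj₁ ≡.refl)           = ≡.refl
    joined (inj₂ (x , y , ≡.refl)) = ≡.trans (ℕₚ.+-identityʳ _) (≡.cong (χ x ℕ.+_) (≡.sym (ℕₚ.+-identityʳ (χ y))))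

open WeightedDegree

-- A copy of the local function `split` of `suppressAll`, which cannot be named from outside.
splitLabel : ∀ {t} {V : Set} → Fin (suc t) ⊎ V → Maybe (Fin t ⊎ V)
splitLabel (inj₁ zero)    = nothing
splitLabel (inj₁ (suc i)) = just (inj₁ i)
splitLabel (inj₂ x)       = just (inj₂ x)

labelWeight : ∀ {t} {V : Set} → Fin t → Fin t ⊎ V → ℕ
labelWeight i (inj₁ j) = if does (i Fin.≟ j) then 1 else 0
labelWeight i (inj₂ _) = 0

-- Suppression of vertices as contraction with the dual form.

module Suppression (K : CommutativeRing 0ℓ 0ℓ) (k ℓ : ℕ) where

  open CommutativeRing K hiding (zero)
  open Signs K
  open LinearOperators K
  open Linear
  open SuperWords K
  open EdgeOperators K k ℓ
  open Peeling odd
  open SetoidReasoning setoid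

  ⊛-linear : ∀ {V : Set} (φ : List Colour → Carrier) → Linear (_⊛_ {V} φ)
  ⊛-linear φ = linear-scale (λ w → sg (inversions w)) (linear-scale (λ w → φ (here w)) (linear-substitution there))

  -- The two letters of an edge have equal parity, so moving the letters at `nothing` past both of
  -- them costs no sign.
  op-just : ∀ {V : Set} φ (e : Edge V) E w → op (mapEdge just e) (φ ⊛ E) w ≈ (φ ⊛ op e E) w
  op-just φ e E w = trans (∑-cong (step e)) (sym (∑-homo (⊛-linear φ) (λ c w → term e E w c) w))
    where
    step : ∀ e c → term (mapEdge just e) (φ ⊛ E) w c ≈ (φ ⊛ λ w → term e E w c) w
    step circle     c = sym (*-homo (⊛-linear φ) (sg (odd c)) E w)
    step (link x y) c = trans
      (*-congˡ (*-congʳ (reflexive (≡.cong sg cancel))))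
      (sym (*-homo (⊛-linear φ) (sg (negative c)) (λ w → E ((x , c) ∷ (y , dual c) ∷ w)) w))
      where
      cancel : inversions ((just x , c) ∷ (just y , dual c) ∷ w) ≡ inversions w
      cancel = ≡.trans
        (≡.cong (λ o → (odd c ∧ parity odd (here w)) xor ((o ∧ parity odd (here w)) xor inversions w)) (odd-dual c))
        (≡.trans (≡.sym (Bool.xor-assoc (odd c ∧ parity odd (here w)) _ _)) (≡.cong (_xor inversions w) (Bool.xor-same (odd c ∧ parity odd (here w)))))

  private
    χ = contraction

    absorb : ∀ {a x} → a ≈ 0# → ∀ s → s * (a * x) ≈ a * x
    absorb {a} {x} a≈0 s = trans (trans (*-congˡ ax≈0) (zeroʳ s)) (sym ax≈0)
      where
      ax≈0 = trans (*-congʳ a≈0) (zeroˡ x)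

  contract-path : ∀ {V : Set} x y (E : Word V → Carrier) →
    op (link nothing (just y)) (op (link (just x) nothing) (χ ⊛ E)) [] ≈ op (link x y) E []
  contract-path x y E = ∑-cong λ d → *-congˡ {x = sg (negative d)} (trans
    (∑-cong (λ c → *-congˡ {x = sg (negative c)} (step c d)))
    (form-reproduces d (λ c → E ((x , c) ∷ (y , dual d) ∷ []))))
    where
    -- Where `form` can be nonzero, `dual c` and `d` have equal parity and `c` passes them without
    -- sign; elsewhere both sides vanish.
    step : ∀ c d → sg (inversions ((just x , c) ∷ (nothing , dual c) ∷ (nothing , d) ∷ (just y , dual d) ∷ []))
                     * (form (dual c) d * E ((x , c) ∷ (y , dual d) ∷ []))
                   ≈ form (dual c) d * E ((x , c) ∷ (y , dual d) ∷ [])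
    step (inj₁ i)        (inj₁ j)        = *-identityˡ _
    step (inj₁ i)        (inj₂ (inj₁ j)) = absorb refl _
    step (inj₁ i)        (inj₂ (inj₂ j)) = absorb refl _
    step (inj₂ (inj₁ i)) (inj₁ j)        = absorb refl _
    step (inj₂ (inj₂ i)) (inj₁ j)        = absorb refl _
    step (inj₂ (inj₁ i)) (inj₂ (inj₁ j)) = *-identityˡ _
    step (inj₂ (inj₁ i)) (inj₂ (inj₂ j)) = absorb refl _
    step (inj₂ (inj₂ i)) (inj₂ (inj₁ j)) = absorb refl _
    step (inj₂ (inj₂ i)) (inj₂ (inj₂ j)) = *-identityˡ _

  -- Each even colour contributes 1 and each odd colour -1: a closed loop takes the supertrace of
  -- the identity. This is where the value k - 2ℓ of a circle comes from.
  contract-loop : ∀ {V : Set} (E : Word V → Carrier) → op (link nothing nothing) (χ ⊛ E) [] ≈ op circle E []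
  contract-loop E = ∑-cong step
    where
    step : ∀ c → term (link nothing nothing) (χ ⊛ E) [] c ≈ term circle E [] c
    step (inj₁ i)        = trans (*-identityˡ _) (trans (*-identityˡ _) (*-congʳ (basis-diagonal i)))
    step (inj₂ (inj₁ i)) = trans (*-identityˡ _) (trans (*-identityˡ _)
      (*-congʳ (trans (*-congˡ (basis-diagonal i)) (*-identityʳ (sg true)))))
    step (inj₂ (inj₂ i)) = *-congˡ (trans (*-identityˡ _) (trans (*-congʳ (basis-diagonal i)) (*-identityˡ _)))

  Z-rest : ∀ {V : Set} (es : List (Edge (Maybe V))) → weight at-nothing es ≡ 0 →
           ∀ E w → Z es (χ ⊛ E) w ≈ (χ ⊛ Z (mapMaybe rest es) E) w
  Z-rest []                            eq E w = refl
  Z-rest (circle ∷ es)                 eq E w =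
    trans (cong (Z-linear es) (op-just χ circle E) w) (Z-rest es eq (op circle E) w)
  Z-rest (link (just x) (just y) ∷ es) eq E w =
    trans (cong (Z-linear es) (op-just χ (link x y) E) w) (Z-rest es eq (op (link x y) E) w)

  module _ {V : Set} where

    Z-one-stub : ∀ (es : List (Edge (Maybe V))) → weight at-nothing es ≡ 1 → ∀ {y} → mapMaybe stub es ≡ y ∷ [] →
                 ∀ E → Super E → ∀ w → Z es (χ ⊛ E) w ≈ op (link nothing (just y)) (χ ⊛ Z (mapMaybe rest es) E) w
    Z-one-stub (circle ∷ es) eq stubs E S w =
      trans (cong (Z-linear es) (op-just χ circle E) w) (Z-one-stub es eq stubs (op circle E) (super-op S circle) w)
    Z-one-stub (link (just x) (just y) ∷ es) eq stubs E S w =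
      trans (cong (Z-linear es) (op-just χ (link x y) E) w) (Z-one-stub es eq stubs (op (link x y) E) (super-op S (link x y)) w)
    Z-one-stub (link nothing (just y) ∷ es) eq stubs E S w with List.∷-injectiveˡ stubs
    ... | ≡.refl = trans (Z-op (⊛-super contraction-super S) es (link nothing (just y)) w)
                         (cong (op-linear (link nothing (just y))) (Z-rest es (ℕₚ.suc-injective eq) E) w)
    Z-one-stub (link (just x) nothing ∷ es) eq stubs E S w with List.∷-injectiveˡ stubs
    ... | ≡.refl = begin
      Z es (op (link (just x) nothing) (χ ⊛ E)) w
        ≈⟨ cong (Z-linear es) (op-flip χE-super (just x) nothing) w ⟩
      Z es (op (link nothing (just x)) (χ ⊛ E)) w
        ≈⟨ Z-op χE-super es (link nothing (just x)) w ⟩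
      op (link nothing (just x)) (Z es (χ ⊛ E)) w
        ≈⟨ cong (op-linear (link nothing (just x))) (Z-rest es (ℕₚ.suc-injective eq) E) w ⟩
      op (link nothing (just x)) (χ ⊛ Z (mapMaybe rest es) E) w ∎
      where χE-super = ⊛-super contraction-super S

    Z-two-stubs : ∀ x (es : List (Edge (Maybe V))) → weight at-nothing es ≡ 1 → ∀ E → Super E →
      Z es (op (link (just x) nothing) (χ ⊛ E)) [] ≈ Z (join (x ∷ mapMaybe stub es) ++ mapMaybe rest es) E []
    Z-two-stubs x es eq E S with one-stub es eq
    ... | y , stubs rewrite stubs = begin
      Z es (op (link (just x) nothing) (χ ⊛ E)) []
        ≈⟨ Z-op χE-super es (link (just x) nothing) [] ⟩
      op (link (just x) nothing) (Z es (χ ⊛ E)) []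
        ≈⟨ cong (op-linear (link (just x) nothing)) (Z-one-stub es eq stubs E S) [] ⟩
      op (link (just x) nothing) (op (link nothing (just y)) (χ ⊛ R)) []
        ≈⟨ op-comm (⊛-super contraction-super R-super) (link (just x) nothing) (link nothing (just y)) [] ⟩
      op (link nothing (just y)) (op (link (just x) nothing) (χ ⊛ R)) []
        ≈⟨ contract-path x y R ⟩
      op (link x y) R []
        ≈⟨ Z-op S (mapMaybe rest es) (link x y) [] ⟨
      Z (mapMaybe rest es) (op (link x y) E) [] ∎
      where
      R = Z (mapMaybe rest es) E
      R-super = super-Z S (mapMaybe rest es)
      χE-super = ⊛-super contraction-super S

    Z-move : ∀ (es es′ : List (Edge V)) e {E} → Super E → Z (es ++ es′) (op e E) [] ≈ Z (es ++ e ∷ es′) E []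
    Z-move []       es′ e S = refl
    Z-move (d ∷ es) es′ e S = trans (cong (Z-linear (es ++ es′)) (op-comm S d e) []) (Z-move es es′ e (super-op S d))

    -- Edges away from `nothing` pass to the second factor. The first edge that meets `nothing`
    -- decides whether a loop or a path of two edges is contracted.
    Z-suppress : ∀ (es : List (Edge (Maybe V))) → weight at-nothing es ≡ 2 → ∀ E → Super E →
                 Z es (χ ⊛ E) [] ≈ Z (suppress es) E []
    Z-suppress (circle ∷ es) eq E S = begin
      Z es (op circle (χ ⊛ E)) []
        ≈⟨ cong (Z-linear es) (op-just χ circle E) [] ⟩
      Z es (χ ⊛ op circle E) []
        ≈⟨ Z-suppress es eq (op circle E) (super-op S circle) ⟩
      Z (suppress es) (op circle E) []
        ≈⟨ Z-move (join (mapMaybe stub es)) (mapMaybe rest es) circle S ⟩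
      Z (suppress (circle ∷ es)) E [] ∎
    Z-suppress (link (just x) (just y) ∷ es) eq E S = begin
      Z es (op (link (just x) (just y)) (χ ⊛ E)) []
        ≈⟨ cong (Z-linear es) (op-just χ (link x y) E) [] ⟩
      Z es (χ ⊛ op (link x y) E) []
        ≈⟨ Z-suppress es eq (op (link x y) E) (super-op S (link x y)) ⟩
      Z (suppress es) (op (link x y) E) []
        ≈⟨ Z-move (join (mapMaybe stub es)) (mapMaybe rest es) (link x y) S ⟩
      Z (suppress (link (just x) (just y) ∷ es)) E [] ∎
    Z-suppress (link nothing nothing ∷ es) eq E S
      -- The loop uses up both ends at `nothing`, so `join` has nothing to add.
      rewrite no-stubs es (ℕₚ.suc-injective (ℕₚ.suc-injective eq)) = begin
      Z es (op (link nothing nothing) (χ ⊛ E)) []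
        ≈⟨ Z-op (⊛-super contraction-super S) es (link nothing nothing) [] ⟩
      op (link nothing nothing) (Z es (χ ⊛ E)) []
        ≈⟨ cong (op-linear (link nothing nothing)) (Z-rest es (ℕₚ.suc-injective (ℕₚ.suc-injective eq)) E) [] ⟩
      op (link nothing nothing) (χ ⊛ Z (mapMaybe rest es) E) []
        ≈⟨ contract-loop (Z (mapMaybe rest es) E) ⟩
      op circle (Z (mapMaybe rest es) E) []
        ≈⟨ Z-op S (mapMaybe rest es) circle [] ⟨
      Z (mapMaybe rest es) (op circle E) [] ∎
    Z-suppress (link (just x) nothing ∷ es) eq E S = Z-two-stubs x es (ℕₚ.suc-injective eq) E S
    Z-suppress (link nothing (just x) ∷ es) eq E S = trans
      (cong (Z-linear es) (op-flip (⊛-super contraction-super S) nothing (just x)) [])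
      (Z-two-stubs x es (ℕₚ.suc-injective eq) E S)

  unlabel : {V : Set} → Fin 0 ⊎ V → V
  unlabel = [ (λ ()) , (λ x → x) ]′

  -- Labels are peeled off in the order in which `suppressAll` suppresses them, so that both
  -- recursions unfold together.
  contractLabels : ∀ t {V : Set} → (Word V → Carrier) → Word (Fin t ⊎ V) → Carrier
  contractLabels zero    E w = E (relabel unlabel w)
  contractLabels (suc t) E w = (contraction ⊛ contractLabels t E) (relabel splitLabel w)

  contractLabels-super : ∀ t {V : Set} {E : Word V → Carrier} → Super E → Super (contractLabels t E)
  contractLabels-super zero    S = super-map (Product.map₁ unlabel) S
  contractLabels-super (suc t) S = super-map (Product.map₁ splitLabel) (⊛-super contraction-super (contractLabels-super t S))

  Z-suppressAll : ∀ t {V : Set} (es : List (Edge (Fin t ⊎ V))) → (∀ i → weight (labelWeight i) es ≡ 2) →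
    ∀ (E : Word V → Carrier) → Super E → Z es (contractLabels t E) [] ≈ Z (suppressAll t es) E []
  Z-suppressAll zero    es deg E S = trans (Z-relabel unlabel E es [])
    (reflexive (≡.cong (λ es → Z es E []) (List.map-cong (λ { circle → ≡.refl ; (link (inj₂ x) (inj₂ y)) → ≡.refl }) es)))
  Z-suppressAll (suc t) {V} es deg E S = begin
    Z es (contractLabels (suc t) E) []
      ≈⟨ Z-relabel splitLabel (contraction ⊛ contractLabels t E) es [] ⟩
    Z (map (mapEdge splitLabel) es) (contraction ⊛ contractLabels t E) []
      ≈⟨ Z-suppress (map (mapEdge splitLabel) es) deg-zero (contractLabels t E) (contractLabels-super t S) ⟩
    Z (suppress (map (mapEdge splitLabel) es)) (contractLabels t E) []
      ≈⟨ Z-suppressAll t (suppress (map (mapEdge splitLabel) es)) deg-suc E S ⟩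
    Z (suppressAll t (suppress (map (mapEdge splitLabel) es))) E []
      ≡⟨ ≡.cong (λ es → Z (suppressAll t (suppress es)) E []) (List.map-cong
           (λ { circle → ≡.refl ; (link x y) → ≡.cong₂ link (split-eq x) (split-eq y) }) es) ⟩
    Z (suppressAll (suc t) es) E [] ∎
    where
    deg-zero : weight at-nothing (map (mapEdge splitLabel) es) ≡ 2
    deg-zero = ≡.trans (weight-map splitLabel
      (λ { (inj₁ zero) → ≡.refl ; (inj₁ (suc i)) → ≡.refl ; (inj₂ x) → ≡.refl }) es) (deg zero)
    deg-suc : ∀ i → weight (labelWeight i) (suppress (map (mapEdge splitLabel) es)) ≡ 2
    deg-suc i = ≡.trans (weight-suppress (labelWeight i) (map (mapEdge splitLabel) es) deg-zero)
      (≡.trans (weight-map splitLabel (λ { (inj₁ zero) → ≡.refl ; (inj₁ (suc j)) → ≡.refl ; (inj₂ x) → ≡.refl }) es) (deg (suc i)))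
    -- The underscore is solved by the inaccessible local function of `suppressAll`.
    split-eq : ∀ (x : Fin (suc t) ⊎ V) → splitLabel x ≡ _
    split-eq (inj₁ zero)    = ≡.refl
    split-eq (inj₁ (suc i)) = ≡.refl
    split-eq (inj₂ x)       = ≡.refl

-- Matrices that factor through a space of given dimension.

module Factorizations (K : CommutativeRing 0ℓ 0ℓ) where

  open CommutativeRing K hiding (zero)
  open LinearOperators K
  open import Algebra.Properties.Semiring.Sum semiring
    using (sum; sum-cong-≋; *-distribˡ-sum)

  -- M agrees on P × Q with a matrix of rank at most r.
  record Factorization {I J : Set} (P : I → Set) (Q : J → Set) (r : ℕ) (M : I → J → Carrier) : Set where
    field
      left    : I → Vector Carrier r
      right   : J → Vector Carrier r
      factors : ∀ {i j} → P i → Q j → M i j ≈ sum (λ x → left i x * right j x)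

  open Factorization public

  module _ {I J : Set} {P : I → Set} {Q : J → Set} where

    factor-cong : ∀ {r M N} → (∀ {i j} → P i → Q j → M i j ≈ N i j) → Factorization P Q r N → Factorization P Q r M
    factor-cong M≈N f = record
      { left = left f ; right = right f ; factors = λ Pi Qj → trans (M≈N Pi Qj) (factors f Pi Qj) }

    factor-+ : ∀ {r s M N} → Factorization P Q r M → Factorization P Q s N →
               Factorization P Q (r ℕ.+ s) (λ i j → M i j + N i j)
    factor-+ {r} {s} {M} {N} f g = record
      { left    = λ i → left f i Vector.++ left g i
      ; right   = λ j → right f j Vector.++ right g j
      ; factors = λ {i} {j} Pi Qj → trans (+-cong (factors f Pi Qj) (factors g Pi Qj)) (sym (trans
          (sum-splitAt r (λ x → (left f i Vector.++ left g i) x * (right f j Vector.++ right g j) x))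
          (+-cong (sum-cong-≋ (λ x → reflexive (≡.cong₂ _*_ (lookup-++ˡ (left f i) (left g i) x) (lookup-++ˡ (right f j) (right g j) x))))
                  (sum-cong-≋ (λ x → reflexive (≡.cong₂ _*_ (lookup-++ʳ (left f i) (left g i) x) (lookup-++ʳ (right f j) (right g j) x)))))))
      }

    factor-sum : ∀ {n r} {M : Fin n → I → J → Carrier} → (∀ x → Factorization P Q r (M x)) →
                 Factorization P Q (n ℕ.* r) (λ i j → sum (λ x → M x i j))
    factor-sum {zero}  f = record { left = λ _ () ; right = λ _ () ; factors = λ _ _ → refl }
    factor-sum {suc n} f = factor-+ (f zero) (factor-sum (f ∘ suc))

    factor-scale : ∀ {I′ J′ : Set} {P′ : I′ → Set} {Q′ : J′ → Set} {r M} (a : I → Carrier) (b : J → Carrier)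
      (g : I → I′) (h : J → J′) → (∀ {i} → P i → P′ (g i)) → (∀ {j} → Q j → Q′ (h j)) →
      Factorization P′ Q′ r M → Factorization P Q r (λ i j → a i * b j * M (g i) (h j))
    factor-scale a b g h P⇒P′ Q⇒Q′ f = record
      { left    = λ i x → a i * left f (g i) x
      ; right   = λ j x → b j * right f (h j) x
      ; factors = λ {i} {j} Pi Qj → trans (*-congˡ (factors f (P⇒P′ Pi) (Q⇒Q′ Qj)))
          (trans (*-distribˡ-sum (a i * b j) (λ x → left f (g i) x * right f (h j) x))
            (sum-cong-≋ (λ x → *-interchange (a i) (b j) (left f (g i) x) (right f (h j) x))))
      }
      where
      open import Algebra.Properties.CommutativeSemigroup *-commutativeSemigroup using () renaming (interchange to *-interchange)

weight-indicator : ∀ {t n} (v : Fin t ⊎ Fin n) es → FragmentIncidence.degree es ⊤ v ≡ weight (FragmentIncidence.indicator v) es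
weight-indicator v []              = ≡.refl
weight-indicator v (circle ∷ es)   = weight-indicator v es
weight-indicator v (link x y ∷ es) = ≡.cong (FragmentIncidence.multiplicity v (link x y) ℕ.+_) (weight-indicator v es)

weight-labelled : ∀ {t} (F : Fragment t) i → weight (labelWeight i) (Fragment.edges F) ≡ 1
weight-labelled F i = ≡.trans (≡.sym (weight-cong indicator≡labelWeight edges))
  (≡.trans (≡.sym (weight-indicator (inj₁ i) edges)) (labelled i))
  where
  open Fragment F
  indicator≡labelWeight : ∀ x → FragmentIncidence.indicator (inj₁ i) x ≡ labelWeight i x
  indicator≡labelWeight (inj₁ j) = ≡.refl
  indicator≡labelWeight (inj₂ x) = ≡.refl
  weight-cong : ∀ {V : Set} {χ ξ : V → ℕ} → (∀ x → χ x ≡ ξ x) → ∀ es → weight χ es ≡ weight ξ es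
  weight-cong eq []              = ≡.refl
  weight-cong eq (circle ∷ es)   = weight-cong eq es
  weight-cong eq (link x y ∷ es) = ≡.cong₂ ℕ._+_ (≡.cong₂ ℕ._+_ (eq x) (eq y)) (weight-cong eq es)

-- Gluing of fragments and the sum over label colours.

module Gluing (K : CommutativeRing 0ℓ 0ℓ) (k ℓ : ℕ) where

  open CommutativeRing K hiding (zero)
  open Signs K
  open LinearOperators K
  open Linear
  open SuperWords K
  open EdgeOperators K k ℓ
  open Peeling odd
  open Suppression K k ℓ
  open Factorizations K
  open Fragment using (order; edges)
  open import Algebra.Properties.Semiring.Sum semiring
    using (sum; sum-cong-≋; *-distribˡ-sum)
  open SetoidReasoning setoid

  letterWeight : {V : Set} → (V → ℕ) → Word V → ℕ
  letterWeight χ []            = 0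
  letterWeight χ ((x , _) ∷ w) = χ x ℕ.+ letterWeight χ w

  letterWeight-relabel : ∀ {V W : Set} {χ : V → ℕ} {ξ : W → ℕ} (f : V → W) → (∀ x → ξ (f x) ≡ χ x) →
                         ∀ w → letterWeight ξ (relabel f w) ≡ letterWeight χ w
  letterWeight-relabel f eq []            = ≡.refl
  letterWeight-relabel f eq ((x , _) ∷ w) = ≡.cong₂ ℕ._+_ (eq x) (letterWeight-relabel f eq w)

  length-here : ∀ {V : Set} (w : Word (Maybe V)) → length (here w) ≡ letterWeight at-nothing w
  length-here []                  = ≡.refl
  length-here ((nothing , _) ∷ w) = ≡.cong suc (length-here w)
  length-here ((just _  , _) ∷ w) = length-here w

  letterWeight-there : ∀ {V : Set} (χ : V → ℕ) w → letterWeight χ (there w) ≡ letterWeight (off-nothing χ) w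
  letterWeight-there χ []                  = ≡.refl
  letterWeight-there χ ((nothing , _) ∷ w) = letterWeight-there χ w
  letterWeight-there χ ((just x  , _) ∷ w) = ≡.cong (χ x ℕ.+_) (letterWeight-there χ w)

  -- An edge puts one letter at each of its ends whatever its colour, so only words with prescribed
  -- numbers of letters are ever evaluated. For a fragment these are the words with one letter at
  -- each label, the only ones for which a factorization is available.
  Z-cong-weight : ∀ {V I : Set} (χ : I → V → ℕ) es {E E′ : Word V → Carrier} v →
    (∀ w → (∀ i → letterWeight (χ i) w ≡ weight (χ i) es ℕ.+ letterWeight (χ i) v) → E w ≈ E′ w) → Z es E v ≈ Z es E′ v
  Z-cong-weight χ []       v E≈E′ = E≈E′ v (λ i → ≡.refl)
  Z-cong-weight χ (e ∷ es) {E} {E′} v E≈E′ = Z-cong-weight χ es v (λ w weights → ∑-cong (step e E≈E′ w weights))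
    where
    step : ∀ e →
      (∀ w → (∀ i → letterWeight (χ i) w ≡ weight (χ i) (e ∷ es) ℕ.+ letterWeight (χ i) v) → E w ≈ E′ w) →
      ∀ w → (∀ i → letterWeight (χ i) w ≡ weight (χ i) es ℕ.+ letterWeight (χ i) v) →
      ∀ c → term e E w c ≈ term e E′ w c
    step circle     E≈E′ w weights c = *-congˡ (E≈E′ w weights)
    step (link x y) E≈E′ w weights c = *-congˡ (E≈E′ _ (λ i → ≡.trans
      (≡.cong (λ n → χ i x ℕ.+ (χ i y ℕ.+ n)) (weights i))
      (solve 4 (λ x y e v → x :+ (y :+ (e :+ v)) := x :+ y :+ e :+ v) ≡.refl (χ i x) (χ i y) (weight (χ i) es) (letterWeight (χ i) v))))
      where open +-*-Solver

  Z-suffix : ∀ {V : Set} (E : Word V → Carrier) v es w → Z es (λ u → E (u ++ v)) w ≈ Z es E (w ++ v)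
  Z-suffix E v []       w = refl
  Z-suffix E v (e ∷ es) w = trans
    (cong (Z-linear es) (λ w → ∑-cong (λ c → reflexive (step e w c))) w)
    (Z-suffix (op e E) v es w)
    where
    step : ∀ e w c → term e (λ u → E (u ++ v)) w c ≡ term e E (w ++ v) c
    step circle     w c = ≡.refl
    step (link x y) w c = ≡.refl

  relabel-splitLabel : ∀ {t} {V W : Set} (g : V → W) (w : Word (Fin (suc t) ⊎ V)) →
    relabel splitLabel (relabel (Sum.map₂ g) w) ≡ relabel (Maybe.map (Sum.map₂ g)) (relabel splitLabel w)
  relabel-splitLabel g w = ≡.trans
    (relabel-∘ {h = λ x → Maybe.map (Sum.map₂ g) (splitLabel x)}
      (λ { (inj₁ zero) → ≡.refl ; (inj₁ (suc i)) → ≡.refl ; (inj₂ x) → ≡.refl }) w)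
    (≡.sym (relabel-∘ (λ _ → ≡.refl) w))

  -- `form` vanishes unless `c` and `d` have equal parity. A sign that couples the first word,
  -- through `p`, with the second word's letter `d` is thereby expressed by the first word alone.
  contraction-parity : ∀ p c d → sg (p ∧ odd d) * form c d ≈ sg (odd c ∧ p) * form c d
  contraction-parity p (inj₁ i)        (inj₁ j)        = *-congʳ (reflexive (≡.cong sg (Bool.∧-zeroʳ p)))
  contraction-parity p (inj₁ i)        (inj₂ (inj₁ j)) = trans (zeroʳ _) (sym (zeroʳ _))
  contraction-parity p (inj₁ i)        (inj₂ (inj₂ j)) = trans (zeroʳ _) (sym (zeroʳ _))
  contraction-parity p (inj₂ (inj₁ i)) (inj₁ j)        = trans (zeroʳ _) (sym (zeroʳ _))
  contraction-parity p (inj₂ (inj₂ i)) (inj₁ j)        = trans (zeroʳ _) (sym (zeroʳ _))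
  contraction-parity p (inj₂ c)        (inj₂ d)        = *-congʳ (reflexive (≡.cong sg (Bool.∧-identityʳ p)))

  module _ (E : ∀ n → Word (Fin n) → Carrier)
           (E-multiplicative : ∀ m n u w → E (m ℕ.+ n) (relabel (_↑ˡ n) u ++ relabel (m ↑ʳ_) w) ≈ E m u * E n w) where

    Boundary : ℕ → Set
    Boundary t = Σ ℕ (λ n → Word (Fin t ⊎ Fin n))

    glued : ∀ t → Boundary t → Boundary t → Carrier
    glued t (m , u) (n , w) =
      contractLabels t (E (m ℕ.+ n)) (relabel (Sum.map₂ (_↑ˡ n)) u ++ relabel (Sum.map₂ (m ↑ʳ_)) w)

    Once : ∀ t → Boundary t → Set
    Once t (n , w) = ∀ i → letterWeight (labelWeight i) w ≡ 1

    removeLabel : ∀ {t} → Boundary (suc t) → Boundary t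
    removeLabel (n , w) = n , there (relabel splitLabel w)

    once-removeLabel : ∀ {t} (b : Boundary (suc t)) → Once (suc t) b → Once t (removeLabel b)
    once-removeLabel (n , w) once i = ≡.trans (letterWeight-there (labelWeight i) (relabel splitLabel w))
      (≡.trans (letterWeight-relabel splitLabel (λ { (inj₁ zero) → ≡.refl ; (inj₁ (suc j)) → ≡.refl ; (inj₂ x) → ≡.refl }) w)
               (once (suc i)))

    label-letter : ∀ {t} (b : Boundary (suc t)) → Once (suc t) b → ∃[ c ] here (relabel splitLabel (proj₂ b)) ≡ c ∷ []
    label-letter (n , w) once = singleton (here (relabel splitLabel w)) (≡.trans (length-here (relabel splitLabel w))
      (≡.trans (letterWeight-relabel splitLabel (λ { (inj₁ zero) → ≡.refl ; (inj₁ (suc j)) → ≡.refl ; (inj₂ x) → ≡.refl }) w)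
               (once zero)))
      where
      singleton : ∀ (u : List Colour) → length u ≡ 1 → ∃[ c ] u ≡ c ∷ []
      singleton (c ∷ []) eq = c , ≡.refl

    -- On a word with a single letter at label 0, the first two factors of `leftCoefficient` are the
    -- Kronecker delta of that letter and `x`. The sign with `odd x` is that of the second word's
    -- letter at the label passing the rest of the first word; the `inversions` are internal to each
    -- word.
    leftCoefficient rightCoefficient : ∀ {t} → Colour → Boundary (suc t) → Carrier
    leftCoefficient x b@(n , w) =
      sg (negative x) * contraction (dual x ∷ here (relabel splitLabel w))
        * (sg (odd x ∧ parity oddₗ (proj₂ (removeLabel b))) * sg (inversions (relabel splitLabel w)))
    rightCoefficient x (n , w) = sg (inversions (relabel splitLabel w)) * contraction (x ∷ here (relabel splitLabel w))

    -- x is the colour of the first word's letter at label 0.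
    glued-suc : ∀ {t} (a b : Boundary (suc t)) → Once (suc t) a → Once (suc t) b →
      glued (suc t) a b ≈ ∑ (λ x → leftCoefficient x a * rightCoefficient x b * glued t (removeLabel a) (removeLabel b))
    glued-suc {t} a@(m , u) b@(n , w) once-a once-b
      with c , hu ← label-letter a once-a | d , hw ← label-letter b once-b = begin
      (contraction ⊛ contractLabels t (E (m ℕ.+ n))) (relabel splitLabel (relabel (Sum.map₂ (_↑ˡ n)) u ++ relabel (Sum.map₂ (m ↑ʳ_)) w))
        ≡⟨ ≡.cong (contraction ⊛ contractLabels t (E (m ℕ.+ n))) split-words ⟩
      (contraction ⊛ contractLabels t (E (m ℕ.+ n))) (u″ ++ w″)
        ≡⟨ ≡.cong₂ (λ i z → sg i * z) inversions-eq (≡.cong₂ (λ h z → contraction h * contractLabels t (E (m ℕ.+ n)) z) here-eq there-eq) ⟩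
      sg (inversions u′ xor ((p ∧ odd d) xor inversions w′)) * (form c d * G)
        ≈⟨ *-congʳ (trans (sg-xor (inversions u′) _) (*-congˡ (sg-xor (p ∧ odd d) (inversions w′)))) ⟩
      sg (inversions u′) * (sg (p ∧ odd d) * sg (inversions w′)) * (form c d * G)
        ≈⟨ solve 5 (λ i s j f g → i :* (s :* j) :* (f :* g) := s :* f :* (i :* j :* g)) refl
             (sg (inversions u′)) (sg (p ∧ odd d)) (sg (inversions w′)) (form c d) G ⟩
      sg (p ∧ odd d) * form c d * (sg (inversions u′) * sg (inversions w′) * G)
        ≈⟨ *-congʳ (contraction-parity p c d) ⟩
      s c
        ≈⟨ form-reproduces c s ⟨
      ∑ (λ x → sg (negative x) * (form (dual x) c * s x))
        ≈⟨ ∑-cong (λ x → solve 7 (λ ν δ s f i j g → ν :* (δ :* (s :* f :* (i :* j :* g))) := ν :* δ :* (s :* i) :* (j :* f) :* g) refl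
             (sg (negative x)) (form (dual x) c) (sg (odd x ∧ p)) (form x d) (sg (inversions u′)) (sg (inversions w′)) G) ⟩
      ∑ (λ x → sg (negative x) * form (dual x) c * (sg (odd x ∧ p) * sg (inversions u′)) * (sg (inversions w′) * form x d) * G)
        ≡⟨ ≡.cong₂ (λ h h′ → ∑ (λ x → sg (negative x) * contraction (dual x ∷ h) * (sg (odd x ∧ p) * sg (inversions u′))
                                        * (sg (inversions w′) * contraction (x ∷ h′)) * G)) hu hw ⟨
      ∑ (λ x → leftCoefficient x a * rightCoefficient x b * G) ∎
      where
      open import Algebra.Solver.Ring.NaturalCoefficients.Default commutativeSemiring using (solve; _:=_; _:*_)
      u′ = relabel splitLabel u
      w′ = relabel splitLabel w
      u″ = relabel (Maybe.map (Sum.map₂ (_↑ˡ n))) u′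
      w″ = relabel (Maybe.map (Sum.map₂ (m ↑ʳ_))) w′
      p = parity oddₗ (there u′)
      G = glued t (removeLabel a) (removeLabel b)
      s : Colour → Carrier
      s x = sg (odd x ∧ p) * form x d * (sg (inversions u′) * sg (inversions w′) * G)
      split-words : relabel splitLabel (relabel (Sum.map₂ (_↑ˡ n)) u ++ relabel (Sum.map₂ (m ↑ʳ_)) w) ≡ u″ ++ w″
      split-words = ≡.trans (List.map-++ _ (relabel (Sum.map₂ (_↑ˡ n)) u) _)
        (≡.cong₂ _++_ (relabel-splitLabel (_↑ˡ n) u) (relabel-splitLabel (m ↑ʳ_) w))
      here-eq : here (u″ ++ w″) ≡ c ∷ d ∷ []
      here-eq = ≡.trans (here-++ u″ w″) (≡.cong₂ _++_ (≡.trans (here-relabel _ u′) hu) (≡.trans (here-relabel _ w′) hw))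
      there-eq : there (u″ ++ w″) ≡ relabel (Sum.map₂ (_↑ˡ n)) (there u′) ++ relabel (Sum.map₂ (m ↑ʳ_)) (there w′)
      there-eq = ≡.trans (there-++ u″ w″) (≡.cong₂ _++_ (there-relabel _ u′) (there-relabel _ w′))
      inversions-eq : inversions (u″ ++ w″) ≡ inversions u′ xor ((p ∧ odd d) xor inversions w′)
      inversions-eq = ≡.trans (inversions-++ u″ w″) (≡.cong₂ _xor_ (inversions-relabel _ u′) (≡.cong₂ _xor_
        (≡.cong₂ _∧_ (≡.trans (≡.cong (parity oddₗ) (there-relabel _ u′)) (parity-relabel _ (there u′)))
          (≡.trans (≡.cong (parity odd) (≡.trans (here-relabel _ w′) hw)) (Bool.xor-identityʳ (odd d))))
        (inversions-relabel _ w′)))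

    -- By `glued-suc` a label contributes one summand per colour, each the matrix for one label less
    -- with rows and columns rescaled; so every label multiplies the dimension by k + 2ℓ.
    glued-factorization : ∀ t → Factorization (Once t) (Once t) ((k ℕ.+ 2 ℕ.* ℓ) ℕ.^ t) (glued t)
    glued-factorization zero = record
      { left    = λ (m , u) _ → E m (relabel unlabel u)
      ; right   = λ (n , w) _ → E n (relabel unlabel w)
      ; factors = λ {a} {b} _ _ → base a b
      }
      where
      -- The trailing zero is the end of a sum over `Fin 1`.
      base : ∀ a b → glued 0 a b ≈ E (proj₁ a) (relabel unlabel (proj₂ a)) * E (proj₁ b) (relabel unlabel (proj₂ b)) + 0#
      base (m , u) (n , w) = begin
        E (m ℕ.+ n) (relabel unlabel (relabel (Sum.map₂ (_↑ˡ n)) u ++ relabel (Sum.map₂ (m ↑ʳ_)) w))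
          ≡⟨ ≡.cong (E (m ℕ.+ n)) (≡.trans (List.map-++ _ (relabel (Sum.map₂ (_↑ˡ n)) u) _) (≡.cong₂ _++_ (unlabel-map (_↑ˡ n) u) (unlabel-map (m ↑ʳ_) w))) ⟩
        E (m ℕ.+ n) (relabel (_↑ˡ n) (relabel unlabel u) ++ relabel (m ↑ʳ_) (relabel unlabel w))
          ≈⟨ E-multiplicative m n (relabel unlabel u) (relabel unlabel w) ⟩
        E m (relabel unlabel u) * E n (relabel unlabel w)
          ≈⟨ +-identityʳ _ ⟨
        E m (relabel unlabel u) * E n (relabel unlabel w) + 0# ∎
        where
        unlabel-map : ∀ {V W : Set} (g : V → W) (w : Word (Fin 0 ⊎ V)) → relabel unlabel (relabel (Sum.map₂ g) w) ≡ relabel g (relabel unlabel w)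
        unlabel-map g w = ≡.trans (relabel-∘ {h = λ x → g (unlabel x)} (λ { (inj₂ x) → ≡.refl }) w) (≡.sym (relabel-∘ (λ _ → ≡.refl) w))
    glued-factorization (suc t) = ≡.subst (λ r → Factorization (Once (suc t)) (Once (suc t)) r (glued (suc t)))
      (solve 3 (λ k ℓ r → k :* r :+ (ℓ :* r :+ ℓ :* r) := (k :+ con 2 :* ℓ) :* r) ≡.refl k ℓ ((k ℕ.+ 2 ℕ.* ℓ) ℕ.^ t))
      (factor-cong (λ {a} {b} → glued-suc a b)
        (factor-+ (factor-sum (λ i → summand (inj₁ i)))
          (factor-+ (factor-sum (λ i → summand (inj₂ (inj₁ i)))) (factor-sum (λ i → summand (inj₂ (inj₂ i)))))))
      where
      open +-*-Solver
      summand : ∀ x → Factorization (Once (suc t)) (Once (suc t)) ((k ℕ.+ 2 ℕ.* ℓ) ℕ.^ t)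
        (λ a b → leftCoefficient x a * rightCoefficient x b * glued t (removeLabel a) (removeLabel b))
      summand x = factor-scale (leftCoefficient x) (rightCoefficient x) removeLabel removeLabel
        (λ {a} → once-removeLabel a) (λ {b} → once-removeLabel b) (glued-factorization t)

    module _ (E-super : ∀ n → Super (E n)) where

      -- The edges of `F₂` produce a word `w`, in front of which those of `F₁` then put their
      -- letters; with `w` held fixed, the two fragments can be treated one after the other.
      Z-⋆ : ∀ {t} (F₁ F₂ : Fragment t) →
        Z (Graph.edges (F₁ ⋆ F₂)) (E (Graph.order (F₁ ⋆ F₂))) []
          ≈ Z (edges F₂) (λ w → Z (edges F₁) (λ u → glued t (order F₁ , u) (order F₂ , w)) []) []
      Z-⋆ {t} F₁ F₂ = begin
        Z (suppressAll t (es₁ ++ es₂)) (E _) []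
          ≈⟨ Z-suppressAll t (es₁ ++ es₂) degrees (E _) (E-super _) ⟨
        Z (es₁ ++ es₂) L []
          ≡⟨ ≡.cong-app (Z-++ es₁ es₂ L) [] ⟩
        Z es₂ (Z es₁ L) []
          ≈⟨ Z-relabel i₂ (Z es₁ L) (edges F₂) [] ⟨
        Z (edges F₂) (λ w → Z es₁ L (relabel i₂ w)) []
          ≈⟨ cong (Z-linear (edges F₂)) (λ w → inner (relabel i₂ w)) [] ⟩
        Z (edges F₂) (λ w → Z (edges F₁) (λ u → L (relabel i₁ u ++ relabel i₂ w)) []) [] ∎
        where
        i₁ = Sum.map₂ {A = Fin t} (_↑ˡ order F₂)
        i₂ = Sum.map₂ {A = Fin t} (order F₁ ↑ʳ_)
        es₁ = map (mapEdge i₁) (edges F₁)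
        es₂ = map (mapEdge i₂) (edges F₂)
        L = contractLabels t (E (order F₁ ℕ.+ order F₂))
        inner : ∀ v → Z es₁ L v ≈ Z (edges F₁) (λ u → L (relabel i₁ u ++ v)) []
        inner v = sym (trans (Z-relabel i₁ (λ u → L (u ++ v)) (edges F₁) []) (Z-suffix L v es₁ []))
        degrees : ∀ i → weight (labelWeight i) (es₁ ++ es₂) ≡ 2
        degrees i = ≡.trans (weight-++ (labelWeight i) es₁ es₂) (≡.cong₂ ℕ._+_
          (≡.trans (weight-map i₁ (λ { (inj₁ _) → ≡.refl ; (inj₂ _) → ≡.refl }) (edges F₁)) (weight-labelled F₁ i))
          (≡.trans (weight-map i₂ (λ { (inj₁ _) → ≡.refl ; (inj₂ _) → ≡.refl }) (edges F₂)) (weight-labelled F₂ i)))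

      Z-⋆-factorization : ∀ t → ∃₂ λ (A B : Fragment t → Vector Carrier ((k ℕ.+ 2 ℕ.* ℓ) ℕ.^ t)) →
        ∀ F₁ F₂ → Z (Graph.edges (F₁ ⋆ F₂)) (E (Graph.order (F₁ ⋆ F₂))) [] ≈ sum (λ x → A F₁ x * B F₂ x)
      Z-⋆-factorization t = A , B , λ F₁ F₂ → trans (Z-⋆ F₁ F₂) (factored F₁ F₂)
        where
        f = glued-factorization t
        A B : Fragment t → Vector Carrier ((k ℕ.+ 2 ℕ.* ℓ) ℕ.^ t)
        A F x = Z (edges F) (λ u → left f (order F , u) x) []
        B F x = Z (edges F) (λ w → right f (order F , w) x) []
        once : ∀ (F : Fragment t) w → (∀ i → letterWeight (labelWeight i) w ≡ weight (labelWeight i) (edges F) ℕ.+ 0) →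
               Once t (order F , w)
        once F w weights i = ≡.trans (weights i) (≡.trans (ℕₚ.+-identityʳ _) (weight-labelled F i))
        factored : ∀ F₁ F₂ →
          Z (edges F₂) (λ w → Z (edges F₁) (λ u → glued t (order F₁ , u) (order F₂ , w)) []) [] ≈ sum (λ x → A F₁ x * B F₂ x)
        factored F₁ F₂ = begin
          Z (edges F₂) (λ w → Z (edges F₁) (λ u → glued t (order F₁ , u) (order F₂ , w)) []) []
            ≈⟨ Z-cong-weight labelWeight (edges F₂) [] (λ w w-weights → Z-cong-weight labelWeight (edges F₁) [] (λ u u-weights →
                 factors f {order F₁ , u} {order F₂ , w} (once F₁ u u-weights) (once F₂ w w-weights))) ⟩
          Z (edges F₂) (λ w → Z (edges F₁) (λ u → sum (λ x → l u x * r w x)) []) []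
            ≈⟨ cong (Z-linear (edges F₂)) (λ w → trans
                 (cong (Z-linear (edges F₁)) (λ u → sum-cong-≋ (λ x → *-comm (l u x) (r w x))) [])
                 (trans (sum-homo (Z-linear (edges F₁)) (λ x u → r w x * l u x) [])
                        (sum-cong-≋ (λ x → trans (*-homo (Z-linear (edges F₁)) (r w x) (λ u → l u x) []) (*-comm (r w x) (A F₁ x)))))) [] ⟩
          Z (edges F₂) (λ w → sum (λ x → A F₁ x * r w x)) []
            ≈⟨ sum-homo (Z-linear (edges F₂)) (λ x w → A F₁ x * r w x) [] ⟩
          sum (λ x → Z (edges F₂) (λ w → A F₁ x * r w x) [])
            ≈⟨ sum-cong-≋ (λ x → *-homo (Z-linear (edges F₂)) (A F₁ x) (λ w → r w x) []) ⟩
          sum (λ x → A F₁ x * B F₂ x) ∎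
          where
          l = λ u x → left f (order F₁ , u) x
          r = λ w x → right f (order F₂ , w) x

-- Calculation in quotients of the tensor algebra.

module TensorAlgebraQuotient (K : CommutativeRing 0ℓ 0ℓ) {n : ℕ} (R : Rel (Over.Expr K n) 0ℓ) where

  open CommutativeRing K hiding (zero)
  open import Algebra.Properties.Ring ring using (-1*x≈-x)
  open Over K

  quotientMonoid : Monoid 0ℓ 0ℓ
  quotientMonoid = record
    { Carrier  = Expr n
    ; _≈_      = Quotient R
    ; _∙_      = _⊠_
    ; ε        = 1ᵉ
    ; isMonoid = record
      { isSemigroup = record
        { isMagma = record
          { isEquivalence = record { refl = ≈-refl ; sym = ≈-sym ; trans = ≈-trans }
          ; ∙-cong        = ⊠-cong
          }
        ; assoc = ⊠-assoc
        }
      ; identity = ⊠-identityˡ , ⊠-identityʳ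
      }
    }

  open SetoidReasoning (Monoid.setoid quotientMonoid)

  ⊞-identityʳ : ∀ x → Quotient R (x ⊞ 0ᵉ) x
  ⊞-identityʳ x = ≈-trans (⊞-comm x 0ᵉ) (⊞-identityˡ x)

  ⊞-inverseʳ : ∀ x → Quotient R (x ⊞ (- 1#) · x) 0ᵉ
  ⊞-inverseʳ x = begin
    x ⊞ (- 1#) · x         ≈⟨ ⊞-cong (·-identity x) ≈-refl ⟨
    1# · x ⊞ (- 1#) · x    ≈⟨ ·-distribʳ 1# (- 1#) x ⟨
    (1# + - 1#) · x        ≈⟨ ·-cong (-‿inverseʳ 1#) ≈-refl ⟩
    0# · x                 ≈⟨ ·-zero x ⟩
    0ᵉ                     ∎

  x⊞y≈0⇒x≈-y : ∀ x y → Quotient R (x ⊞ y) 0ᵉ → Quotient R x ((- 1#) · y)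
  x⊞y≈0⇒x≈-y x y x⊞y≈0 = begin
    x                          ≈⟨ ⊞-identityʳ x ⟨
    x ⊞ 0ᵉ                     ≈⟨ ⊞-cong ≈-refl (⊞-inverseʳ y) ⟨
    x ⊞ (y ⊞ (- 1#) · y)       ≈⟨ ⊞-assoc x y _ ⟨
    x ⊞ y ⊞ (- 1#) · y         ≈⟨ ⊞-cong x⊞y≈0 ≈-refl ⟩
    0ᵉ ⊞ (- 1#) · y            ≈⟨ ⊞-identityˡ _ ⟩
    (- 1#) · y                 ∎

  -- Polarization of the relation ι v ⊠ ι v ≈ 0.
  anticommute : (∀ v → Quotient R (ι v ⊠ ι v) 0ᵉ) → ∀ u v → Quotient R (ι u ⊠ ι v) ((- 1#) · (ι v ⊠ ι u))
  anticommute v²≈0 u v = x⊞y≈0⇒x≈-y _ _ (begin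
    ι u ⊠ ι v ⊞ ι v ⊠ ι u
      ≈⟨ ⊞-cong (≈-trans (⊞-cong (v²≈0 u) ≈-refl) (⊞-identityˡ _)) (≈-trans (⊞-cong ≈-refl (v²≈0 v)) (⊞-identityʳ _)) ⟨
    (ι u ⊠ ι u ⊞ ι u ⊠ ι v) ⊞ (ι v ⊠ ι u ⊞ ι v ⊠ ι v)
      ≈⟨ ⊞-cong (⊠-distribˡ (ι u) (ι u) (ι v)) (⊠-distribˡ (ι v) (ι u) (ι v)) ⟨
    ι u ⊠ (ι u ⊞ ι v) ⊞ ι v ⊠ (ι u ⊞ ι v)
      ≈⟨ ⊠-distribʳ (ι u ⊞ ι v) (ι u) (ι v) ⟨
    (ι u ⊞ ι v) ⊠ (ι u ⊞ ι v)
      ≈⟨ ⊠-cong (ι-⊞ u v) (ι-⊞ u v) ⟨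
    ι (λ i → u i + v i) ⊠ ι (λ i → u i + v i)
      ≈⟨ v²≈0 _ ⟩
    0ᵉ ∎)

  ι-neg : ∀ v → Quotient R (ι (λ i → - v i)) ((- 1#) · ι v)
  ι-neg v = ≈-trans (ι-cong (λ i → sym (-1*x≈-x (v i)))) (ι-· (- 1#) v)

-- 𝐠 j is kept apart from the letter ± 𝐟 j′ that denotes the same vector, so
-- that words over a vertex are literally the products in exteriorPart.
data Letter (k ℓ : ℕ) : Set where
  𝐞   : Fin k → Letter k ℓ
  𝐟 𝐠 : Fin (ℓ ℕ.+ ℓ) → Letter k ℓ

oddᴸ : ∀ {k ℓ} → Letter k ℓ → Bool
oddᴸ (𝐞 _) = false
oddᴸ (𝐟 _) = true
oddᴸ (𝐠 _) = true

-- The colouring model as a functional on the letters at one vertex.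

module VertexFunctional (K : CommutativeRing 0ℓ 0ℓ) (k ℓ : ℕ) (h : Over.ColouringModel K k ℓ) where

  open CommutativeRing K hiding (zero)
  open Signs K
  open SuperWords K
  open Supersymmetric
  private module O = Over K
  open O using (Expr; ι; 1ᵉ; _⊠_; Quotient; Commutators; Squares; basis)
    renaming (_·_ to _·ᵉ_)
  open O.Dual h
  open IsLeftModuleHomomorphism isLinear using (⟦⟧-cong; *ₗ-homo)
  private
    module S = TensorAlgebraQuotient K (Commutators k)
    module ⋀ = TensorAlgebraQuotient K (Squares (ℓ ℕ.+ ℓ))

  symmetric : List (Letter k ℓ) → Expr k
  symmetric []        = 1ᵉ
  symmetric (𝐞 i ∷ w) = ι (basis i) ⊠ symmetric w
  symmetric (𝐟 _ ∷ w) = symmetric w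
  symmetric (𝐠 _ ∷ w) = symmetric w

  exterior : List (Letter k ℓ) → Expr (ℓ ℕ.+ ℓ)
  exterior []        = 1ᵉ
  exterior (𝐞 _ ∷ w) = exterior w
  exterior (𝐟 j ∷ w) = O.f {ℓ} j ⊠ exterior w
  exterior (𝐠 j ∷ w) = O.g {ℓ} j ⊠ exterior w

  -- The linear form `h` may be nonzero on odd elements, whereas the partition function evaluates it
  -- only on products of pairs of odd letters. Setting it to zero on odd words makes the edge sets
  -- that are not Eulerian contribute nothing.
  vertex : List (Letter k ℓ) → Carrier
  vertex w = if parity oddᴸ w then 0# else ⟦ symmetric w O.⊗ exterior w ⟧

  symmetric-++ : ∀ u w → Quotient (Commutators k) (symmetric (u ++ w)) (symmetric u ⊠ symmetric w)
  symmetric-++ []        w = O.≈-sym (O.⊠-identityˡ _)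
  symmetric-++ (𝐞 i ∷ u) w = O.≈-trans (O.⊠-cong O.≈-refl (symmetric-++ u w)) (O.≈-sym (O.⊠-assoc _ _ _))
  symmetric-++ (𝐟 _ ∷ u) w = symmetric-++ u w
  symmetric-++ (𝐠 _ ∷ u) w = symmetric-++ u w

  exterior-++ : ∀ u w → Quotient (Squares (ℓ ℕ.+ ℓ)) (exterior (u ++ w)) (exterior u ⊠ exterior w)
  exterior-++ []        w = O.≈-sym (O.⊠-identityˡ _)
  exterior-++ (𝐞 _ ∷ u) w = exterior-++ u w
  exterior-++ (𝐟 j ∷ u) w = O.≈-trans (O.⊠-cong O.≈-refl (exterior-++ u w)) (O.≈-sym (O.⊠-assoc _ _ _))
  exterior-++ (𝐠 j ∷ u) w = O.≈-trans (O.⊠-cong O.≈-refl (exterior-++ u w)) (O.≈-sym (O.⊠-assoc _ _ _))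

  parity-replace : ∀ u {w w′ : List (Letter k ℓ)} → parity oddᴸ w ≡ parity oddᴸ w′ → parity oddᴸ (u ++ w) ≡ parity oddᴸ (u ++ w′)
  parity-replace u {w} {w′} eq = ≡.trans (parity-++ oddᴸ u w) (≡.trans (≡.cong (parity oddᴸ u xor_) eq) (≡.sym (parity-++ oddᴸ u w′)))

  vertex-replace : ∀ c u w w′ → parity oddᴸ w ≡ parity oddᴸ w′ →
    Quotient (Commutators k) (symmetric w) (symmetric w′) →
    Quotient (Squares (ℓ ℕ.+ ℓ)) (exterior w) (c ·ᵉ exterior w′) → vertex (u ++ w) ≈ c * vertex (u ++ w′)
  vertex-replace c u w w′ parity-eq sym-eq ext-eq = select (parity-replace u {w} {w′} parity-eq)
    (trans (⟦⟧-cong (O.≈-trans (O.⊗-cong symmetric-eq exterior-eq) (O.⊗-·ʳ c _ _))) (*ₗ-homo c _))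
    where
    select : ∀ {b b′ x y} → b ≡ b′ → x ≈ c * y → (if b then 0# else x) ≈ c * (if b′ then 0# else y)
    select {true}  ≡.refl _    = sym (zeroʳ c)
    select {false} ≡.refl x≈cy = x≈cy
    symmetric-eq : Quotient (Commutators k) (symmetric (u ++ w)) (symmetric (u ++ w′))
    symmetric-eq = O.≈-trans (symmetric-++ u w) (O.≈-trans (O.⊠-cong O.≈-refl sym-eq) (O.≈-sym (symmetric-++ u w′)))
    exterior-eq : Quotient (Squares (ℓ ℕ.+ ℓ)) (exterior (u ++ w)) (c ·ᵉ exterior (u ++ w′))
    exterior-eq = O.≈-trans (exterior-++ u w) (O.≈-trans (O.⊠-cong O.≈-refl ext-eq)
      (O.≈-trans (O.·-⊠ʳ c _ _) (O.·-cong refl (O.≈-sym (exterior-++ u w′)))))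

  private
    exterior-letter : ∀ a → oddᴸ a ≡ true → ∃[ v ] ∀ w → exterior (a ∷ w) ≡ ι v ⊠ exterior w
    exterior-letter (𝐟 j) _ = basis j , λ w → ≡.refl
    exterior-letter (𝐠 j) _ with splitAt ℓ j
    ... | inj₁ i = (λ x → - basis (ℓ ↑ʳ i) x) , λ w → ≡.refl
    ... | inj₂ i = basis (i ↑ˡ ℓ) , λ w → ≡.refl

    symmetric-odd : ∀ a → oddᴸ a ≡ true → ∀ w → symmetric (a ∷ w) ≡ symmetric w
    symmetric-odd (𝐟 _) _ w = ≡.refl
    symmetric-odd (𝐠 _) _ w = ≡.refl

    symmetric-swap : ∀ a b w → Quotient (Commutators k) (symmetric (a ∷ b ∷ w)) (symmetric (b ∷ a ∷ w))
    symmetric-swap (𝐞 i) (𝐞 j) w = O.≈-trans (O.≈-sym (O.⊠-assoc _ _ _))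
      (O.≈-trans (O.⊠-cong (O.relation (O.commute (basis i) (basis j))) O.≈-refl) (O.⊠-assoc _ _ _))
    symmetric-swap (𝐞 i) (𝐟 j) w = O.≈-refl
    symmetric-swap (𝐞 i) (𝐠 j) w = O.≈-refl
    symmetric-swap (𝐟 i) b     w rewrite symmetric-odd (𝐟 i) ≡.refl (b ∷ w) = symmetric-drop b
      where
      symmetric-drop : ∀ b → Quotient (Commutators k) (symmetric (b ∷ w)) (symmetric (b ∷ 𝐟 i ∷ w))
      symmetric-drop (𝐞 _) = O.≈-refl
      symmetric-drop (𝐟 _) = O.≈-refl
      symmetric-drop (𝐠 _) = O.≈-refl
    symmetric-swap (𝐠 i) (𝐞 _) w = O.≈-refl
    symmetric-swap (𝐠 i) (𝐟 _) w = O.≈-refl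
    symmetric-swap (𝐠 i) (𝐠 _) w = O.≈-refl

    exterior-swap-odd : ∀ a b → oddᴸ a ≡ true → oddᴸ b ≡ true → ∀ w →
      Quotient (Squares (ℓ ℕ.+ ℓ)) (exterior (a ∷ b ∷ w)) ((- 1#) ·ᵉ exterior (b ∷ a ∷ w))
    exterior-swap-odd a b oa ob w with u , a-eq ← exterior-letter a oa | v , b-eq ← exterior-letter b ob
      rewrite a-eq (b ∷ w) | b-eq w | b-eq (a ∷ w) | a-eq w =
      O.≈-trans (O.≈-sym (O.⊠-assoc _ _ _))
        (O.≈-trans (O.⊠-cong (⋀.anticommute (λ v → O.relation (O.square v)) u v) O.≈-refl)
          (O.≈-trans (O.·-⊠ˡ _ _ _) (O.·-cong refl (O.⊠-assoc _ _ _))))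

    exterior-swap : ∀ a b w → Quotient (Squares (ℓ ℕ.+ ℓ)) (exterior (a ∷ b ∷ w)) (sg (oddᴸ a ∧ oddᴸ b) ·ᵉ exterior (b ∷ a ∷ w))
    exterior-swap (𝐞 i) (𝐞 j) w = O.≈-sym (O.·-identity _)
    exterior-swap (𝐞 i) (𝐟 j) w = O.≈-sym (O.·-identity _)
    exterior-swap (𝐞 i) (𝐠 j) w = O.≈-sym (O.·-identity _)
    exterior-swap (𝐟 i) (𝐞 j) w = O.≈-sym (O.·-identity _)
    exterior-swap (𝐠 i) (𝐞 j) w = O.≈-sym (O.·-identity _)
    exterior-swap a@(𝐟 i) b@(𝐟 j) w = exterior-swap-odd a b ≡.refl ≡.refl w
    exterior-swap a@(𝐟 i) b@(𝐠 j) w = exterior-swap-odd a b ≡.refl ≡.refl w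
    exterior-swap a@(𝐠 i) b@(𝐟 j) w = exterior-swap-odd a b ≡.refl ≡.refl w
    exterior-swap a@(𝐠 i) b@(𝐠 j) w = exterior-swap-odd a b ≡.refl ≡.refl w

  vertex-super : Supersymmetric oddᴸ vertex
  vertex-super .swap u a b w = vertex-replace (sg (oddᴸ a ∧ oddᴸ b)) u (a ∷ b ∷ w) (b ∷ a ∷ w)
    (parity-swap oddᴸ [] a b w) (symmetric-swap a b w) (exterior-swap a b w)

  vertex-g-left : ∀ i u w → vertex (u ++ 𝐠 (i ↑ˡ ℓ) ∷ w) ≈ sg true * vertex (u ++ 𝐟 (ℓ ↑ʳ i) ∷ w)
  vertex-g-left i u w = vertex-replace (sg true) u (𝐠 (i ↑ˡ ℓ) ∷ w) (𝐟 (ℓ ↑ʳ i) ∷ w) ≡.refl O.≈-refl g≈-f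
    where
    g≈-f : Quotient (Squares (ℓ ℕ.+ ℓ)) (exterior (𝐠 (i ↑ˡ ℓ) ∷ w)) (sg true ·ᵉ exterior (𝐟 (ℓ ↑ʳ i) ∷ w))
    g≈-f rewrite Fin.splitAt-↑ˡ ℓ i ℓ = O.≈-trans (O.⊠-cong (⋀.ι-neg (basis (ℓ ↑ʳ i))) O.≈-refl) (O.·-⊠ˡ _ _ _)

  vertex-g-right : ∀ i u w → vertex (u ++ 𝐠 (ℓ ↑ʳ i) ∷ w) ≈ sg false * vertex (u ++ 𝐟 (i ↑ˡ ℓ) ∷ w)
  vertex-g-right i u w = vertex-replace (sg false) u (𝐠 (ℓ ↑ʳ i) ∷ w) (𝐟 (i ↑ˡ ℓ) ∷ w) ≡.refl O.≈-refl g≈f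
    where
    g≈f : Quotient (Squares (ℓ ℕ.+ ℓ)) (exterior (𝐠 (ℓ ↑ʳ i) ∷ w)) (sg false ·ᵉ exterior (𝐟 (i ↑ˡ ℓ) ∷ w))
    g≈f rewrite Fin.splitAt-↑ʳ ℓ ℓ i = O.≈-sym (O.·-identity _)

-- The sign of a permutation in terms of its cycles.

xors : ∀ {m} → (Fin m → Bool) → Bool
xors {zero}  s = false
xors {suc m} s = s zero xor xors (s ∘ suc)

xors-cong : ∀ {m} {s t : Fin m → Bool} → (∀ x → s x ≡ t x) → xors s ≡ xors t
xors-cong {zero}  eq = ≡.refl
xors-cong {suc m} eq = ≡.cong₂ _xor_ (eq zero) (xors-cong (eq ∘ suc))

xors-false : ∀ {m} {s : Fin m → Bool} → (∀ x → s x ≡ false) → xors s ≡ false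
xors-false {zero}  eq = ≡.refl
xors-false {suc m} eq = ≡.cong₂ _xor_ (eq zero) (xors-false (eq ∘ suc))

xors-flip : ∀ {m} {s t : Fin m → Bool} a → s a ≡ not (t a) → (∀ x → x ≢ a → s x ≡ t x) → xors s ≡ not (xors t)
xors-flip {suc m} {s} {t} zero    at off = ≡.trans
  (≡.cong₂ _xor_ at (xors-cong (λ x → off (suc x) λ ()))) (≡.sym (Bool.not-distribˡ-xor (t zero) (xors (t ∘ suc))))
xors-flip {suc m} {s} {t} (suc a) at off = ≡.trans
  (≡.cong₂ _xor_ (off zero λ ()) (xors-flip a at (λ x x≢a → off (suc x) (x≢a ∘ Fin.suc-injective))))
  (≡.sym (Bool.not-distribʳ-xor (t zero) (xors (t ∘ suc))))

module _ {m} (κ : Fin m → Fin m) where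

  Least : Fin m → Set
  Least a = ∀ (i : Fin m) → a Fin.≤ fold a κ (toℕ i)

  least? : ∀ a → Dec (Least a)
  least? a = Fin.all? (λ i → a Fin.≤? fold a κ (toℕ i))

  -- sg (signature κ) is (-1)^(m - number of cycles), the sign of κ if κ is a permutation.
  signature : Bool
  signature = xors (λ a → not (does (least? a)))

  fold-fixed : ∀ {x} → κ x ≡ x → ∀ n → fold x κ n ≡ x
  fold-fixed fixed zero    = ≡.refl
  fold-fixed fixed (suc n) = ≡.trans (≡.cong κ (fold-fixed fixed n)) fixed

  module _ (κ-injective : ∀ {x y} → κ x ≡ κ y → x ≡ y) where

    fold-injective : ∀ {x y} n → fold x κ n ≡ fold y κ n → x ≡ y
    fold-injective zero    eq = eq
    fold-injective (suc n) eq = fold-injective n (κ-injective eq)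

    -- Among m + 1 successive iterates two agree; by injectivity their common initial steps cancel,
    -- leaving a return to `x`.
    period : ∀ x → ∃[ p ] p ℕ.< m × fold x κ (suc p) ≡ x
    period x with Fin.pigeonhole (ℕₚ.n<1+n m) (λ (i : Fin (suc m)) → fold x κ (toℕ i))
    ... | i , j , i<j , eq with ℕₚ.m≤n⇒∃[o]m+o≡n i<j
    ... | p , i+p≡j = p , p<m , fold-injective (toℕ i)
      (≡.trans (≡.sym (fold-+ x κ (toℕ i) {suc p}))
        (≡.trans (≡.cong (fold x κ) (≡.trans (ℕₚ.+-suc (toℕ i) p) i+p≡j)) (≡.sym eq)))
      where
      p<m : p ℕ.< m
      p<m = ℕₚ.≤-trans (ℕ.s≤s (ℕₚ.m≤n+m p (toℕ i))) (ℕₚ.≤-trans (ℕₚ.≤-reflexive i+p≡j) (ℕₚ.≤-pred (Fin.toℕ<n j)))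

    fold-period : ∀ {x} p → fold x κ p ≡ x → ∀ q → fold x κ (q ℕ.* p) ≡ x
    fold-period p eq zero    = ≡.refl
    fold-period {x} p eq (suc q) = ≡.trans (fold-+ x κ p {q ℕ.* p}) (≡.trans (≡.cong (λ y → fold y κ p) (fold-period p eq q)) eq)

    -- `Least` inspects `m` iterates. The period is at most `m`, so these already run through the
    -- whole cycle.
    least⇒least∞ : ∀ {x} → Least x → ∀ n → x Fin.≤ fold x κ n
    least⇒least∞ {x} least n with period x
    ... | p , p<m , eq = ≡.subst (x Fin.≤_) (≡.trans (≡.cong (fold x κ) (Fin.toℕ-fromℕ< r<m)) (≡.sym reduce)) (least (fromℕ< r<m))
      where
      r = n % suc p
      r<m : r ℕ.< m
      r<m = ℕₚ.≤-trans (m%n<n n (suc p)) p<m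
      reduce : fold x κ n ≡ fold x κ r
      reduce = ≡.trans (≡.cong (fold x κ) (m≡m%n+[m/n]*n n (suc p)))
        (≡.trans (fold-+ x κ r {n / suc p ℕ.* suc p}) (≡.cong (λ y → fold y κ r) (fold-period (suc p) eq (n / suc p))))

-- Deleting the largest non-fixed point a from its cycle.
module Deletion {m} (κ : Fin m → Fin m) (κ-injective : ∀ {x y} → κ x ≡ κ y → x ≡ y) (a : Fin m)
                (fixed-above : ∀ x → a Fin.< x → κ x ≡ x) (κa≢a : κ a ≢ a) where

  -- The transposition after `κ` fixes `a` and sends the predecessor of `a` straight to `κ a`.
  delete : Fin m → Fin m
  delete = transpose (κ a) a ∘ κ

  delete-injective : ∀ {x y} → delete x ≡ delete y → x ≡ y
  delete-injective {x} {y} eq = κ-injective (≡.trans (≡.sym (transpose-inverse a (κ a)))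
    (≡.trans (≡.cong (transpose a (κ a)) eq) (transpose-inverse a (κ a))))

  delete-a : delete a ≡ a
  delete-a with κ a Fin.≟ κ a
  ... | yes _   = ≡.refl
  ... | no  neq = contradiction ≡.refl neq

  delete-before : ∀ {y} → κ y ≡ a → delete y ≡ κ a
  delete-before {y} eq with κ y Fin.≟ κ a
  ... | yes κy≡κa = contradiction (≡.trans (≡.sym κy≡κa) eq) κa≢a
  ... | no  _ with κ y Fin.≟ a
  ...   | yes _   = ≡.refl
  ...   | no  neq = contradiction eq neq

  delete-other : ∀ {y} → y ≢ a → κ y ≢ a → delete y ≡ κ y
  delete-other {y} y≢a κy≢a with κ y Fin.≟ κ a
  ... | yes κy≡κa = contradiction (κ-injective κy≡κa) y≢a
  ... | no  _ with κ y Fin.≟ a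
  ...   | yes κy≡a = contradiction κy≡a κy≢a
  ...   | no  _    = ≡.refl

  fixed-delete : ∀ {x} → κ x ≡ x → delete x ≡ x
  fixed-delete {x} eq = ≡.trans (delete-other x≢a (λ κx≡a → x≢a (≡.trans (≡.sym eq) κx≡a))) eq
    where
    x≢a : x ≢ a
    x≢a ≡.refl = κa≢a eq

  κa<a : κ a Fin.< a
  κa<a with ℕₚ.<-cmp (toℕ (κ a)) (toℕ a)
  ... | tri< lt _ _ = lt

  ... | tri≈ _ eq _ = contradiction (Fin.toℕ-injective eq) κa≢a
  ... | tri> _ _ gt = contradiction (κ-injective (fixed-above (κ a) gt)) κa≢a

  iterate-delete : ∀ {x} → x ≢ a → ∀ n → fold x delete n ≢ a × ∃[ i ] fold x delete n ≡ fold x κ i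
  iterate-delete x≢a zero = x≢a , 0 , ≡.refl
  iterate-delete {x} x≢a (suc n) with iterate-delete x≢a n
  ... | y≢a , i , eq = (λ y′≡a → y≢a (delete-injective (≡.trans y′≡a (≡.sym delete-a)))) , next (κ (fold x delete n) Fin.≟ a)
    where
    next : Dec (κ (fold x delete n) ≡ a) → ∃[ i ] delete (fold x delete n) ≡ fold x κ i
    next (yes κy≡a) = suc (suc i) , ≡.trans (delete-before κy≡a) (≡.cong κ (≡.trans (≡.sym κy≡a) (≡.cong κ eq)))
    next (no  κy≢a) = suc i , ≡.trans (delete-other y≢a κy≢a) (≡.cong κ eq)

  iterate-κ : ∀ {x} → x ≢ a → ∀ n → (∃[ j ] fold x κ n ≡ fold x delete j) ⊎ (fold x κ n ≡ a × ∃[ j ] κ a ≡ fold x delete j)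
  iterate-κ x≢a zero = inj₁ (0 , ≡.refl)
  iterate-κ {x} x≢a (suc n) with iterate-κ x≢a n
  ... | inj₂ (y≡a , j , eq) = inj₁ (j , ≡.trans (≡.cong κ y≡a) eq)
  ... | inj₁ (j , eq) with κ (fold x κ n) Fin.≟ a
  ...   | yes κy≡a = inj₂ (κy≡a , suc j , ≡.trans (≡.sym (delete-before κy≡a)) (≡.cong delete eq))
  ...   | no  κy≢a = inj₁ (suc j , ≡.trans (≡.sym (delete-other y≢a κy≢a)) (≡.cong delete eq))
    where
    y≢a : fold x κ n ≢ a
    y≢a y≡a = proj₁ (iterate-delete x≢a j) (≡.trans (≡.sym eq) y≡a)

  -- The orbits of `x` under the two maps differ at most by `a`. A point below `a` stays least when
  -- `a` joins its orbit, and a point above `a` is fixed.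
  least-delete : ∀ x → x ≢ a → does (least? κ x) ≡ does (least? delete x)
  least-delete x x≢a = does-⇔ (mk⇔ to from) (least? κ x) (least? delete x)
    where
    to : Least κ x → Least delete x
    to least i with iterate-delete x≢a (toℕ i)
    ... | _ , j , eq = ≡.subst (x Fin.≤_) (≡.sym eq) (least⇒least∞ κ κ-injective least j)
    from : Least delete x → Least κ x
    from least i with toℕ x ℕₚ.≤? toℕ a
    ... | no  x≰a = ≡.subst (x Fin.≤_) (≡.sym (fold-fixed κ (fixed-above x (ℕₚ.≰⇒> x≰a)) (toℕ i))) ℕₚ.≤-refl
    ... | yes x≤a with iterate-κ x≢a (toℕ i)
    ...   | inj₁ (j , eq)  = ≡.subst (x Fin.≤_) (≡.sym eq) (least⇒least∞ delete delete-injective least j)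
    ...   | inj₂ (y≡a , _) = ≡.subst (x Fin.≤_) (≡.sym y≡a) x≤a

  -- Before, `a` is not least in its cycle, since `κ a` is smaller; afterwards it is a cycle of its
  -- own. All other points keep their status, so the number of cycles grows by one.
  signature-delete : signature κ ≡ not (signature delete)
  signature-delete = xors-flip a
    (≡.cong not (≡.trans (dec-false (least? κ a) a-not-least) (≡.sym (≡.cong not (dec-true (least? delete a) a-least)))))
    (λ x x≢a → ≡.cong not (least-delete x x≢a))
    where
    a-not-least : ¬ Least κ a
    a-not-least least = ℕₚ.<⇒≱ κa<a (least⇒least∞ κ κ-injective least 1)
    a-least : Least delete a
    a-least i = ≡.subst (a Fin.≤_) (≡.sym (fold-fixed delete delete-a (toℕ i))) ℕₚ.≤-refl

-- Functions of families that alternate under permutations.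

module AlternatingFunctions (K : CommutativeRing 0ℓ 0ℓ) where

  open CommutativeRing K hiding (zero)
  open Signs K

  module _ {m} {X : Set} (Odd : X → Set) (H : (Fin m → X) → Carrier)
           (H-cong : ∀ {B C} → (∀ x → B x ≡ C x) → H B ≈ H C)
           (H-transpose : ∀ B {p q} → p ≢ q → Odd (B p) → Odd (B q) → H B ≈ sg true * H (B ∘ transpose p q)) where

    private
      -- Induction on a bound from which on `κ` is the identity. If the top point below the bound is
      -- moved, it is the largest moved point, and one transposition, hence one sign, deletes it
      -- from its cycle. Oddness is asked of moved points only, since the block over a fixed point
      -- may be empty.
      alternating-below : ∀ b (κ : Fin m → Fin m) → (∀ {x y} → κ x ≡ κ y → x ≡ y) → (∀ x → b ℕ.≤ toℕ x → κ x ≡ x) →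
                          ∀ B → (∀ x → κ x ≢ x → Odd (B x)) → H B ≈ sg (signature κ) * H (B ∘ κ)
      alternating-below zero κ κ-injective fixed B odd = sym (trans
        (*-cong (reflexive (≡.cong sg (xors-false λ a → ≡.cong not (dec-true (least? κ a) (λ i →
                  ≡.subst (a Fin.≤_) (≡.sym (fold-fixed κ (fixed a ℕ.z≤n) (toℕ i))) ℕₚ.≤-refl)))))
                (H-cong (λ x → ≡.cong B (fixed x ℕ.z≤n))))
        (*-identityˡ (H B)))
      alternating-below (suc b) κ κ-injective fixed B odd with b ℕ.<? m
      ... | no  b≮m = alternating-below b κ κ-injective
            (λ x b≤x → contradiction (ℕₚ.≤-trans (ℕ.s≤s b≤x) (Fin.toℕ<n x)) b≮m) B odd
      ... | yes b<m with κ (fromℕ< b<m) Fin.≟ fromℕ< b<m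
      ...   | yes κa≡a = alternating-below b κ κ-injective fixed′ B odd
        where
        fixed′ : ∀ x → b ℕ.≤ toℕ x → κ x ≡ x
        fixed′ x b≤x with ℕₚ.m≤n⇒m<n∨m≡n b≤x
        ... | inj₁ b<x = fixed x b<x
        ... | inj₂ b≡x with Fin.toℕ-injective {i = fromℕ< b<m} (≡.trans (Fin.toℕ-fromℕ< b<m) b≡x)
        ...   | ≡.refl = κa≡a
      ...   | no  κa≢a = trans (H-transpose B (≡.≢-sym κa≢a) (odd a κa≢a) (odd (κ a) (κa≢a ∘ κ-injective)))
              (trans (*-congˡ (alternating-below b delete delete-injective fixed′ B′ odd′))
              (trans (sym (*-assoc _ _ _))
                (*-cong (trans (sym (sg-xor true (signature delete))) (reflexive (≡.cong sg (≡.sym signature-delete))))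
                        -- The transposition in `B′` undoes the one in `delete`, so that
                        -- `B′ ∘ delete` is `B ∘ κ`.
                        (H-cong (λ x → ≡.cong B (transpose-inverse a (κ a)))))))
        where
        a = fromℕ< b<m
        open Deletion κ κ-injective a (λ x a<x → fixed x (≡.subst (ℕ._< toℕ x) (Fin.toℕ-fromℕ< b<m) a<x)) κa≢a
        B′ = B ∘ transpose a (κ a)
        fixed′ : ∀ x → b ℕ.≤ toℕ x → delete x ≡ x
        fixed′ x b≤x with ℕₚ.m≤n⇒m<n∨m≡n b≤x
        ... | inj₁ b<x = fixed-delete (fixed x b<x)
        ... | inj₂ b≡x with Fin.toℕ-injective {i = fromℕ< b<m} (≡.trans (Fin.toℕ-fromℕ< b<m) b≡x)
        ...   | ≡.refl = delete-a
        odd′ : ∀ x → delete x ≢ x → Odd (B′ x)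
        odd′ x moved with x Fin.≟ a
        ... | yes _ = odd (κ a) (κa≢a ∘ κ-injective)
        ... | no  _ with x Fin.≟ κ a
        ...   | yes _ = odd a κa≢a
        ...   | no  _ = odd x (moved ∘ fixed-delete)

    alternating : ∀ (κ : Fin m → Fin m) → (∀ {x y} → κ x ≡ κ y → x ≡ y) →
                  ∀ B → (∀ x → κ x ≢ x → Odd (B x)) → H B ≈ sg (signature κ) * H (B ∘ κ)
    alternating κ κ-injective = alternating-below m κ κ-injective (λ x m≤x → contradiction (Fin.toℕ<n x) (ℕₚ.≤⇒≯ m≤x))

-- Edge subsets and sums over their colourings.

side : ∀ {m} (F : Subset m) a → a ∈ F ⊎ a ∈ ∁ F
side (_       ∷ F) (suc a) = Sum.map thereᵛ thereᵛ (side F a)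
side (inside  ∷ F) zero    = inj₁ hereᵛ
side (outside ∷ F) zero    = inj₂ hereᵛ

cardinalityParity : ∀ {m} → Subset m → Bool
cardinalityParity []      = false
cardinalityParity (s ∷ F) = s xor cardinalityParity F

module ColouringSums (K : CommutativeRing 0ℓ 0ℓ) where

  open CommutativeRing K hiding (zero)
  open LinearOperators K
  open import Algebra.Properties.Semiring.Sum semiring using (sum; sum-cong-≋)
  open Over K using (∑colourings; Colouring)

  none : ∀ {n} → Colouring [] n
  none _ ()

  skip : ∀ {m n} {F : Subset m} → Colouring F n → Colouring (outside ∷ F) n
  skip φ (suc a) (thereᵛ a∈F) = φ a a∈F

  extend : ∀ {m n} {F : Subset m} → Fin n → Colouring F n → Colouring (inside ∷ F) n
  extend c φ zero    hereᵛ        = c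
  extend c φ (suc a) (thereᵛ a∈F) = φ a a∈F

  ∑ᶜ : ∀ {m} (F : Subset m) n → (Colouring F n → Carrier) → Carrier
  ∑ᶜ []            n s = s none
  ∑ᶜ (outside ∷ F) n s = ∑ᶜ F n (s ∘ skip)
  ∑ᶜ (inside  ∷ F) n s = sum (λ c → ∑ᶜ F n (s ∘ extend c))

  -- ∑colourings applies its summand s to pattern lambdas in whose scope s
  -- lies; hence a hypothesis on pairs of pointwise equal colourings.
  ∑colourings≈∑ᶜ : ∀ {m} (F : Subset m) n {s t : Colouring F n → Carrier} →
    (∀ {φ φ′} → (∀ a a∈F → φ a a∈F ≡ φ′ a a∈F) → s φ ≈ t φ′) → ∑colourings F n s ≈ ∑ᶜ F n t
  ∑colourings≈∑ᶜ []            n s≈t = s≈t (λ _ ())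
  ∑colourings≈∑ᶜ (outside ∷ F) n s≈t = ∑colourings≈∑ᶜ F n (λ eq → s≈t λ { (suc a) (thereᵛ a∈F) → eq a a∈F })
  ∑colourings≈∑ᶜ (inside  ∷ F) n s≈t = sum-cong-≋ {n} (λ c → ∑colourings≈∑ᶜ F n (λ eq →
    s≈t λ { zero hereᵛ → ≡.refl ; (suc a) (thereᵛ a∈F) → eq a a∈F }))

  ∑ᶜ-linear : ∀ {m} (F : Subset m) n → Linear (λ s (_ : Fin 1) → ∑ᶜ F n s)
  ∑ᶜ-linear []            n = linear-substitution (λ _ → none)
  ∑ᶜ-linear (outside ∷ F) n = linear-∘ (∑ᶜ-linear F n) (linear-substitution skip)
  ∑ᶜ-linear (inside  ∷ F) n = linear-sum (λ c → linear-∘ (∑ᶜ-linear F n) (linear-substitution (extend c)))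

  module _ {m} (F : Subset m) (n : ℕ) where

    open Linear (∑ᶜ-linear F n)

    ∑ᶜ-cong : ∀ {s t : Colouring F n → Carrier} → (∀ φ → s φ ≈ t φ) → ∑ᶜ F n s ≈ ∑ᶜ F n t
    ∑ᶜ-cong eq = cong eq zero

    ∑ᶜ-* : ∀ c (s : Colouring F n → Carrier) → ∑ᶜ F n (λ φ → c * s φ) ≈ c * ∑ᶜ F n s
    ∑ᶜ-* c s = *-homo c s zero

    ∑ᶜ-sum : ∀ {p} (s : Fin p → Colouring F n → Carrier) →
      ∑ᶜ F n (λ φ → sum (λ i → s i φ)) ≈ sum (λ i → ∑ᶜ F n (s i))
    ∑ᶜ-sum s = sum-homo s zero

-- Expansion of the product of edges over the set F of odd edges.

module Expansions (K : CommutativeRing 0ℓ 0ℓ) (k ℓ : ℕ) where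

  open CommutativeRing K hiding (zero)
  open Signs K
  open LinearOperators K
  open SuperWords K
  open Supersymmetric
  open EdgeOperators K k ℓ
  open ColouringSums K
  open import Algebra.Properties.Semiring.Sum semiring using (sum; sum-cong-≋; *-distribˡ-sum)
  open SetoidReasoning setoid
  private module O = Over K
  open O using (Colouring; ∑⊆)
  module C = Peeling odd
  module L = Peeling (oddᴸ {k} {ℓ})

  LWord : Set → Set
  LWord V = List (V × Letter k ℓ)

  embed : Colour → Letter k ℓ
  embed (inj₁ i)        = 𝐞 i
  embed (inj₂ (inj₁ i)) = 𝐟 (i ↑ˡ ℓ)
  embed (inj₂ (inj₂ i)) = 𝐟 (ℓ ↑ʳ i)

  odd-embed : ∀ c → oddᴸ (embed c) ≡ odd c
  odd-embed (inj₁ _)        = ≡.refl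
  odd-embed (inj₂ (inj₁ _)) = ≡.refl
  odd-embed (inj₂ (inj₂ _)) = ≡.refl

  embedWord : {V : Set} → Word V → LWord V
  embedWord = map (Product.map₂ embed)

  -- E does not distinguish 𝐠 j from the letter ± 𝐟 j′ that denotes the same vector.
  record Admissible {V : Set} (E : LWord V → Carrier) : Set where
    field
      super   : Supersymmetric L.oddₗ E
      g-left  : ∀ i u x w → E (u ++ (x , 𝐠 (i ↑ˡ ℓ)) ∷ w) ≈ sg true * E (u ++ (x , 𝐟 (ℓ ↑ʳ i)) ∷ w)
      g-right : ∀ i u x w → E (u ++ (x , 𝐠 (ℓ ↑ʳ i)) ∷ w) ≈ sg false * E (u ++ (x , 𝐟 (i ↑ˡ ℓ)) ∷ w)

  open Admissible

  admissible-prefix : ∀ {V : Set} {E : LWord V → Carrier} v → Admissible E → Admissible (λ w → E (v ++ w))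
  admissible-prefix v A .super = super-prefix (super A) v
  admissible-prefix {E = E} v A .g-left i u x w =
    ≡.subst₂ (λ a b → E a ≈ sg true * E b) (List.++-assoc v u _) (List.++-assoc v u _) (g-left A i (v ++ u) x w)
  admissible-prefix {E = E} v A .g-right i u x w =
    ≡.subst₂ (λ a b → E a ≈ sg false * E b) (List.++-assoc v u _) (List.++-assoc v u _) (g-right A i (v ++ u) x w)

  super-embed : ∀ {V : Set} {E : LWord V → Carrier} → Admissible E → Super (E ∘ embedWord)
  super-embed {E = E} A .swap u a@(_ , c) b@(_ , d) w = trans (swap (super-map (Product.map₂ embed) (super A)) u a b w)
    (*-congʳ (reflexive (≡.cong₂ (λ o o′ → sg (o ∧ o′)) (odd-embed c) (odd-embed d))))

  at : {V : Set} → Maybe V → Letter k ℓ → LWord V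
  at nothing  c = []
  at (just x) c = (x , c) ∷ []

  evens : {V : Set} → Edge V → Fin k → LWord V
  evens circle     i = []
  evens (link x y) i = (x , 𝐞 i) ∷ (y , 𝐞 i) ∷ []

  -- `𝐟` goes to the head and `𝐠` to the tail, because at a vertex f belongs to the incoming and g
  -- to the outgoing arc of a pair.
  odds : {V : Set} → Bool → Edge V → Fin (ℓ ℕ.+ ℓ) → LWord V
  odds forwards e j = at (target forwards e) (𝐟 j) ++ at (source forwards e) (𝐠 j)

  opₑ-embed : ∀ {V : Set} (e : Edge V) (E : LWord V → Carrier) w →
              opₑ e (E ∘ embedWord) w ≈ sum (λ i → E (evens e i ++ embedWord w))
  opₑ-embed circle     E w = sum-cong-≋ {k} (λ i → *-identityˡ (E (embedWord w)))
  opₑ-embed (link x y) E w = sum-cong-≋ (λ i → *-identityˡ (E ((x , 𝐞 i) ∷ (y , 𝐞 i) ∷ embedWord w)))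

  -- The odd part of an edge is symmetric in its ends, so it can be written along either direction;
  -- the second direction is obtained from the first by `opₒ-flip`.
  opₒ-embed : ∀ {V : Set} forwards (e : Edge V) {E : LWord V → Carrier} → Admissible E → ∀ w →
              opₒ e (E ∘ embedWord) w ≈ sg true * sum (λ j → E (odds forwards e j ++ embedWord w))
  opₒ-embed {V} forwards circle {E} A w = begin
    sum {ℓ} (λ _ → sg true * E (embedWord w)) + sum {ℓ} (λ _ → sg true * E (embedWord w))
      ≈⟨ +-cong (*-distribˡ-sum {ℓ} (sg true) (λ _ → E (embedWord w))) (*-distribˡ-sum {ℓ} (sg true) (λ _ → E (embedWord w))) ⟨
    sg true * sum {ℓ} (λ _ → E (embedWord w)) + sg true * sum {ℓ} (λ _ → E (embedWord w))
      ≈⟨ distribˡ (sg true) _ _ ⟨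
    sg true * (sum {ℓ} (λ _ → E (embedWord w)) + sum {ℓ} (λ _ → E (embedWord w)))
      ≈⟨ *-congˡ (sum-splitAt ℓ (λ _ → E (embedWord w))) ⟨
    sg true * sum {ℓ ℕ.+ ℓ} (λ _ → E (embedWord w))
      ≈⟨ *-congˡ (sum-cong-≋ (λ j → reflexive (≡.cong (λ u → E (u ++ embedWord w)) (circle-odds forwards j)))) ⟨
    sg true * sum (λ j → E (odds forwards circle j ++ embedWord w)) ∎
    where
    circle-odds : ∀ forwards j → odds {V} forwards circle j ≡ []
    circle-odds true  j = ≡.refl
    circle-odds false j = ≡.refl
  opₒ-embed false (link x y) {E} A w = begin
    sum (λ i → 1# * E ((x , 𝐟 (i ↑ˡ ℓ)) ∷ (y , 𝐟 (ℓ ↑ʳ i)) ∷ w′)) + sum (λ i → sg true * E ((x , 𝐟 (ℓ ↑ʳ i)) ∷ (y , 𝐟 (i ↑ˡ ℓ)) ∷ w′))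
      ≈⟨ +-cong (sum-cong-≋ (λ i → left i)) (sum-cong-≋ (λ i → right i)) ⟩
    sum (λ i → sg true * t (i ↑ˡ ℓ)) + sum (λ i → sg true * t (ℓ ↑ʳ i))
      ≈⟨ +-cong (*-distribˡ-sum (sg true) (λ i → t (i ↑ˡ ℓ))) (*-distribˡ-sum (sg true) (λ i → t (ℓ ↑ʳ i))) ⟨
    sg true * sum (λ i → t (i ↑ˡ ℓ)) + sg true * sum (λ i → t (ℓ ↑ʳ i))
      ≈⟨ distribˡ (sg true) _ _ ⟨
    sg true * (sum (λ i → t (i ↑ˡ ℓ)) + sum (λ i → t (ℓ ↑ʳ i)))
      ≈⟨ *-congˡ (sum-splitAt ℓ t) ⟨
    sg true * sum t ∎
    where
    w′ = embedWord w
    t : Fin (ℓ ℕ.+ ℓ) → Carrier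
    t j = E ((x , 𝐟 j) ∷ (y , 𝐠 j) ∷ w′)
    left : ∀ i → 1# * E ((x , 𝐟 (i ↑ˡ ℓ)) ∷ (y , 𝐟 (ℓ ↑ʳ i)) ∷ w′) ≈ sg true * t (i ↑ˡ ℓ)
    left i = trans (*-identityˡ _) (sym (trans (*-congˡ (g-left A i ((x , 𝐟 (i ↑ˡ ℓ)) ∷ []) y w′)) (sg-cancel true _)))
    right : ∀ i → sg true * E ((x , 𝐟 (ℓ ↑ʳ i)) ∷ (y , 𝐟 (i ↑ˡ ℓ)) ∷ w′) ≈ sg true * t (ℓ ↑ʳ i)
    right i = *-congˡ (sym (trans (g-right A i ((x , 𝐟 (ℓ ↑ʳ i)) ∷ []) y w′) (*-identityˡ _)))
  opₒ-embed true (link x y) A w = trans (opₒ-flip (super-embed A) x y w) (opₒ-embed false (link y x) A w)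

  ZF : ∀ {V : Set} (es : List (Edge V)) → Subset (length es) → (Word V → Carrier) → Word V → Carrier
  ZF []       []            E = E
  ZF (e ∷ es) (outside ∷ F) E = ZF es F (opₑ e E)
  ZF (e ∷ es) (inside  ∷ F) E = ZF es F (opₒ e E)

  ZF-linear : ∀ {V : Set} (es : List (Edge V)) F → Linear (ZF es F)
  ZF-linear []       []            = linear-substitution (λ w → w)
  ZF-linear (e ∷ es) (outside ∷ F) = linear-∘ (ZF-linear es F) (opₑ-linear e)
  ZF-linear (e ∷ es) (inside  ∷ F) = linear-∘ (ZF-linear es F) (opₒ-linear e)

  open Linear

  ∑⊆-cong : ∀ {m} {s t : Subset m → Carrier} → (∀ F → s F ≈ t F) → ∑⊆ s ≈ ∑⊆ t
  ∑⊆-cong {zero}  eq = eq []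
  ∑⊆-cong {suc m} eq = +-cong (∑⊆-cong (λ F → eq (outside ∷ F))) (∑⊆-cong (λ F → eq (inside ∷ F)))

  Z≈∑⊆ZF : ∀ {V : Set} (es : List (Edge V)) E w → Z es E w ≈ ∑⊆ (λ F → ZF es F E w)
  Z≈∑⊆ZF []       E w = refl
  Z≈∑⊆ZF (e ∷ es) E w = trans (+-homo (Z-linear es) (opₑ e E) (opₒ e E) w)
    (+-cong (Z≈∑⊆ZF es (opₑ e E) w) (Z≈∑⊆ZF es (opₒ e E) w))

  module _ {V : Set} where

    block : (es : List (Edge V)) (F : Subset (length es)) → (Fin (length es) → Bool) →
            Colouring F (ℓ ℕ.+ ℓ) → Colouring (∁ F) k → Fin (length es) → LWord V
    block es F forwards φ ψ a =
      [ (λ a∈F → odds (forwards a) (lookup es a) (φ a a∈F)) , (λ a∉F → evens (lookup es a) (ψ a a∉F)) ]′ (side F a)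

    blocks : (es : List (Edge V)) (F : Subset (length es)) → (Fin (length es) → Bool) →
             Colouring F (ℓ ℕ.+ ℓ) → Colouring (∁ F) k → LWord V
    blocks es F forwards φ ψ = concat (tabulate (block es F forwards φ ψ))

    block-suc : ∀ e es s F forwards φ ψ a → block (e ∷ es) (s ∷ F) forwards φ ψ (suc a)
      ≡ block es F (forwards ∘ suc) (λ a a∈F → φ (suc a) (thereᵛ a∈F)) (λ a a∉F → ψ (suc a) (thereᵛ a∉F)) a
    block-suc e es s F forwards φ ψ a with side F a
    ... | inj₁ _ = ≡.refl
    ... | inj₂ _ = ≡.refl

    concat-tabulate-cong : ∀ {m} u {b b′ : Fin m → LWord V} w → (∀ a → b a ≡ b′ a) →
            u ++ concat (tabulate b′) ++ w ≡ (u ++ concat (tabulate b)) ++ w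
    concat-tabulate-cong u w eq = ≡.trans (≡.cong (λ z → u ++ concat z ++ w) (≡.sym (List.tabulate-cong eq))) (≡.sym (List.++-assoc u _ _))

    -- The sign collects the -1 that each edge of `F` carries in `opₒ-embed`. In the induction, `E`
    -- absorbs the block of the first edge as a prefix.
    ZF-expand : ∀ es F forwards {E : LWord V → Carrier} → Admissible E → ∀ w →
      ZF es F (E ∘ embedWord) w ≈ sg (cardinalityParity F) *
        ∑ᶜ F (ℓ ℕ.+ ℓ) (λ φ → ∑ᶜ (∁ F) k (λ ψ → E (blocks es F forwards φ ψ ++ embedWord w)))
    ZF-expand []       []            forwards A w = sym (*-identityˡ _)
    ZF-expand (e ∷ es) (outside ∷ F) forwards {E} A w = begin
      ZF es F (opₑ e (E ∘ embedWord)) w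
        ≈⟨ cong (ZF-linear es F) (opₑ-embed e E) w ⟩
      ZF es F (λ w → sum (λ i → E (evens e i ++ embedWord w))) w
        ≈⟨ sum-homo (ZF-linear es F) (λ i w → E (evens e i ++ embedWord w)) w ⟩
      sum (λ i → ZF es F (λ w → E (evens e i ++ embedWord w)) w)
        ≈⟨ sum-cong-≋ (λ i → ZF-expand es F (forwards ∘ suc) (admissible-prefix (evens e i) A) w) ⟩
      sum (λ i → sg (cardinalityParity F) * ∑ᶜ F (ℓ ℕ.+ ℓ) (λ φ → ∑ᶜ (∁ F) k (λ ψ → E (evens e i ++ remainder φ ψ))))
        ≈⟨ *-distribˡ-sum (sg (cardinalityParity F)) (λ i → ∑ᶜ F (ℓ ℕ.+ ℓ) (λ φ → ∑ᶜ (∁ F) k (λ ψ → E (evens e i ++ remainder φ ψ)))) ⟨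
      sg (cardinalityParity F) * sum (λ i → ∑ᶜ F (ℓ ℕ.+ ℓ) (λ φ → ∑ᶜ (∁ F) k (λ ψ → E (evens e i ++ remainder φ ψ))))
        ≈⟨ *-congˡ (∑ᶜ-sum F (ℓ ℕ.+ ℓ) (λ i φ → ∑ᶜ (∁ F) k (λ ψ → E (evens e i ++ remainder φ ψ)))) ⟨
      sg (cardinalityParity F) * ∑ᶜ F (ℓ ℕ.+ ℓ) (λ φ → sum (λ i → ∑ᶜ (∁ F) k (λ ψ → E (evens e i ++ remainder φ ψ))))
        ≈⟨ *-congˡ (∑ᶜ-cong F (ℓ ℕ.+ ℓ) (λ φ → sum-cong-≋ (λ i → ∑ᶜ-cong (∁ F) k (λ ψ → reflexive (≡.cong E
             (concat-tabulate-cong (evens e i) (embedWord w) (block-suc e es outside F forwards (skip φ) (extend i ψ)))))))) ⟩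
      sg (cardinalityParity F) * ∑ᶜ F (ℓ ℕ.+ ℓ) (λ φ → sum (λ i → ∑ᶜ (∁ F) k (λ ψ →
        E (blocks (e ∷ es) (outside ∷ F) forwards (skip φ) (extend i ψ) ++ embedWord w)))) ∎
      where
      remainder : Colouring F (ℓ ℕ.+ ℓ) → Colouring (∁ F) k → LWord V
      remainder φ ψ = blocks es F (forwards ∘ suc) φ ψ ++ embedWord w
    ZF-expand (e ∷ es) (inside ∷ F) forwards {E} A w = begin
      ZF es F (opₒ e (E ∘ embedWord)) w
        ≈⟨ cong (ZF-linear es F) (opₒ-embed (forwards zero) e A) w ⟩
      ZF es F (λ w → sg true * sum (λ j → E (o j ++ embedWord w))) w
        ≈⟨ *-homo (ZF-linear es F) (sg true) (λ w → sum (λ j → E (o j ++ embedWord w))) w ⟩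
      sg true * ZF es F (λ w → sum (λ j → E (o j ++ embedWord w))) w
        ≈⟨ *-congˡ (sum-homo (ZF-linear es F) (λ j w → E (o j ++ embedWord w)) w) ⟩
      sg true * sum (λ j → ZF es F (λ w → E (o j ++ embedWord w)) w)
        ≈⟨ *-congˡ (sum-cong-≋ (λ j → ZF-expand es F (forwards ∘ suc) (admissible-prefix (o j) A) w)) ⟩
      sg true * sum (λ j → sg (cardinalityParity F) * ∑ᶜ F (ℓ ℕ.+ ℓ) (λ φ → ∑ᶜ (∁ F) k (λ ψ → E (o j ++ remainder φ ψ))))
        ≈⟨ *-congˡ (*-distribˡ-sum (sg (cardinalityParity F)) (λ j → ∑ᶜ F (ℓ ℕ.+ ℓ) (λ φ → ∑ᶜ (∁ F) k (λ ψ → E (o j ++ remainder φ ψ))))) ⟨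
      sg true * (sg (cardinalityParity F) * sum (λ j → ∑ᶜ F (ℓ ℕ.+ ℓ) (λ φ → ∑ᶜ (∁ F) k (λ ψ → E (o j ++ remainder φ ψ)))))
        ≈⟨ *-assoc (sg true) _ _ ⟨
      sg true * sg (cardinalityParity F) * sum (λ j → ∑ᶜ F (ℓ ℕ.+ ℓ) (λ φ → ∑ᶜ (∁ F) k (λ ψ → E (o j ++ remainder φ ψ))))
        ≈⟨ *-cong (sym (sg-xor true (cardinalityParity F))) (sum-cong-≋ (λ j → ∑ᶜ-cong F (ℓ ℕ.+ ℓ) (λ φ → ∑ᶜ-cong (∁ F) k (λ ψ →
             reflexive (≡.cong E (concat-tabulate-cong (o j) (embedWord w) (block-suc e es inside F forwards (extend j φ) (skip ψ)))))))) ⟩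
      sg (cardinalityParity (inside ∷ F)) * sum (λ j → ∑ᶜ F (ℓ ℕ.+ ℓ) (λ φ → ∑ᶜ (∁ F) k (λ ψ →
        E (blocks (e ∷ es) (inside ∷ F) forwards (extend j φ) (skip ψ) ++ embedWord w)))) ∎
      where
      o : Fin (ℓ ℕ.+ ℓ) → LWord V
      o = odds (forwards zero) e
      remainder : Colouring F (ℓ ℕ.+ ℓ) → Colouring (∁ F) k → LWord V
      remainder φ ψ = blocks es F (forwards ∘ suc) φ ψ ++ embedWord w

-- Colourings take membership proofs as arguments; those returned by `side` have to be identified
-- with those that come from `κ-inside`.
∈-irrelevant : ∀ {m} {F : Subset m} {a} (p q : a ∈ F) → p ≡ q
∈-irrelevant hereᵛ      hereᵛ      = ≡.refl
∈-irrelevant (thereᵛ p) (thereᵛ q) = ≡.cong thereᵛ (∈-irrelevant p q)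

side-∈ : ∀ {m} (F : Subset m) {a} (a∈F : a ∈ F) → side F a ≡ inj₁ a∈F
side-∈ F {a} a∈F with side F a
... | inj₁ a∈F′ = ≡.cong inj₁ (∈-irrelevant a∈F′ a∈F)
... | inj₂ a∉F  = contradiction a∈F (x∈∁p⇒x∉p a∉F)

side-∁ : ∀ {m} (F : Subset m) {a} (a∈∁F : a ∈ ∁ F) → side F a ≡ inj₂ a∈∁F
side-∁ F {a} a∈∁F with side F a
... | inj₁ a∈F   = contradiction a∈F (x∈∁p⇒x∉p a∈∁F)
... | inj₂ a∈∁F′ = ≡.cong inj₂ (∈-irrelevant a∈∁F′ a∈∁F)

transpose-left : ∀ {n} (p q : Fin n) → transpose p q p ≡ q
transpose-left p q with p Fin.≟ p
... | yes _   = ≡.refl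
... | no  neq = contradiction ≡.refl neq

transpose-right : ∀ {n} (p q : Fin n) → transpose p q q ≡ p
transpose-right p q with q Fin.≟ p
... | yes eq = eq
... | no  _ with q Fin.≟ q
...   | yes _   = ≡.refl
...   | no  neq = contradiction ≡.refl neq

transpose-other : ∀ {n} {p q r : Fin n} → r ≢ p → r ≢ q → transpose p q r ≡ r
transpose-other {p = p} {q} {r} r≢p r≢q with r Fin.≟ p
... | yes eq = contradiction eq r≢p
... | no  _ with r Fin.≟ q
...   | yes eq = contradiction eq r≢q
...   | no  _  = ≡.refl

does-sym : ∀ {n} (x y : Fin n) → does (x Fin.≟ y) ≡ does (y Fin.≟ x)
does-sym x y with x Fin.≟ y
... | yes eq  = ≡.sym (dec-true (y Fin.≟ x) (≡.sym eq))
... | no  neq = ≡.sym (dec-false (y Fin.≟ x) (neq ∘ ≡.sym))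

-- Permuting tail blocks between head blocks that stay in place.

module Interleaving {X : Set} where

  interleave : ∀ {m} → (Fin m → List X) → (Fin m → List X) → List X
  interleave A B = concat (tabulate (λ a → A a ++ B a))

  interleave-cong : ∀ {m} (A : Fin m → List X) {B B′ : Fin m → List X} → (∀ a → B a ≡ B′ a) → interleave A B ≡ interleave A B′
  interleave-cong A eq = ≡.cong concat (List.tabulate-cong (λ a → ≡.cong (A a ++_) (eq a)))

  isolate : ∀ {m} (A B : Fin m → List X) q → ∃₂ λ v w →
    ∀ B′ → (∀ r → r ≢ q → B′ r ≡ B r) → interleave A B′ ≡ v ++ B′ q ++ w
  isolate {suc m} A B zero = A zero , interleave (A ∘ suc) (B ∘ suc) , λ B′ agree →
    ≡.trans (List.++-assoc (A zero) (B′ zero) _)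
      (≡.cong (λ z → A zero ++ B′ zero ++ z) (interleave-cong (A ∘ suc) (λ a → agree (suc a) λ ())))
  isolate {suc m} A B (suc q) with isolate (A ∘ suc) (B ∘ suc) q
  ... | v , w , split = (A zero ++ B zero) ++ v , w , λ B′ agree →
    ≡.trans (≡.cong₂ (λ b z → (A zero ++ b) ++ z) (agree zero λ ()) (split (B′ ∘ suc) (λ r r≢q → agree (suc r) (r≢q ∘ Fin.suc-injective))))
      (≡.sym (List.++-assoc (A zero ++ B zero) v _))

  -- One choice of `u`, `v`, `w` must serve both a family and its transposition, hence the
  -- quantification over all `B′` that agree off the two positions.
  isolate₂ : ∀ {m} (A B : Fin m → List X) {p q} → p Fin.< q → ∃[ u ] ∃₂ λ v w →
    ∀ B′ → (∀ r → r ≢ p → r ≢ q → B′ r ≡ B r) → interleave A B′ ≡ u ++ B′ p ++ v ++ B′ q ++ w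
  isolate₂ {suc m} A B {zero} {suc q} p<q with isolate (A ∘ suc) (B ∘ suc) q
  ... | v , w , split = A zero , v , w , λ B′ agree →
    ≡.trans (List.++-assoc (A zero) (B′ zero) _)
      (≡.cong (λ z → A zero ++ B′ zero ++ z) (split (B′ ∘ suc) (λ r r≢q → agree (suc r) (λ ()) (r≢q ∘ Fin.suc-injective))))
  isolate₂ {suc m} A B {suc p} {suc q} (ℕ.s≤s p<q) with isolate₂ (A ∘ suc) (B ∘ suc) p<q
  ... | u , v , w , split = (A zero ++ B zero) ++ u , v , w , λ B′ agree →
    ≡.trans (≡.cong₂ (λ b z → (A zero ++ b) ++ z) (agree zero (λ ()) (λ ()))
        (split (B′ ∘ suc) (λ r r≢p r≢q → agree (suc r) (r≢p ∘ Fin.suc-injective) (r≢q ∘ Fin.suc-injective))))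
      (≡.sym (List.++-assoc (A zero ++ B zero) u _))

module InterleavedTransposition (K : CommutativeRing 0ℓ 0ℓ) {X : Set} (odd : X → Bool) where

  open CommutativeRing K hiding (zero)
  open Signs K
  open SuperWords K
  open Interleaving {X}
  open import Relation.Binary.Definitions using (tri<; tri≈; tri>)

  OddLetter : List X → Set
  OddLetter u = ∃[ x ] u ≡ x ∷ [] × odd x ≡ true

  module _ {E : List X → Carrier} (E-super : Supersymmetric odd E) {m} (A : Fin m → List X) where

    private
      ordered : ∀ B B′ {p q} → p Fin.< q → OddLetter (B p) → OddLetter (B q) →
        B′ p ≡ B q → B′ q ≡ B p → (∀ r → r ≢ p → r ≢ q → B′ r ≡ B r) →
        E (interleave A B) ≈ sg true * E (interleave A B′)
      ordered B B′ {p} {q} p<q (x , Bp , ox) (y , Bq , oy) B′p B′q agree with isolate₂ A B p<q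
      ... | u , v , w , split = ≡.subst₂ (λ s t → E s ≈ sg true * E t)
        (≡.sym (≡.trans (split B (λ _ _ _ → ≡.refl)) (≡.cong₂ (λ s t → u ++ s ++ v ++ t ++ w) Bp Bq)))
        (≡.sym (≡.trans (split B′ agree) (≡.cong₂ (λ s t → u ++ s ++ v ++ t ++ w) (≡.trans B′p Bq) (≡.trans B′q Bp))))
        (transpose-odd E-super ox oy u v w)

    interleave-transpose : ∀ B {p q} → p ≢ q → OddLetter (B p) → OddLetter (B q) →
      E (interleave A B) ≈ sg true * E (interleave A (B ∘ transpose p q))
    interleave-transpose B {p} {q} p≢q odd-p odd-q with Fin.<-cmp p q
    ... | tri≈ _ p≡q _ = contradiction p≡q p≢q
    ... | tri< p<q _ _ = ordered B (B ∘ transpose p q) p<q odd-p odd-q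
          (≡.cong B (transpose-left p q)) (≡.cong B (transpose-right p q)) (λ r r≢p r≢q → ≡.cong B (transpose-other r≢p r≢q))
    ... | tri> _ _ q<p = ordered B (B ∘ transpose p q) q<p odd-q odd-p
          (≡.cong B (transpose-right p q)) (≡.cong B (transpose-left p q)) (λ r r≢q r≢p → ≡.cong B (transpose-other r≢p r≢q))

-- Parities and the letters at a vertex.

oddℕ : ℕ → Bool
oddℕ zero    = false
oddℕ (suc n) = not (oddℕ n)

oddℕ-+ : ∀ m n → oddℕ (m ℕ.+ n) ≡ oddℕ m xor oddℕ n
oddℕ-+ zero    n = ≡.refl
oddℕ-+ (suc m) n = ≡.trans (≡.cong not (oddℕ-+ m n)) (Bool.not-distribˡ-xor (oddℕ m) (oddℕ n))

¬odd⇒even : ∀ n → oddℕ n ≡ false → 2 ∣ n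
¬odd⇒even zero          eq = divides 0 ≡.refl
¬odd⇒even (suc (suc n)) eq with ¬odd⇒even n (≡.trans (≡.sym (Bool.not-involutive (oddℕ n))) eq)
... | divides q n≡2q = divides (suc q) (≡.cong (2 ℕ.+_) n≡2q)

module _ {k ℓ n : ℕ} where

  lettersAt : Fin n → List (Fin n × Letter k ℓ) → List (Letter k ℓ)
  lettersAt v []            = []
  lettersAt v ((x , c) ∷ w) = if does (x Fin.≟ v) then c ∷ lettersAt v w else lettersAt v w

  lettersAt-++ : ∀ v u w → lettersAt v (u ++ w) ≡ lettersAt v u ++ lettersAt v w
  lettersAt-++ v []            w = ≡.refl
  lettersAt-++ v ((x , c) ∷ u) w with does (x Fin.≟ v)
  ... | true  = ≡.cong (c ∷_) (lettersAt-++ v u w)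
  ... | false = lettersAt-++ v u w

-- Sorting the letters of such a word by vertex costs no sign.
data Paired {k ℓ} {V : Set} : List (V × Letter k ℓ) → Set where
  []   : Paired []
  even : ∀ {x c w} → oddᴸ c ≡ false → Paired w → Paired ((x , c) ∷ w)
  pair : ∀ {x c d w} → oddᴸ c ≡ true → oddᴸ d ≡ true → Paired w → Paired ((x , c) ∷ (x , d) ∷ w)

paired-++ : ∀ {k ℓ} {V : Set} {u w : List (V × Letter k ℓ)} → Paired u → Paired w → Paired (u ++ w)
paired-++ []            q = q
paired-++ (even o p)    q = even o (paired-++ p q)
paired-++ (pair o o′ p) q = pair o o′ (paired-++ p q)

-- The mixed partition function as the value on the product of edges.

module PartitionFunctions (K : CommutativeRing 0ℓ 0ℓ) (k ℓ : ℕ) (h : Over.ColouringModel K k ℓ) where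

  open CommutativeRing K hiding (zero)
  open Signs K
  open LinearOperators K
  open SuperWords K
  open EdgeOperators K k ℓ hiding (∑)
  open Expansions K k ℓ
  open VertexFunctional K k ℓ h
  open ColouringSums K
  open AlternatingFunctions K
  open import Algebra.Properties.Semiring.Sum semiring using (sum; sum-cong-≋)
  open import Algebra.Definitions.RawSemiring (RawRing.rawSemiring rawRing) using (_^_)
  open import Algebra.Definitions.RawMonoid *-rawMonoid using () renaming (sum to ∏)
  open SetoidReasoning setoid
  private module O = Over K
  open O using (Colouring; ∑colourings; ι; 1ᵉ; _⊠_; Commutators; Squares; basis)
  open O.Dual h
  open L using (here; there; relabel; inversions; isolateZero; ⨂)

  evaluate : ∀ n → LWord (Fin n) → Carrier
  evaluate = ⨂ vertex

  evaluate-admissible : ∀ n → Admissible (evaluate n)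
  evaluate-admissible n = record
    { super   = L.⨂-super vertex vertex-super n
    ; g-left  = λ i → L.⨂-replace vertex ≡.refl (vertex-g-left i) n
    ; g-right = λ i → L.⨂-replace vertex ≡.refl (vertex-g-right i) n
    }

  evaluate-embed-multiplicative : ∀ m n (u : Word (Fin m)) (w : Word (Fin n)) →
    evaluate (m ℕ.+ n) (embedWord (C.relabel (_↑ˡ n) u ++ C.relabel (m ↑ʳ_) w)) ≈ evaluate m (embedWord u) * evaluate n (embedWord w)
  evaluate-embed-multiplicative m n u w = trans
    (reflexive (≡.cong (evaluate (m ℕ.+ n)) (≡.trans (List.map-++ _ (C.relabel (_↑ˡ n) u) _)
      (≡.cong₂ _++_ (embed-relabel (_↑ˡ n) u) (embed-relabel (m ↑ʳ_) w)))))
    (L.⨂-multiplicative vertex m n (embedWord u) (embedWord w))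
    where
    embed-relabel : ∀ {V W : Set} (g : V → W) (w : Word V) → embedWord (C.relabel g w) ≡ relabel g (embedWord w)
    embed-relabel g []      = ≡.refl
    embed-relabel g (_ ∷ w) = ≡.cong (_ ∷_) (embed-relabel g w)

  here-isolateZero : ∀ {n} (w : LWord (Fin (suc n))) → here (relabel isolateZero w) ≡ lettersAt zero w
  here-isolateZero []                = ≡.refl
  here-isolateZero ((zero  , c) ∷ w) = ≡.cong (c ∷_) (here-isolateZero w)
  here-isolateZero ((suc x , c) ∷ w) = here-isolateZero w

  lettersAt-there : ∀ {n} (v : Fin n) (w : LWord (Fin (suc n))) →
                    lettersAt v (there (relabel isolateZero w)) ≡ lettersAt (suc v) w
  lettersAt-there v []                = ≡.refl
  lettersAt-there v ((zero  , c) ∷ w) = lettersAt-there v w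
  lettersAt-there v ((suc x , c) ∷ w) with does (x Fin.≟ v)
  ... | true  = ≡.cong (c ∷_) (lettersAt-there v w)
  ... | false = lettersAt-there v w

  evaluate-odd : ∀ {n} (v : Fin n) w → parity oddᴸ (lettersAt v w) ≡ true → evaluate n w ≈ 0#
  evaluate-odd zero w odd = trans (*-congˡ (trans (*-congʳ vertex≈0) (zeroˡ _))) (zeroʳ _)
    where
    w₀ = here (relabel isolateZero w)
    vertex≈0 : vertex w₀ ≈ 0#
    vertex≈0 = reflexive (≡.cong (λ b → if b then 0# else ⟦ symmetric w₀ O.⊗ exterior w₀ ⟧)
      (≡.trans (≡.cong (parity oddᴸ) (here-isolateZero w)) odd))
  evaluate-odd (suc v) w odd = trans (*-congˡ (trans (*-congˡ
    (evaluate-odd v (there (relabel isolateZero w)) (≡.trans (≡.cong (parity oddᴸ) (lettersAt-there v w)) odd))) (zeroʳ _))) (zeroʳ _)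

  paired-relabel : ∀ {V W : Set} (g : V → W) {w : LWord V} → Paired w → Paired (relabel g w)
  paired-relabel g []            = []
  paired-relabel g (even o p)    = even o (paired-relabel g p)
  paired-relabel g (pair o o′ p) = pair o o′ (paired-relabel g p)

  paired-here : ∀ {V : Set} {w : LWord (Maybe V)} → Paired w → parity oddᴸ (here w) ≡ false
  paired-here []                           = ≡.refl
  paired-here (even {nothing} o p)         = ≡.cong₂ _xor_ o (paired-here p)
  paired-here (even {just _}  o p)         = paired-here p
  paired-here (pair {nothing} {c} {d} {w} o o′ p) =
    ≡.cong₂ (λ a b → a xor b) o (≡.cong₂ _xor_ o′ (paired-here p))
  paired-here (pair {just _}  o o′ p)      = paired-here p

  paired-there : ∀ {V : Set} {w : LWord (Maybe V)} → Paired w → Paired (there w)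
  paired-there []                      = []
  paired-there (even {nothing} o p)    = paired-there p
  paired-there (even {just _}  o p)    = even o (paired-there p)
  paired-there (pair {nothing} o o′ p) = paired-there p
  paired-there (pair {just _}  o o′ p) = pair o o′ (paired-there p)

  paired-inversions : ∀ {V : Set} {w : LWord (Maybe V)} → Paired w → inversions w ≡ false
  paired-inversions []                      = ≡.refl
  paired-inversions (even {nothing} o p)    = paired-inversions p
  paired-inversions (even {just _}  o p)    = ≡.cong₂ _xor_ (≡.cong (_∧ _) o) (paired-inversions p)
  paired-inversions (pair {nothing} o o′ p) = paired-inversions p
  paired-inversions (pair {just _} {c} {d} {w} o o′ p) = ≡.cong₂ _xor_ (even-here c)
    (≡.cong₂ _xor_ (even-here d) (paired-inversions p))
    where
    even-here : ∀ c → oddᴸ c ∧ parity oddᴸ (here w) ≡ false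
    even-here c = ≡.trans (≡.cong (oddᴸ c ∧_) (paired-here p)) (Bool.∧-zeroʳ (oddᴸ c))

  evaluate-paired : ∀ {n} (w : LWord (Fin n)) → Paired w →
    evaluate n w ≈ ∏ (λ v → ⟦ symmetric (lettersAt v w) O.⊗ exterior (lettersAt v w) ⟧)
  evaluate-paired {zero}  w p = refl
  evaluate-paired {suc n} w p = begin
    sg (inversions w′) * (vertex (here w′) * evaluate n (there w′))
      ≈⟨ trans (*-congʳ (reflexive (≡.cong sg (paired-inversions p′)))) (*-identityˡ _) ⟩
    vertex (here w′) * evaluate n (there w′)
      ≈⟨ *-cong (reflexive vertex-value) (evaluate-paired (there w′) (paired-there p′)) ⟩
    value (lettersAt zero w) * ∏ (λ v → value (lettersAt v (there w′)))
      ≈⟨ *-congˡ (∏-cong (λ v → reflexive (≡.cong value (lettersAt-there v w)))) ⟩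
    ∏ (λ v → value (lettersAt v w)) ∎
    where
    open import Algebra.Properties.Monoid.Sum *-monoid using () renaming (sum-cong-≋ to ∏-cong)
    value : List (Letter k ℓ) → Carrier
    value u = ⟦ symmetric u O.⊗ exterior u ⟧
    w′ = relabel isolateZero w
    p′ = paired-relabel isolateZero p
    vertex-value : vertex (here w′) ≡ value (lettersAt zero w)
    vertex-value = ≡.trans (≡.cong (λ b → if b then 0# else value (here w′)) (paired-here p′))
      (≡.cong value (here-isolateZero w))

  module _ (M : Monoid 0ℓ 0ℓ) where
    private module M = Monoid M

    combine-concat : ∀ {X : Set} (P : List X → M.Carrier) → P [] M.≈ M.ε → (∀ u w → P (u ++ w) M.≈ P u M.∙ P w) →
      ∀ {m} (F : Subset m) (b : Fin m → List X) (q : ∀ a → a ∈ F → M.Carrier) →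
      (∀ a (a∈F : a ∈ F) → P (b a) M.≈ q a a∈F) → (∀ a → a ∉ F → P (b a) M.≈ M.ε) →
      P (concat (tabulate b)) M.≈ combine M.rawMonoid F q
    combine-concat P P-[] P-++ []            b q on off = P-[]
    combine-concat P P-[] P-++ (outside ∷ F) b q on off = M.trans (P-++ (b zero) _) (M.trans
      (M.∙-cong (off zero λ ()) (combine-concat P P-[] P-++ F (b ∘ suc) (λ a a∈F → q (suc a) (thereᵛ a∈F))
        (λ a a∈F → on (suc a) (thereᵛ a∈F)) (λ a a∉F → off (suc a) λ { (thereᵛ a∈F) → a∉F a∈F })))
      (M.identityˡ _))
    combine-concat P P-[] P-++ (inside ∷ F)  b q on off = M.trans (P-++ (b zero) _)
      (M.∙-cong (on zero hereᵛ) (combine-concat P P-[] P-++ F (b ∘ suc) (λ a a∈F → q (suc a) (thereᵛ a∈F))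
        (λ a a∈F → on (suc a) (thereᵛ a∈F)) (λ a a∉F → off (suc a) λ { (thereᵛ a∈F) → a∉F a∈F })))

  power-of-minus-one : ∀ n → (- 1#) ^ n ≈ sg (oddℕ n)
  power-of-minus-one zero    = refl
  power-of-minus-one (suc n) = trans (*-congˡ (power-of-minus-one n)) (sym (sg-xor true (oddℕ n)))

  -- Modulo two, the elements of `F` where `d` holds are all of `F` plus those where it fails, and
  -- it fails only inside `F`. Applied to least elements of cycles, this compares circuits in F with
  -- cycles of `κ` on all edges.
  oddℕ-count : ∀ {m} (F : Subset m) (d : Fin m → Bool) → (∀ a → a ∉ F → d a ≡ true) →
    oddℕ (combine +-0-rawMonoid F (λ a _ → if d a then 1 else 0)) ≡ cardinalityParity F xor xors (λ a → not (d a))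
  oddℕ-count []            d off = ≡.refl
  oddℕ-count (outside ∷ F) d off rewrite off zero (λ ()) = oddℕ-count F (d ∘ suc) (λ a a∉F → off (suc a) λ { (thereᵛ a∈F) → a∉F a∈F })
  oddℕ-count (inside  ∷ F) d off with d zero
    | oddℕ-count F (d ∘ suc) (λ a a∉F → off (suc a) λ { (thereᵛ a∈F) → a∉F a∈F })
  ... | true  | ih = ≡.trans (≡.cong not ih) (Bool.not-distribˡ-xor (cardinalityParity F) _)
  ... | false | ih = ≡.trans ih (≡.trans (≡.sym (Bool.not-involutive _)) (≡.trans
    (≡.cong not (Bool.not-distribˡ-xor (cardinalityParity F) _)) (Bool.not-distribʳ-xor (not (cardinalityParity F)) _)))

  paired-at : ∀ {V : Set} (x : Maybe V) c d → oddᴸ c ≡ true → oddᴸ d ≡ true → Paired (at x c ++ at x d)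
  paired-at nothing  c d o o′ = []
  paired-at (just x) c d o o′ = pair o o′ []

  paired-evens : ∀ {V : Set} (e : Edge V) i → Paired (evens e i)
  paired-evens circle     i = []
  paired-evens (link x y) i = even ≡.refl (even ≡.refl [])

  paired-concat : ∀ {V : Set} {m} (b : Fin m → LWord V) → (∀ a → Paired (b a)) → Paired (concat (tabulate b))
  paired-concat {m = zero}  b p = []
  paired-concat {m = suc m} b p = paired-++ (p zero) (paired-concat (b ∘ suc) (p ∘ suc))

  private
    S-monoid = TensorAlgebraQuotient.quotientMonoid K (Commutators k)
    ⋀-monoid = TensorAlgebraQuotient.quotientMonoid K (Squares (ℓ ℕ.+ ℓ))
    module S = Monoid S-monoid
    module ⋀ = Monoid ⋀-monoid

  open import Algebra.Definitions.RawMonoid (O.multiplication-of (Commutators k)) using () renaming (_×_ to power)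

  module _ {n} (v : Fin n) where

    symmetricAt : LWord (Fin n) → O.Expr k
    symmetricAt w = symmetric (lettersAt v w)

    exteriorAt : LWord (Fin n) → O.Expr (ℓ ℕ.+ ℓ)
    exteriorAt w = exterior (lettersAt v w)

    symmetricAt-++ : ∀ u w → symmetricAt (u ++ w) S.≈ symmetricAt u S.∙ symmetricAt w
    symmetricAt-++ u w = S.trans (S.reflexive (≡.cong symmetric (lettersAt-++ v u w))) (symmetric-++ (lettersAt v u) (lettersAt v w))

    exteriorAt-++ : ∀ u w → exteriorAt (u ++ w) ⋀.≈ exteriorAt u ⋀.∙ exteriorAt w
    exteriorAt-++ u w = ⋀.trans (⋀.reflexive (≡.cong exterior (lettersAt-++ v u w))) (exterior-++ (lettersAt v u) (lettersAt v w))

    symmetricAt-evens : ∀ e i → symmetricAt (evens e i) ≡ power (multiplicity v e) (ι (basis i))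
    symmetricAt-evens circle     i = ≡.refl
    symmetricAt-evens (link x y) i rewrite does-sym v x | does-sym v y with does (x Fin.≟ v) | does (y Fin.≟ v)
    ... | true  | true  = ≡.refl
    ... | true  | false = ≡.refl
    ... | false | true  = ≡.refl
    ... | false | false = ≡.refl

    exteriorAt-evens : ∀ e i → exteriorAt (evens e i) ≡ 1ᵉ
    exteriorAt-evens circle     i = ≡.refl
    exteriorAt-evens (link x y) i with does (x Fin.≟ v) | does (y Fin.≟ v)
    ... | true  | true  = ≡.refl
    ... | true  | false = ≡.refl
    ... | false | true  = ≡.refl
    ... | false | false = ≡.refl

    symmetricAt-pair : ∀ x i j → symmetricAt (at x (𝐟 i) ++ at x (𝐠 j)) ≡ 1ᵉ
    symmetricAt-pair nothing  i j = ≡.refl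
    symmetricAt-pair (just x) i j with does (x Fin.≟ v)
    ... | true  = ≡.refl
    ... | false = ≡.refl

    exteriorAt-pair : ∀ x i j → exteriorAt (at x (𝐟 i) ++ at x (𝐠 j))
      ⋀.≈ (if does (≡-dec Fin._≟_ x (just v)) then O.f {ℓ} i ⊠ O.g {ℓ} j else 1ᵉ)
    exteriorAt-pair nothing  i j = ⋀.refl
    exteriorAt-pair (just x) i j with does (x Fin.≟ v)
    ... | true  = ⋀.∙-cong ⋀.refl (⋀.identityʳ _)
    ... | false = ⋀.refl

  module _ (G : Graph) (F : Subset (Graph.size G)) (ω : EulerianOrientation G F) (pairing : LocalPairing G F ω) where

    open Graph G
    open EulerianOrientation ω using (forwards)
    open LocalPairing pairing
    open Interleaving
    open InterleavedTransposition K (L.oddₗ {Fin order})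

    next-injective : ∀ {x y} → next x ≡ next y → x ≡ y
    next-injective {x} {y} eq = ≡.trans (≡.sym (inverseˡ κ)) (≡.trans (≡.cong (κ ⟨$⟩ˡ_) eq) (inverseˡ κ))

    summand : Colouring F (ℓ ℕ.+ ℓ) → Colouring (∁ F) k → Carrier
    summand φ ψ = ∏ (λ v → ⟦ O.symmetricPart k ℓ h G F ω pairing ψ v O.⊗ O.exteriorPart k ℓ h G F ω pairing φ v ⟧)

    module _ (φ : Colouring F (ℓ ℕ.+ ℓ)) (ψ : Colouring (∁ F) k) where

      -- The letters of an edge outside F stay in place and are therefore counted among the heads;
      -- only the tails are permuted by `κ`.
      heads tails : Fin size → LWord (Fin order)
      heads a = [ (λ a∈F → at (head G forwards a) (𝐟 (φ a a∈F))) , (λ a∉F → evens (edge a) (ψ a a∉F)) ]′ (side F a)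
      tails a = [ (λ a∈F → at (tail G forwards a) (𝐠 (φ a a∈F))) , (λ _ → []) ]′ (side F a)

      paired : Fin size → LWord (Fin order)
      paired a = [ (λ a∈F → at (head G forwards a) (𝐟 (φ a a∈F)) ++ at (head G forwards a) (𝐠 (φ (next a) (κ-inside a∈F))))
                 , (λ a∉F → evens (edge a) (ψ a a∉F)) ]′ (side F a)

      blocks≡interleave : blocks edges F forwards φ ψ ≡ interleave heads tails
      blocks≡interleave = ≡.cong concat (List.tabulate-cong block≡)
        where
        block≡ : ∀ a → block edges F forwards φ ψ a ≡ heads a ++ tails a
        block≡ a with side F a
        ... | inj₁ _ = ≡.refl
        ... | inj₂ _ = ≡.sym (List.++-identityʳ _)

      -- By `κ-meets` the tail of `next a` is the head of `a`, so after the permutation the two odd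
      -- letters of a block lie at the same vertex.
      interleave≡paired : interleave heads (tails ∘ next) ≡ concat (tabulate paired)
      interleave≡paired = ≡.cong concat (List.tabulate-cong paired≡)
        where
        paired≡ : ∀ a → heads a ++ tails (next a) ≡ paired a
        paired≡ a with side F a in eq
        ... | inj₁ a∈F rewrite side-∈ F (κ-inside a∈F) =
          ≡.cong (λ x → at (head G forwards a) (𝐟 (φ a a∈F)) ++ at x (𝐠 (φ (next a) (κ-inside a∈F)))) (≡.sym (κ-meets a∈F))
        ... | inj₂ a∉F rewrite κ-outside (x∈∁p⇒x∉p a∉F) | eq = List.++-identityʳ _

      -- Empty tail blocks occur outside F and at circles, and `κ` fixes both kinds of edges.
      odd-tails : ∀ a → next a ≢ a → OddLetter (tails a)
      odd-tails a moved with side F a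
      ... | inj₂ a∉F = contradiction (κ-outside (x∈∁p⇒x∉p a∉F)) moved
      ... | inj₁ a∈F with edge a in eq | forwards a
      ...   | circle   | _     = contradiction (κ-circle eq) moved
      ...   | link x y | true  = (x , 𝐠 (φ a a∈F)) , ≡.refl , ≡.refl
      ...   | link x y | false = (y , 𝐠 (φ a a∈F)) , ≡.refl , ≡.refl

      evaluate-blocks : evaluate order (blocks edges F forwards φ ψ) ≈ sg (signature next) * evaluate order (concat (tabulate paired))
      evaluate-blocks = begin
        evaluate order (blocks edges F forwards φ ψ)
          ≡⟨ ≡.cong (evaluate order) blocks≡interleave ⟩
        evaluate order (interleave heads tails)
          ≈⟨ alternating OddLetter (λ B → evaluate order (interleave heads B))
               (λ eq → reflexive (≡.cong (evaluate order) (interleave-cong heads eq)))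
               (interleave-transpose (Admissible.super (evaluate-admissible order)) heads)
               next next-injective tails odd-tails ⟩
        sg (signature next) * evaluate order (interleave heads (tails ∘ next))
          ≡⟨ ≡.cong (λ w → sg (signature next) * evaluate order w) interleave≡paired ⟩
        sg (signature next) * evaluate order (concat (tabulate paired)) ∎

      evaluate-paired-blocks : evaluate order (concat (tabulate paired)) ≈ summand φ ψ
      evaluate-paired-blocks = trans (evaluate-paired (concat (tabulate paired)) (paired-concat paired is-paired))
        (∏-cong (λ v → ⟦⟧-cong (O.⊗-cong (symmetric-eq v) (exterior-eq v))))
        where
        open import Algebra.Properties.Monoid.Sum *-monoid using () renaming (sum-cong-≋ to ∏-cong)
        open IsLeftModuleHomomorphism isLinear using (⟦⟧-cong)
        is-paired : ∀ a → Paired (paired a)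
        is-paired a with side F a
        ... | inj₁ a∈F = paired-at (head G forwards a) _ _ ≡.refl ≡.refl
        ... | inj₂ a∉F = paired-evens (edge a) _
        symmetric-eq : ∀ v → symmetricAt v (concat (tabulate paired)) S.≈ O.symmetricPart k ℓ h G F ω pairing ψ v
        symmetric-eq v = combine-concat S-monoid (symmetricAt v) S.refl (symmetricAt-++ v) (∁ F) paired
          (λ a → power (multiplicity v (edge a)) ∘ λ a∉F → ι (basis (ψ a a∉F))) on off
          where
          on : ∀ a (a∉F : a ∈ ∁ F) → symmetricAt v (paired a) S.≈ power (multiplicity v (edge a)) (ι (basis (ψ a a∉F)))
          on a a∉F rewrite side-∁ F a∉F = S.reflexive (symmetricAt-evens v (edge a) (ψ a a∉F))
          off : ∀ a → a ∉ ∁ F → symmetricAt v (paired a) S.≈ S.ε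
          off a ¬a∉F with side F a
          ... | inj₁ a∈F = S.reflexive (symmetricAt-pair v (head G forwards a) _ _)
          ... | inj₂ a∉F = contradiction a∉F ¬a∉F
        exterior-eq : ∀ v → exteriorAt v (concat (tabulate paired)) ⋀.≈ O.exteriorPart k ℓ h G F ω pairing φ v
        exterior-eq v = combine-concat ⋀-monoid (exteriorAt v) ⋀.refl (exteriorAt-++ v) F paired
          (λ a a∈F → if enters G forwards v a then O.f {ℓ} (φ a a∈F) ⊠ O.g {ℓ} (φ (next a) (κ-inside a∈F)) else 1ᵉ) on off
          where
          on : ∀ a (a∈F : a ∈ F) → exteriorAt v (paired a)
            ⋀.≈ (if enters G forwards v a then O.f {ℓ} (φ a a∈F) ⊠ O.g {ℓ} (φ (next a) (κ-inside a∈F)) else 1ᵉ)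
          on a a∈F rewrite side-∈ F a∈F = exteriorAt-pair v (head G forwards a) _ _
          off : ∀ a → a ∉ F → exteriorAt v (paired a) ⋀.≈ ⋀.ε
          off a a∉F with side F a
          ... | inj₁ a∈F  = contradiction a∈F a∉F
          ... | inj₂ a∈∁F = ⋀.reflexive (exteriorAt-evens v (edge a) _)

    circuits-sign : (- 1#) ^ circuits ≈ sg (cardinalityParity F xor signature next)
    circuits-sign = trans (power-of-minus-one circuits)
      (reflexive (≡.cong sg (oddℕ-count F (λ a → does (isLeast? a)) (λ a a∉F → dec-true (isLeast? a) (λ i →
        ≡.subst (a Fin.≤_) (≡.sym (fold-fixed next (κ-outside a∉F) (toℕ i))) ℕₚ.≤-refl)))))

    s≈ZF : O.s k ℓ h G F ω pairing ≈ ZF edges F (evaluate order ∘ embedWord) []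
    s≈ZF = begin
      (- 1#) ^ circuits * ∑colourings F (ℓ ℕ.+ ℓ) (λ φ → ∑colourings (∁ F) k (summand φ))
        ≈⟨ *-cong (trans circuits-sign (sg-xor (cardinalityParity F) (signature next)))
             (∑colourings≈∑ᶜ F (ℓ ℕ.+ ℓ) (λ φ≡φ′ → ∑colourings≈∑ᶜ (∁ F) k (λ ψ≡ψ′ → summand≈ φ≡φ′ ψ≡ψ′))) ⟩
      sg (cardinalityParity F) * sg (signature next) *
        ∑ᶜ F (ℓ ℕ.+ ℓ) (λ φ → ∑ᶜ (∁ F) k (λ ψ → sg (signature next) * E φ ψ))
        ≈⟨ *-congˡ (trans (∑ᶜ-cong F (ℓ ℕ.+ ℓ) (λ φ → ∑ᶜ-* (∁ F) k (sg (signature next)) (E φ)))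
                          (∑ᶜ-* F (ℓ ℕ.+ ℓ) (sg (signature next)) (λ φ → ∑ᶜ (∁ F) k (E φ)))) ⟩
      sg (cardinalityParity F) * sg (signature next) * (sg (signature next) * ∑ᶜ F (ℓ ℕ.+ ℓ) (λ φ → ∑ᶜ (∁ F) k (E φ)))
        ≈⟨ trans (*-assoc _ _ _) (*-congˡ (sg-cancel (signature next) _)) ⟩
      sg (cardinalityParity F) * ∑ᶜ F (ℓ ℕ.+ ℓ) (λ φ → ∑ᶜ (∁ F) k (E φ))
        ≈⟨ ZF-expand edges F forwards (evaluate-admissible order) [] ⟨
      ZF edges F (evaluate order ∘ embedWord) [] ∎
      where
      E : Colouring F (ℓ ℕ.+ ℓ) → Colouring (∁ F) k → Carrier
      E φ ψ = evaluate order (blocks edges F forwards φ ψ ++ [])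
      blocks-cong : ∀ {φ φ′ ψ ψ′} → (∀ a a∈F → φ a a∈F ≡ φ′ a a∈F) → (∀ a a∉F → ψ a a∉F ≡ ψ′ a a∉F) →
                    blocks edges F forwards φ ψ ≡ blocks edges F forwards φ′ ψ′
      blocks-cong {φ} {φ′} {ψ} {ψ′} φ≡φ′ ψ≡ψ′ = ≡.cong concat (List.tabulate-cong block-cong)
        where
        block-cong : ∀ a → block edges F forwards φ ψ a ≡ block edges F forwards φ′ ψ′ a
        block-cong a with side F a
        ... | inj₁ a∈F = ≡.cong (odds (forwards a) (edge a)) (φ≡φ′ a a∈F)
        ... | inj₂ a∉F = ≡.cong (evens (edge a)) (ψ≡ψ′ a a∉F)
      summand≈ : ∀ {φ φ′ ψ ψ′} → (∀ a a∈F → φ a a∈F ≡ φ′ a a∈F) → (∀ a a∉F → ψ a a∉F ≡ ψ′ a a∉F) →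
                 summand φ ψ ≈ sg (signature next) * E φ′ ψ′
      summand≈ {φ} {φ′} {ψ} {ψ′} φ≡φ′ ψ≡ψ′ = begin
        summand φ ψ
          ≈⟨ evaluate-paired-blocks φ ψ ⟨
        evaluate order (concat (tabulate (paired φ ψ)))
          ≈⟨ sg-cancel (signature next) _ ⟨
        sg (signature next) * (sg (signature next) * evaluate order (concat (tabulate (paired φ ψ))))
          ≈⟨ *-congˡ (evaluate-blocks φ ψ) ⟨
        sg (signature next) * evaluate order (blocks edges F forwards φ ψ)
          ≡⟨ ≡.cong (λ w → sg (signature next) * evaluate order w)
               (≡.trans (blocks-cong φ≡φ′ ψ≡ψ′) (≡.sym (List.++-identityʳ _))) ⟩
        sg (signature next) * E φ′ ψ′ ∎

  module _ {n} (v : Fin n) where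

    VanishesAt : Bool → (Word (Fin n) → Carrier) → Set
    VanishesAt p E = ∀ w → parity oddᴸ (lettersAt v (embedWord w)) ≡ p → E w ≈ 0#

    parity-lettersAt-∷ : ∀ x (c : Letter k ℓ) w → parity oddᴸ (lettersAt v ((x , c) ∷ w)) ≡ (does (x Fin.≟ v) ∧ oddᴸ c) xor parity oddᴸ (lettersAt v w)
    parity-lettersAt-∷ x c w with does (x Fin.≟ v)
    ... | true  = ≡.refl
    ... | false = ≡.refl

    oddℕ-multiplicity : ∀ x y → oddℕ (multiplicity v (link x y)) ≡ does (x Fin.≟ v) xor does (y Fin.≟ v)
    oddℕ-multiplicity x y rewrite does-sym v x | does-sym v y with does (x Fin.≟ v) | does (y Fin.≟ v)
    ... | true  | true  = ≡.refl
    ... | true  | false = ≡.refl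
    ... | false | true  = ≡.refl
    ... | false | false = ≡.refl

    term-vanishes : ∀ {p E} → VanishesAt p E → ∀ e w c →
      parity oddᴸ (lettersAt v (embedWord w)) ≡ p xor (odd c ∧ oddℕ (multiplicity v e)) → term e E w c ≈ 0#
    term-vanishes {p} {E} vanishes circle     w c eq = trans (*-congˡ (vanishes w (≡.trans eq
      (≡.trans (≡.cong (p xor_) (Bool.∧-zeroʳ (odd c))) (Bool.xor-identityʳ p))))) (zeroʳ _)
    term-vanishes {p} {E} vanishes (link x y) w c eq = trans (*-congˡ (vanishes _ parity-eq)) (zeroʳ _)
      where
      open xor-∧-Solver
      parity-eq : parity oddᴸ (lettersAt v (embedWord ((x , c) ∷ (y , dual c) ∷ w))) ≡ p
      parity-eq rewrite parity-lettersAt-∷ x (embed c) ((y , embed (dual c)) ∷ embedWord w)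
                      | parity-lettersAt-∷ y (embed (dual c)) (embedWord w)
                      | odd-embed c | odd-embed (dual c) | odd-dual c | eq | oddℕ-multiplicity x y =
        solve 4 (λ x y o p → x :* o :+ (y :* o :+ (p :+ o :* (x :+ y))) := p) ≡.refl (does (x Fin.≟ v)) (does (y Fin.≟ v)) (odd c) p

    opₑ-vanishes : ∀ {p E} → VanishesAt p E → ∀ e → VanishesAt p (opₑ e E)
    opₑ-vanishes {p} vanishes e w eq = sum-zero {k} (λ i → term-vanishes vanishes e w (inj₁ i) (≡.trans eq (≡.sym (Bool.xor-identityʳ p))))

    -- An odd colour puts an odd letter at each end of the edge, so the parity on which the
    -- functional vanishes shifts by the multiplicity of `v`; a loop shifts it twice.
    opₒ-vanishes : ∀ {p E} → VanishesAt p E → ∀ e → VanishesAt (p xor oddℕ (multiplicity v e)) (opₒ e E)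
    opₒ-vanishes vanishes e w eq = trans (+-cong
      (sum-zero {ℓ} (λ i → term-vanishes vanishes e w (inj₂ (inj₁ i)) eq))
      (sum-zero {ℓ} (λ i → term-vanishes vanishes e w (inj₂ (inj₂ i)) eq))) (+-identityʳ 0#)

    ZF-vanishes : ∀ {p E} → VanishesAt p E → ∀ es F → VanishesAt (p xor oddℕ (degree es F v)) (ZF es F E)
    ZF-vanishes {p} vanishes []       []            = λ w eq → vanishes w (≡.trans eq (Bool.xor-identityʳ p))
    ZF-vanishes {p} vanishes (e ∷ es) (outside ∷ F) = ZF-vanishes (opₑ-vanishes vanishes e) es F
    ZF-vanishes {p} vanishes (e ∷ es) (inside  ∷ F) = λ w eq →
      ZF-vanishes (opₒ-vanishes vanishes e) es F w (≡.trans eq (≡.trans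
        (≡.cong (p xor_) (oddℕ-+ (multiplicity v e) (degree es F v)))
        (≡.sym (Bool.xor-assoc p _ _))))

  ¬eulerian⇒ZF≈0 : ∀ G F → ¬ Eulerian G F → ZF (Graph.edges G) F (evaluate (Graph.order G) ∘ embedWord) [] ≈ 0#
  ¬eulerian⇒ZF≈0 G F ¬eulerian with Fin.¬∀⟶∃¬ (Graph.order G) (λ v → 2 ∣ degree (Graph.edges G) F v) (λ v → 2 ∣? degree (Graph.edges G) F v) ¬eulerian
  -- `evaluate` vanishes on words with odd parity at `v`; an odd degree turns this into vanishing on
  -- even parity, which is that of the empty word.
  ... | v , ¬2∣deg = ZF-vanishes v {true} (λ w → evaluate-odd v (embedWord w)) (Graph.edges G) F [] (parity-eq (oddℕ (degree (Graph.edges G) F v)) ≡.refl)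
    where
    parity-eq : ∀ b → oddℕ (degree (Graph.edges G) F v) ≡ b → false ≡ true xor oddℕ (degree (Graph.edges G) F v)
    parity-eq true  eq = ≡.cong not (≡.sym eq)
    parity-eq false eq = contradiction (¬odd⇒even _ eq) ¬2∣deg

  -- Subset by subset: `s≈ZF` evaluates the Eulerian ones, whatever orientation and pairing `choice`
  -- supplies, and the parity argument shows that the others contribute zero to `Z`.
  partitionFunction≈Z : ∀ choice G → O.partitionFunction k ℓ h choice G ≈ Z (Graph.edges G) (evaluate (Graph.order G) ∘ embedWord) []
  partitionFunction≈Z choice G = trans (∑⊆-cong (λ F → subset F (eulerian? G F))) (sym (Z≈∑⊆ZF (Graph.edges G) _ []))
    where
    subset : ∀ F (eulerian : Dec (Eulerian G F)) →
      O.sOfEulerian k ℓ h choice G F eulerian ≈ ZF (Graph.edges G) F (evaluate (Graph.order G) ∘ embedWord) []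
    subset F (yes eulerian)  = let (ω , pairing) = choice G F eulerian in s≈ZF G F ω pairing
    subset F (no  ¬eulerian) = sym (¬eulerian⇒ZF≈0 G F ¬eulerian)

open import Data.Nat using (_+_; _*_; _^_)

theorem6 : (k ℓ : ℕ) (h : ColouringModel k ℓ) (choice : Choice) (t : ℕ) →
    Rank≤ (connectionMatrix (partitionFunction k ℓ h choice) t) ((k + 2 * ℓ) ^ t)
theorem6 k ℓ h choice t = factorization⇒rank≤ reduced 1≉0 _ ((k + 2 * ℓ) ^ t) A B
  (λ F₁ F₂ → trans (partitionFunction≈Z choice (F₁ ⋆ F₂)) (factors F₁ F₂))
  where
  open CommutativeRing ℂ-commutativeRing using (trans)
  open LinearAlgebra ℂ-commutativeRing
  open ComplexNumbers
  open EdgeOperators ℂ-commutativeRing k ℓ using (Word)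
  open Expansions ℂ-commutativeRing k ℓ
  open Gluing ℂ-commutativeRing k ℓ
  open PartitionFunctions ℂ-commutativeRing k ℓ h

  E : ∀ n → Word (Fin n) → ℂ
  E n w = evaluate n (embedWord w)

  factorization = Z-⋆-factorization E evaluate-embed-multiplicative (λ n → super-embed (evaluate-admissible n)) t
  A = proj₁ factorization
  B = proj₁ (proj₂ factorization)
  factors = proj₂ (proj₂ factorization)
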